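{- For every fixed graph $H$ with at least two edges, the threshold bias of the $(1:q)$ Budget $H$-Game on $K_n$ satisfies $q_H^b(n)=\Theta\big(n^{1/m(H)}\big)$ as $n\to\infty$.
   Context: For a graph $H$ with at least two edges, let $v(\cdot)$ and $e(\cdot)$ denote the numbers of vertices and edges, and let $$m(H):=\max_{\substack{H'\subseteq H\\ v(H')\ge 3}}\frac{e(H')-1}{v(H')-2},$$ the maximum being over subgraphs $H'$ of $H$ with at least three vertices. The $(1:q)$ Budget $H$-Game on the complete graph $K_n$ is played by Maker and Breaker, who take alternate turns, with Maker beginning. In her turn, Maker claims one previously unclaimed edge of $K_n$. In his turn, Breaker may claim an arbitrary number (possibly zero) of previously unclaimed edges of $K_n$, subject to the condition that at the end of his turn the total number of edges claimed by Breaker so far is at most $q$ times the total number of edges claimed by Maker so far. Maker wins if at some point she has claimed all edges of a subgraph of $K_n$ isomorphic to $H$. Breaker wins if he manages to claim at least one edge of each such subgraph. The threshold bias $q_H^b(n)$ is the smallest non-negative integer $q$ such that Breaker has a winning strategy in this game. -}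

module Defs where

open import Data.Fin using (Fin; toℕ; finToFun; funToFin) renaming (_<_ to _<ᶠ_)
open import Data.Fin.Properties
  using (any?; all?; finToFun-funToFin; <-cmp; <-asym)
  renaming (_≟_ to _≟ᶠ_; _<?_ to _<ᶠ?_)
open import Data.Fin.Subset
  using (Subset; inside; outside; ⊥; ⁅_⁆; ∁; _∪_; _∩_; _∈_; _∉_; _⊆_; ∣_∣; Nonempty)
open import Data.Fin.Subset.Properties
open import Data.Integer using (+_; 1ℤ) renaming (_-_ to _-ᶻ_; ∣_∣ to ∣_∣ᶻ)
open import Data.List
  using (List; []; _∷_; _++_; map; mapMaybe; filter; length; lookup; allFin; cartesianProduct)
open import Data.List.Extrema using (max)
open import Data.List.Membership.Propositional renaming (_∈_ to _∈ᴸ_) using ()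
open import Data.List.Membership.Propositional.Properties
  using (∈-filter⁺; ∈-filter⁻; ∈-cartesianProduct⁺; ∈-allFin; ∈-lookup)
open import Data.List.Relation.Unary.All using ([]; _∷_)
import Data.List.Relation.Unary.All as All
open import Data.List.Relation.Unary.AllPairs using ([]; _∷_)
open import Data.List.Relation.Unary.Any using (index)
open import Data.List.Relation.Unary.Any.Properties using (lookup-index)
open import Data.List.Relation.Unary.Unique.Propositional using (Unique)
import Data.List.Relation.Unary.Unique.Propositional.Properties as Unique
open import Data.Maybe using (Maybe; just; nothing)
open import Data.Nat
  using (ℕ; zero; suc; _+_; _*_; _^_; _≤_; _<_; _≤?_; z≤n; s≤s; >-nonZero)
open import Data.Nat.Properties
  using (≤-trans; ≤-reflexive; <-irrefl; <⇒≱; +-suc; +-identityʳ; m≤n+m; m≤m*n; +-monoˡ-≤)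
open import Data.Product using (_×_; _,_; ∃; ∃₂; proj₁; proj₂)
open import Data.Rational using (ℚ; 0ℚ; ↥_; ↧ₙ_) renaming (_/_ to _/ℚ_)
open import Data.Rational.Properties using (≤-decTotalOrder)
open import Data.Sum using (_⊎_; inj₁; inj₂)
import Data.Vec as Vec
open import Function using (_∘_; id; _⇔_; mk⇔; Equivalence)
open import Function.Definitions using (Injective)
open import Relation.Binary.Bundles using (DecTotalOrder)
open import Relation.Binary.Definitions using (tri<; tri≈; tri>)
open import Relation.Binary.PropositionalEquality
open import Relation.Nullary
  using (¬_; Dec; yes; no; ¬?; _×-dec_; _⊎-dec_; _→-dec_; contradiction)
open import Relation.Nullary.Decidable using (map′; decidable-stable)
open import Relation.Unary using (Decidable)

------------------------------------------------------------------------
-- Graphs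

-- The edges of Kₙ, each listed once, with its smaller endpoint first.  Opaque
-- only to keep the filter out of the types of edges and edge sets; the three
-- lemmas characterise the list.

opaque
  edges : (n : ℕ) → List (Fin n × Fin n)
  edges n = filter (λ (i , j) → i <ᶠ? j) (cartesianProduct (allFin n) (allFin n))

  edges-unique : ∀ n → Unique (edges n)
  edges-unique n =
    Unique.filter⁺ _ (Unique.cartesianProduct⁺ (Unique.allFin⁺ n) (Unique.allFin⁺ n))

  ∈edges⇒< : ∀ {n} {i j : Fin n} → (i , j) ∈ᴸ edges n → i <ᶠ j
  ∈edges⇒< {n} ij∈ = proj₂ (∈-filter⁻ (λ (i , j) → i <ᶠ? j)
    {xs = cartesianProduct (allFin n) (allFin n)} ij∈)

  <⇒∈edges : ∀ {n} {i j : Fin n} → i <ᶠ j → (i , j) ∈ᴸ edges n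
  <⇒∈edges {i = i} {j} i<j =
    ∈-filter⁺ (λ (i , j) → i <ᶠ? j) (∈-cartesianProduct⁺ (∈-allFin i) (∈-allFin j)) i<j

size : ℕ → ℕ
size n = length (edges n)

Edge : ℕ → Set
Edge n = Fin (size n)

EdgeSet : ℕ → Set
EdgeSet n = Subset (size n)

src tgt : ∀ {n} → Edge n → Fin n
src {n} e = proj₁ (lookup (edges n) e)
tgt {n} e = proj₂ (lookup (edges n) e)

Joins : ∀ {n} → Edge n → Fin n → Fin n → Set
Joins e i j = (src e ≡ i × tgt e ≡ j) ⊎ (src e ≡ j × tgt e ≡ i)

-- A finite simple graph with vertex set Fin v.

record Graph : Set where
  constructor graph
  field
    v : ℕ
    E : EdgeSet v

  e : ℕ
  e = ∣ E ∣

open Graph public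

-- F is the edge set of a subgraph of Kₙ isomorphic to H, the isomorphism
-- being given by φ on vertices.

IsCopyVia : ∀ (H : Graph) {n} → (Fin (v H) → Fin n) → EdgeSet n → Set
IsCopyVia H φ F =
  Injective _≡_ _≡_ φ ×
  (∀ f → f ∈ F ⇔ ∃ λ a → a ∈ E H × Joins f (φ (src a)) (φ (tgt a)))

IsCopy : ∀ (H : Graph) {n} → EdgeSet n → Set
IsCopy H F = ∃ λ φ → IsCopyVia H φ F

------------------------------------------------------------------------
-- The density m(H)

subsets : (n : ℕ) → List (Subset n)
subsets zero    = Vec.[] ∷ []
subsets (suc n) = map (inside Vec.∷_) (subsets n) ++ map (outside Vec.∷_) (subsets n)

-- Subgraphs are not required to be induced or spanning.

IsSubgraph : (H : Graph) → Subset (v H) × EdgeSet (v H) → Set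
IsSubgraph H (W , F) = F ⊆ E H × (∀ a → a ∈ F → src a ∈ W × tgt a ∈ W)

isSubgraph? : (H : Graph) → Decidable (IsSubgraph H)
isSubgraph? H (W , F) =
  (F ⊆? E H) ×-dec all? (λ a → (a ∈? F) →-dec ((src a ∈? W) ×-dec (tgt a ∈? W)))

subgraphs : (H : Graph) → List (Subset (v H) × EdgeSet (v H))
subgraphs H = filter (isSubgraph? H) (cartesianProduct (subsets (v H)) (subsets (size (v H))))

-- (e - 1) / (v - 2), defined for v ≥ 3 only.

ratio : (v e : ℕ) → Maybe ℚ
ratio (suc (suc (suc k))) e = just ((+ e -ᶻ 1ℤ) /ℚ suc k)
ratio _                   _ = nothing

-- If e H ≥ 2, then H itself contributes a positive ratio, so the base value
-- 0ℚ does not affect the maximum.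

m : Graph → ℚ
m H = max (DecTotalOrder.totalOrder ≤-decTotalOrder) 0ℚ (mapMaybe (λ (W , F) → ratio ∣ W ∣ ∣ F ∣) (subgraphs H))

------------------------------------------------------------------------
-- The (1 : q) Budget H-Game on Kₙ

module BudgetGame (H : Graph) (n q : ℕ) where

  HitsEveryCopy : EdgeSet n → Set
  HitsEveryCopy B = ∀ F → IsCopy H F → Nonempty (F ∩ B)

  -- M is Maker's edge set, including the edge she has just claimed, B is
  -- Breaker's edge set, and R is the set of edges Breaker claims in this turn.

  LegalResponse : (M B R : EdgeSet n) → Set
  LegalResponse M B R = R ⊆ ∁ (M ∪ B) × ∣ B ∪ R ∣ ≤ q * ∣ M ∣

  -- The strategies with which Breaker wins from the position in which Maker
  -- owns M, Breaker owns B and Maker is to move.  The game is played until all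
  -- edges are claimed.  A strategy tree assigns a response to every sequence
  -- of Maker's moves, so it may depend on the whole history.  `respond' needs
  -- an unclaimed edge, since otherwise it would hold vacuously on a full board.

  data WinningStrategy (M B : EdgeSet n) : Set where
    finished : (∀ f → f ∈ M ∪ B) → HitsEveryCopy B → WinningStrategy M B
    respond  : (∃ λ f → f ∉ M ∪ B) →
               (∀ f → f ∉ M ∪ B →
                 ∃ λ R → LegalResponse (M ∪ ⁅ f ⁆) B R ×
                         WinningStrategy (M ∪ ⁅ f ⁆) (B ∪ R)) →
               WinningStrategy M B

  BreakerWins : Set
  BreakerWins = WinningStrategy ⊥ ⊥

open BudgetGame using (BreakerWins)

IsThresholdBias : Graph → (n q : ℕ) → Set
IsThresholdBias H n q = BreakerWins H n q × (∀ q′ → BreakerWins H n q′ → q ≤ q′)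

------------------------------------------------------------------------
-- Existence of the threshold bias

-- Winning is decidable

isCopy? : ∀ H {n} → Decidable (IsCopy H {n})
isCopy? H {n} F = map′ to from (any? (λ k → via? (finToFun k)))
  where
  joins? : ∀ (f : Edge n) i j → Dec (Joins f i j)
  joins? f i j = ((src f ≟ᶠ i) ×-dec (tgt f ≟ᶠ j)) ⊎-dec ((src f ≟ᶠ j) ×-dec (tgt f ≟ᶠ i))

  injective? : (φ : Fin (v H) → Fin n) → Dec (Injective _≡_ _≡_ φ)
  injective? φ = map′ (λ h {x} {y} → h x y) (λ h x y → h {x} {y})
    (all? λ x → all? λ y → (φ x ≟ᶠ φ y) →-dec (x ≟ᶠ y))

  via? : (φ : Fin (v H) → Fin n) → Dec (IsCopyVia H φ F)
  via? φ = injective? φ ×-dec all? λ f →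
    let image? = any? (λ a → (a ∈? E H) ×-dec joins? f (φ (src a)) (φ (tgt a)))
    in map′ (λ (s , t) → mk⇔ s t) (λ eq → Equivalence.to eq , Equivalence.from eq)
         (((f ∈? F) →-dec image?) ×-dec (image? →-dec (f ∈? F)))

  via-resp : ∀ {φ ψ} → φ ≗ ψ → IsCopyVia H φ F → IsCopyVia H ψ F
  via-resp {φ} {ψ} φ≗ψ (inj , img) =
    (λ {x} {y} eq → inj (trans (φ≗ψ x) (trans eq (sym (φ≗ψ y))))) ,
    λ f → mk⇔
      (λ f∈F → let (a , a∈E , j) = Equivalence.to (img f) f∈F
               in a , a∈E , subst₂ (Joins f) (φ≗ψ _) (φ≗ψ _) j)
      (λ (a , a∈E , j) → Equivalence.from (img f)
               (a , a∈E , subst₂ (Joins f) (sym (φ≗ψ _)) (sym (φ≗ψ _)) j))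

  to : (∃ λ k → IsCopyVia H (finToFun k) F) → IsCopy H F
  to (k , c) = finToFun k , c

  from : IsCopy H F → ∃ λ k → IsCopyVia H (finToFun k) F
  from (φ , c) = funToFin φ , via-resp (λ x → sym (finToFun-funToFin φ x)) c

module _ (H : Graph) (n q : ℕ) where
  open BudgetGame H n q hiding (BreakerWins)

  hitsEveryCopy? : Decidable HitsEveryCopy
  hitsEveryCopy? B = map′
    (λ ∄ F c → decidable-stable (nonempty? (F ∩ B)) λ ne → ∄ (F , c , ne))
    (λ hits (F , c , ne) → ne (hits F c))
    (¬? (anySubset? λ F → isCopy? H F ×-dec ¬? (nonempty? (F ∩ B))))

  M-grows : ∀ {M B : EdgeSet n} {f} → f ∉ M ∪ B → ∣ M ∣ < ∣ M ∪ ⁅ f ⁆ ∣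
  M-grows {M} {B} {f} f∉ = p⊂q⇒∣p∣<∣q∣
    ( p⊆p∪q ⁅ f ⁆
    , f , q⊆p∪q M ⁅ f ⁆ (x∈⁅x⁆ f) , f∉ ∘ p⊆p∪q B)

  -- k bounds the number of remaining rounds.
  strategy? : ∀ k M B → size n ≤ ∣ M ∣ + k → Dec (WinningStrategy M B)
  strategy? k M B bound with any? (λ f → ¬? (f ∈? M ∪ B))
  ... | no ∄ = map′ (finished full) (λ { (finished _ h) → h ; (respond ∃f _) → contradiction ∃f ∄ })
                 (hitsEveryCopy? B)
    where
    full : ∀ f → f ∈ M ∪ B
    full f = decidable-stable (f ∈? M ∪ B) λ f∉ → ∄ (f , f∉)
  strategy? zero M B bound | yes (f , f∉) =
    contradiction (≤-trans (∣p∣≤n (M ∪ ⁅ f ⁆)) (≤-trans bound (≤-reflexive (+-identityʳ _))))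
                  (<⇒≱ (M-grows {M} {B} f∉))
  strategy? (suc k) M B bound | yes (f₀ , f₀∉) =
    map′ (respond (f₀ , f₀∉))
         (λ { (finished full _) → contradiction (full f₀) f₀∉ ; (respond _ s) → s })
         (all? step)
    where
    step : ∀ f → Dec (f ∉ M ∪ B → ∃ λ R → LegalResponse (M ∪ ⁅ f ⁆) B R ×
                                          WinningStrategy (M ∪ ⁅ f ⁆) (B ∪ R))
    step f with f ∈? M ∪ B
    ... | yes f∈ = yes λ f∉ → contradiction f∈ f∉
    ... | no f∉ = map′ (λ r _ → r) (λ r → r f∉)
      (anySubset? λ R →
        ((R ⊆? ∁ ((M ∪ ⁅ f ⁆) ∪ B)) ×-dec (∣ B ∪ R ∣ ≤? q * ∣ M ∪ ⁅ f ⁆ ∣))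
        ×-dec strategy? k (M ∪ ⁅ f ⁆) (B ∪ R)
          (≤-trans bound (≤-trans (≤-reflexive (+-suc _ k))
            (+-monoˡ-≤ k (M-grows {M} {B} f∉)))))

  breakerWins? : Dec (BreakerWins H n q)
  breakerWins? = strategy? (size n) ⊥ ⊥ (m≤n+m _ _)

-- Breaker wins with bias e(Kₙ)

lookup-injective : ∀ {A : Set} {xs : List A} → Unique xs →
                   ∀ {i j} → lookup xs i ≡ lookup xs j → i ≡ j
lookup-injective (_ ∷ _)  {Fin.zero}  {Fin.zero}  _  = refl
lookup-injective (h ∷ _)  {Fin.zero}  {Fin.suc j} eq = contradiction eq (All.lookup h (∈-lookup j))
lookup-injective (h ∷ _)  {Fin.suc i} {Fin.zero}  eq = contradiction (sym eq) (All.lookup h (∈-lookup i))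
lookup-injective (_ ∷ us) {Fin.suc i} {Fin.suc j} eq = cong Fin.suc (lookup-injective us eq)

edge-≡ : ∀ {n} {a b : Edge n} → src a ≡ src b → tgt a ≡ tgt b → a ≡ b
edge-≡ {n} s t = lookup-injective (edges-unique n) (cong₂ _,_ s t)

src<tgt : ∀ {n} (a : Edge n) → src a <ᶠ tgt a
src<tgt a = ∈edges⇒< (∈-lookup a)

position : ∀ {A : Set} {x : A} {xs : List A} → x ∈ᴸ xs → ∃ λ k → lookup xs k ≡ x
position x∈xs = index x∈xs , sym (lookup-index x∈xs)

edgeBetween : ∀ {n} {i j : Fin n} → i ≢ j → ∃ λ f → Joins f i j
edgeBetween {n} {i} {j} i≢j with <-cmp i j
... | tri≈ _ i≡j _ = contradiction i≡j i≢j
... | tri< i<j _ _ = let (f , eq) = position (<⇒∈edges i<j)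
                     in f , inj₁ (cong proj₁ eq , cong proj₂ eq)
... | tri> _ _ j<i = let (f , eq) = position (<⇒∈edges j<i)
                     in f , inj₂ (cong proj₁ eq , cong proj₂ eq)

joins-unique : ∀ {m n} {φ : Fin m → Fin n} → Injective _≡_ _≡_ φ →
               ∀ {f} {a b : Edge m} → Joins f (φ (src a)) (φ (tgt a)) →
               Joins f (φ (src b)) (φ (tgt b)) → a ≡ b
joins-unique inj (inj₁ (p , q)) (inj₁ (r , s)) =
  edge-≡ (inj (trans (sym p) r)) (inj (trans (sym q) s))
joins-unique inj (inj₂ (p , q)) (inj₂ (r , s)) =
  edge-≡ (inj (trans (sym q) s)) (inj (trans (sym p) r))
joins-unique inj {a = a} {b} (inj₁ (p , q)) (inj₂ (r , s)) =
  contradiction (subst₂ _<ᶠ_ (inj (trans (sym p) r)) (inj (trans (sym q) s)) (src<tgt a))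
                (<-asym (src<tgt b))
joins-unique inj {a = a} {b} (inj₂ (p , q)) (inj₁ (r , s)) =
  contradiction (subst₂ _<ᶠ_ (inj (trans (sym q) s)) (inj (trans (sym p) r)) (src<tgt a))
                (<-asym (src<tgt b))

two-elements : ∀ {n} (p : Subset n) → 2 ≤ ∣ p ∣ → ∃₂ λ a b → a ∈ p × b ∈ p × a ≢ b
two-elements {n} p 2≤p with nonempty? p
... | no ∅ = contradiction (≤-trans 2≤p (≤-reflexive (trans (cong ∣_∣ (Empty-unique ∅)) (∣⊥∣≡0 n)))) λ ()
... | yes (a , a∈p) with any? (λ b → (b ∈? p) ×-dec ¬? (a ≟ᶠ b))
...   | yes (b , b∈p , a≢b) = a , b , a∈p , b∈p , a≢b
...   | no ∄ = contradiction
        (≤-trans 2≤p (≤-trans (p⊆q⇒∣p∣≤∣q∣ p⊆a) (≤-reflexive (∣⁅x⁆∣≡1 a)))) λ { (s≤s ()) }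
  where
  p⊆a : p ⊆ ⁅ a ⁆
  p⊆a {x} x∈p = subst (_∈ ⁅ a ⁆)
    (decidable-stable (a ≟ᶠ x) λ a≢x → ∄ (x , x∈p , a≢x)) (x∈⁅x⁆ a)

image-edge : ∀ H {n} {F : EdgeSet n} ((φ , _) : IsCopy H F) → ∀ a → a ∈ E H →
             ∃ λ g → g ∈ F × Joins g (φ (src a)) (φ (tgt a))
image-edge H (φ , inj , img) a a∈E =
  let (g , j) = edgeBetween λ eq → <-irrefl (cong toℕ (inj eq)) (src<tgt a)
  in g , Equivalence.from (img g) (a , a∈E , j) , j

other : ∀ {n} (F : Subset n) {g h} f → g ∈ F → h ∈ F → g ≢ h → ∃ λ x → x ∈ F × x ≢ f
other F {g} {h} f g∈F h∈F g≢h with g ≟ᶠ f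
... | no g≢f   = g , g∈F , g≢f
... | yes refl = h , h∈F , g≢h ∘ sym

copy-has-other-edge : ∀ H → 2 ≤ e H → ∀ {n} (F : EdgeSet n) → IsCopy H F →
                      ∀ f → ∃ λ g → g ∈ F × g ≢ f
copy-has-other-edge H 2≤e {n} F copy@(φ , inj , _) f =
  let (a , b , a∈E , b∈E , a≢b) = two-elements (E H) 2≤e
      (g , g∈F , jg) = image-edge H copy a a∈E
      (h , h∈F , jh) = image-edge H copy b b∈E
  in other F f g∈F h∈F λ g≡h →
       a≢b (joins-unique inj jg (subst (λ x → Joins x (φ (src b)) (φ (tgt b))) (sym g≡h) jh))

module _ (H : Graph) (2≤e : 2 ≤ e H) (n : ℕ) where
  open BudgetGame H n (size n) hiding (BreakerWins)

  private
    M : Edge n → EdgeSet n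
    M f = ⊥ ∪ ⁅ f ⁆

    rest : Edge n → EdgeSet n
    rest f = ∁ (M f ∪ ⊥)

  rest-within-budget : ∀ f → ∣ ⊥ ∪ rest f ∣ ≤ size n * ∣ M f ∣
  rest-within-budget f =
    ≤-trans (∣p∣≤n (⊥ ∪ rest f)) (m≤m*n (size n) ∣ M f ∣ ⦃ >-nonZero 0<∣M∣ ⦄)
    where
    0<∣M∣ : 0 < ∣ M f ∣
    0<∣M∣ = ≤-trans (≤-reflexive (sym (∣⁅x⁆∣≡1 f))) (p⊆q⇒∣p∣≤∣q∣ (q⊆p∪q ⊥ ⁅ f ⁆))

  others-in-rest : ∀ f {g} → g ≢ f → g ∈ ⊥ ∪ rest f
  others-in-rest f {g} g≢f = q⊆p∪q ⊥ (rest f) (x∉p⇒x∈∁p g∉)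
    where
    g∉ : g ∉ M f ∪ ⊥
    g∉ g∈ with x∈p∪q⁻ (M f) ⊥ g∈
    ... | inj₂ q = ∉⊥ q
    ... | inj₁ p with x∈p∪q⁻ ⊥ ⁅ f ⁆ p
    ...   | inj₁ q = ∉⊥ q
    ...   | inj₂ q = g≢f (x∈⁅y⁆⇒x≡y f q)

  board-full : ∀ f g → g ∈ M f ∪ (⊥ ∪ rest f)
  board-full f g with g ≟ᶠ f
  ... | yes refl = p⊆p∪q (⊥ ∪ rest f) (q⊆p∪q ⊥ ⁅ f ⁆ (x∈⁅x⁆ f))
  ... | no g≢f   = q⊆p∪q (M f) (⊥ ∪ rest f) (others-in-rest f g≢f)

  rest-hits : ∀ f → HitsEveryCopy (⊥ ∪ rest f)
  rest-hits f F copy =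
    let (g , g∈F , g≢f) = copy-has-other-edge H 2≤e F copy f
    in g , x∈p∩q⁺ (g∈F , others-in-rest f g≢f)

  ∉⊥∪⊥ : ∀ (f : Edge n) → f ∉ ⊥ ∪ ⊥
  ∉⊥∪⊥ f f∈ with x∈p∪q⁻ ⊥ ⊥ f∈
  ... | inj₁ p = ∉⊥ p
  ... | inj₂ p = ∉⊥ p

  breakerWins-size : BreakerWins H n (size n)
  breakerWins-size = start (any? λ f → ¬? (f ∈? (⊥ ∪ ⊥)))
    where
    start : Dec (∃ λ (f : Edge n) → f ∉ ⊥ ∪ ⊥) → BreakerWins H n (size n)
    start (yes ∃f) = respond ∃f λ f _ →
      rest f , (id , rest-within-budget f) , finished (board-full f) (rest-hits f)
    start (no ∄) = finished
      (λ f → contradiction (f , ∉⊥∪⊥ f) ∄)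
      (λ F copy → let (a , _ , a∈E , _) = two-elements (E H) 2≤e
                      (f , _) = image-edge H copy a a∈E
                  in contradiction (f , ∉⊥∪⊥ f) ∄)

least : ∀ {P : ℕ → Set} → Decidable P → ∀ k → P k →
        ∃ λ q → P q × (∀ q′ → P q′ → q ≤ q′)
least P? zero    p = zero , p , λ _ _ → z≤n
least {P} P? (suc k) p with P? zero
... | yes p₀ = zero , p₀ , λ _ _ → z≤n
... | no ¬p₀ = let (q , pq , min) = least {P ∘ suc} (P? ∘ suc) k p in
  suc q , pq , λ { zero p′ → contradiction p′ ¬p₀ ; (suc q′) p′ → s≤s (min q′ p′) }

thresholdBias-exists : ∀ H → 2 ≤ e H → ∀ n → ∃ (IsThresholdBias H n)
thresholdBias-exists H 2≤e n = least (breakerWins? H n) (size n) (breakerWins-size H 2≤e n)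

thresholdBias : ∀ H → 2 ≤ e H → ℕ → ℕ
thresholdBias H 2≤e n = proj₁ (thresholdBias-exists H 2≤e n)

thresholdBias-spec : ∀ H (2≤e : 2 ≤ e H) n → IsThresholdBias H n (thresholdBias H 2≤e n)
thresholdBias-spec H 2≤e n = proj₂ (thresholdBias-exists H 2≤e n)

------------------------------------------------------------------------
-- f(n) = Θ(n^{1/r}) as n → ∞, for a positive rational r = a/b: there are
-- positive constants c and C with n^{b/a} ≤ c·f(n) and f(n) ≤ C·n^{b/a} for all
-- large n.  Both sides are raised to the a-th power to avoid roots; taking
-- c and C to be natural numbers loses no generality.

infix 4 _=Θ[n^1/_]

_=Θ[n^1/_] : (ℕ → ℕ) → ℚ → Set
f =Θ[n^1/ r ] =
  ∃ λ c → ∃ λ C → ∃ λ n₀ → 0 < c × 0 < C × (∀ n → n₀ ≤ n →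
    n ^ b ≤ (c * f n) ^ a × f n ^ a ≤ C ^ a * n ^ b)
  where
  a = ∣ ↥ r ∣ᶻ
  b = ↧ₙ r

module Submission where

-- Upper bound.  Let H′ ⊆ H attain m(H), put r = e(H′) − 1, and let x be a large multiple of
-- n^{1/m(H)}.  The danger of a free edge f is the sum of x^{number of Maker's edges in K} over
-- the copies K of H′ through f not hit by Breaker; Breaker claims all edges of danger ≥ x^r.
-- Maker then never completes a copy.  The budget suffices by amortisation: the total weight of
-- the unhit copies that Maker has touched grows by less than x^{r+1} with each Maker edge and
-- drops by at least x^r / 2 with each Breaker edge, so 2x Breaker edges per Maker edge suffice.
--
-- Lower bound.  Split the vertices into v(H) blocks of size k, and let Maker aim, for each edge
-- of H, at T random edges between the two corresponding blocks, where T ≈ k^{2 − 1/m(H)}.  Let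
-- X be the number of copies of H in this sample.  If Breaker wins, then every such copy contains
-- a bad sample: an edge that was already his when Maker aimed at it.  By Cauchy–Schwarz, (E X)²
-- is at most the expected number of bad samples, which is O(q T² / k²), times the expected number
-- of pairs of copies sharing a sample, which is O((E X)² / T) by the definition of m(H).  Hence
-- q is at least a constant multiple of k² / T ≈ k^{1/m(H)}.

open import Data.Bool using (true; false; if_then_else_)
open import Data.Fin using (Fin; zero; suc)
import Data.Fin as Fin
open import Data.Fin.Properties using (any?)
import Data.Fin.Properties as Fin
open import Data.Fin.Subset
  using (Subset; Side; inside; outside; ⊥; ⁅_⁆; ∁; _∪_; _∩_; _-_; _∈_; _∉_; _⊆_; ∣_∣; Nonempty; Empty)
open import Data.Fin.Subset.Properties
import Data.Integer as ℤ
import Data.Integer.Properties as ℤ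
open import Data.List
  using (List; []; _∷_; _++_; map; mapMaybe; filter; length; tabulate; allFin;
         cartesianProductWith; cartesianProduct)
import Data.List as List
open import Data.List.Extrema using (xs≤max; ⊥≤max; argmax-sel)
open import Data.List.Membership.Propositional renaming (_∈_ to _∈ᴸ_) using ()
open import Data.List.Membership.Propositional.Properties
  using (∈-filter⁺; ∈-filter⁻; ∈-map⁺; ∈-++⁺ˡ; ∈-++⁺ʳ; ∈-allFin;
         ∈-cartesianProductWith⁺; ∈-cartesianProduct⁺)
open import Data.List.Properties using (map-∘; map-++; map-tabulate; length-tabulate; tabulate-lookup)
open import Data.List.Relation.Unary.All using (All; []; _∷_)
import Data.List.Relation.Unary.All as All
open import Data.List.Relation.Unary.AllPairs using ([]; _∷_)
open import Data.List.Relation.Unary.Any using (here; there)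
open import Data.List.Relation.Unary.Unique.Propositional using (Unique)
import Data.List.Relation.Unary.Unique.Propositional.Properties as Unique
open import Data.Maybe using (Maybe; just; nothing)
open import Data.Maybe.Properties using (just-injective)
open import Data.Nat hiding (∣_-_∣; _≟_; _/_; _%_)
open import Data.Nat.DivMod using (_/_; m/n*n≤m; m≡m%n+[m/n]*n; m%n<n)
open import Data.Nat.ListAction using (sum; product)
open import Data.Nat.ListAction.Properties using (sum-++)
open import Data.Nat.Properties hiding (_≟_)
open import Data.Nat.Tactic.RingSolver using (solve-∀)
open import Data.Product using (_×_; _,_; ∃; ∃₂; proj₁; proj₂)
open import Data.Product.Properties using (≡-dec)
open import Data.Rational using (ℚ; mkℚ; 0ℚ; ↥_; ↧ₙ_; toℚᵘ) renaming (_/_ to _/ℚ_; _≤_ to _≤ℚ_)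
import Data.Rational.Properties as ℚ
open import Data.Rational.Unnormalised using (mkℚᵘ; *≤*; *≡*) renaming (_≃_ to _≃ᵘ_)
import Data.Rational.Unnormalised.Properties as ℚᵘ
open import Data.Sum using (_⊎_; inj₁; inj₂; map₁)
open import Data.Vec as Vec using (Vec; []; _∷_; lookup)
open import Data.Vec.Properties
  using (lookup∘tabulate; lookup-map; lookup-replicate; lookup⇒[]=; []=⇒lookup)
open import Defs
open import Function using (_∘_; id; mk⇔; Equivalence)
open import Relation.Binary.Bundles using (DecTotalOrder)
open import Relation.Binary.Definitions using (DecidableEquality)
open import Relation.Binary.PropositionalEquality
open import Relation.Nullary
open import Relation.Nullary.Decidable using (decidable-stable; dec-true)
open import Relation.Unary using (Decidable)

-- In the upper bound the sets at stake are copies of H′ and not of H: for a subgraph attaining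
-- m(H), the number of copies through an edge, of order n^{v(H′) - 2}, is of the same order as
-- x^{e(H′) - 1}.
--
-- In the lower bound it is not enough that few samples are bad, since one Breaker edge may spoil
-- many copies; the second moment prevents the copies from concentrating on few samples. Breaker
-- adapts to Maker's moves, but the set he owns when she aims does not depend on the value she is
-- about to draw. With ℓ = e(H), her script has ℓT rounds, so this set contains at most qℓT of the
-- k² possible values, whatever the past.
--
-- Expectations appear as sums over all outcomes, cleared of denominators: N is k², and a block of T
-- samples has N^T outcomes. Cauchy-Schwarz is used as 2xyA ≤ x²P + y²Q for all x and y. This is
-- linear in A, P and Q, so it can be summed over the outcomes before x and y are chosen.

private variable
  A B : Set
  P Q : Set

-- Finite sums and products

∑ : List A → (A → ℕ) → ℕ
∑ xs f = sum (map f xs)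

infix 5 ∑

syntax ∑ xs (λ x → t) = ∑[ x ∈ xs ] t

∏ : ∀ {n} → (Fin n → ℕ) → ℕ
∏ f = product (tabulate f)

∑-cong : ∀ (xs : List A) {f g : A → ℕ} → (∀ x → f x ≡ g x) → ∑ xs f ≡ ∑ xs g
∑-cong []       f≡g = refl
∑-cong (x ∷ xs) f≡g = cong₂ _+_ (f≡g x) (∑-cong xs f≡g)

∑-mono : ∀ (xs : List A) {f g : A → ℕ} → (∀ x → f x ≤ g x) → ∑ xs f ≤ ∑ xs g
∑-mono []       f≤g = z≤n
∑-mono (x ∷ xs) f≤g = +-mono-≤ (f≤g x) (∑-mono xs f≤g)

∑-+ : ∀ (xs : List A) (f g : A → ℕ) → ∑[ x ∈ xs ] (f x + g x) ≡ ∑ xs f + ∑ xs g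
∑-+ []       f g = refl
∑-+ (x ∷ xs) f g rewrite ∑-+ xs f g = lemma (f x) (g x) (∑ xs f) (∑ xs g)
  where
  lemma : ∀ a b c d → (a + b) + (c + d) ≡ (a + c) + (b + d)
  lemma = solve-∀

∑-*ˡ : ∀ (xs : List A) c (f : A → ℕ) → ∑[ x ∈ xs ] c * f x ≡ c * ∑ xs f
∑-*ˡ []       c f = sym (*-zeroʳ c)
∑-*ˡ (x ∷ xs) c f rewrite ∑-*ˡ xs c f = sym (*-distribˡ-+ c (f x) (∑ xs f))

∑-*ʳ : ∀ (xs : List A) c (f : A → ℕ) → ∑[ x ∈ xs ] f x * c ≡ ∑ xs f * c
∑-*ʳ xs c f = trans (∑-cong xs λ x → *-comm (f x) c) (trans (∑-*ˡ xs c f) (*-comm c _))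

∑-const : ∀ (xs : List A) c → ∑[ _ ∈ xs ] c ≡ length xs * c
∑-const []       c = refl
∑-const (x ∷ xs) c = cong (c +_) (∑-const xs c)

∑-zero : ∀ (xs : List A) → ∑[ _ ∈ xs ] 0 ≡ 0
∑-zero xs = trans (∑-const xs 0) (*-zeroʳ (length xs))

∑-++ : ∀ (xs ys : List A) (f : A → ℕ) → ∑ (xs ++ ys) f ≡ ∑ xs f + ∑ ys f
∑-++ xs ys f = trans (cong sum (map-++ f xs ys)) (sum-++ (map f xs) (map f ys))

∑-map : ∀ (g : A → B) (xs : List A) (f : B → ℕ) → ∑ (map g xs) f ≡ ∑ xs (f ∘ g)
∑-map g xs f = cong sum (sym (map-∘ xs))

∑-cartesianProductWith : ∀ {D : Set} (h : A → B → D) xs ys (f : D → ℕ) →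
  ∑ (cartesianProductWith h xs ys) f ≡ ∑[ x ∈ xs ] ∑[ y ∈ ys ] f (h x y)
∑-cartesianProductWith h []       ys f = refl
∑-cartesianProductWith h (x ∷ xs) ys f =
  trans (∑-++ (map (h x) ys) _ f)
        (cong₂ _+_ (∑-map (h x) ys f) (∑-cartesianProductWith h xs ys f))

∑-comm : ∀ (xs : List A) (ys : List B) (f : A → B → ℕ) →
  ∑[ x ∈ xs ] ∑[ y ∈ ys ] f x y ≡ ∑[ y ∈ ys ] ∑[ x ∈ xs ] f x y
∑-comm []       ys f = sym (∑-zero ys)
∑-comm (x ∷ xs) ys f =
  trans (cong (∑ ys (f x) +_) (∑-comm xs ys f)) (sym (∑-+ ys (f x) _))

∑-* : ∀ (xs : List A) (ys : List B) (f : A → ℕ) (g : B → ℕ) →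
  ∑ xs f * ∑ ys g ≡ ∑[ x ∈ xs ] ∑[ y ∈ ys ] f x * g y
∑-* xs ys f g = trans (sym (∑-*ʳ xs (∑ ys g) f)) (∑-cong xs λ x → sym (∑-*ˡ ys (f x) g))

∑-allFin-suc : ∀ {n} (f : Fin (suc n) → ℕ) →
  ∑ (allFin (suc n)) f ≡ f zero + ∑ (allFin n) (f ∘ suc)
∑-allFin-suc {n} f = cong (λ ys → f zero + sum ys)
  (trans (map-tabulate suc f) (sym (map-tabulate (λ i → i) (f ∘ suc))))

∑-tabulate : ∀ {n} (f : Fin n → ℕ) → sum (tabulate f) ≡ ∑ (allFin n) f
∑-tabulate f = cong sum (sym (map-tabulate (λ i → i) f))

length-allFin : ∀ n → length (allFin n) ≡ n
length-allFin n = length-tabulate (λ (i : Fin n) → i)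

∏-cong : ∀ {n} {f g : Fin n → ℕ} → (∀ i → f i ≡ g i) → ∏ f ≡ ∏ g
∏-cong {zero}  f≡g = refl
∏-cong {suc n} f≡g = cong₂ _*_ (f≡g zero) (∏-cong (f≡g ∘ suc))

∏-mono : ∀ {n} {f g : Fin n → ℕ} → (∀ i → f i ≤ g i) → ∏ f ≤ ∏ g
∏-mono {zero}  f≤g = ≤-refl
∏-mono {suc n} f≤g = *-mono-≤ (f≤g zero) (∏-mono (f≤g ∘ suc))

∏-* : ∀ {n} (f g : Fin n → ℕ) → ∏ (λ i → f i * g i) ≡ ∏ f * ∏ g
∏-* {zero}  f g = refl
∏-* {suc n} f g rewrite ∏-* (f ∘ suc) (g ∘ suc) = lemma (f zero) (g zero) _ _
  where
  lemma : ∀ a b c d → (a * b) * (c * d) ≡ (a * c) * (b * d)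
  lemma = solve-∀

∏-const : ∀ n c → ∏ {n} (λ _ → c) ≡ c ^ n
∏-const zero    c = refl
∏-const (suc n) c = cong (c *_) (∏-const n c)

-- Lists of vectors as product spaces

choices : ∀ {n} → Vec (List A) n → List (Vec A n)
choices []         = [] ∷ []
choices (xs ∷ xss) = cartesianProductWith _∷_ xs (choices xss)

vectors : List A → ∀ n → List (Vec A n)
vectors xs n = choices (Vec.replicate n xs)

-- Expansion of the product of the sums. For a uniformly random vector this is the independence of
-- its coordinates; counts of placements and moments over blocks factorise by it.
∑-choices-∏ : ∀ {n} (xss : Vec (List A) n) (f : Fin n → A → ℕ) →
  ∑[ φ ∈ choices xss ] ∏ (λ i → f i (Vec.lookup φ i)) ≡ ∏ (λ i → ∑ (Vec.lookup xss i) (f i))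
∑-choices-∏ []         f = refl
∑-choices-∏ (xs ∷ xss) f =
  trans (∑-cartesianProductWith _∷_ xs (choices xss) _)
    (trans (sym (∑-* xs (choices xss) (f zero) _))
      (cong (∑ xs (f zero) *_) (∑-choices-∏ xss (f ∘ suc))))

∑-vectors-∏ : ∀ n (xs : List A) (f : Fin n → A → ℕ) →
  ∑[ φ ∈ vectors xs n ] ∏ (λ i → f i (Vec.lookup φ i)) ≡ ∏ (λ i → ∑ xs (f i))
∑-vectors-∏ n xs f = trans (∑-choices-∏ (Vec.replicate n xs) f)
  (∏-cong λ i → cong (λ ys → ∑ ys (f i)) (lookup-replicate i xs))

∑-vectors-suc : ∀ n (xs : List A) (f : Vec A (suc n) → ℕ) →
  ∑ (vectors xs (suc n)) f ≡ ∑[ x ∈ xs ] ∑[ φ ∈ vectors xs n ] f (x ∷ φ)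
∑-vectors-suc n xs f = ∑-cartesianProductWith _∷_ xs (vectors xs n) f

length-∑ : ∀ (xs : List A) → length xs ≡ ∑[ _ ∈ xs ] 1
length-∑ xs = sym (trans (∑-const xs 1) (*-identityʳ _))

length-vectors : ∀ (xs : List A) n → length (vectors xs n) ≡ length xs ^ n
length-vectors xs zero    = refl
length-vectors xs (suc n) = begin
  length (vectors xs (suc n))              ≡⟨ length-∑ (vectors xs (suc n)) ⟩
  ∑[ _ ∈ vectors xs (suc n) ] 1            ≡⟨ ∑-vectors-suc n xs _ ⟩
  ∑[ x ∈ xs ] ∑[ _ ∈ vectors xs n ] 1      ≡⟨ ∑-const xs _ ⟩
  length xs * (∑[ _ ∈ vectors xs n ] 1)      ≡⟨ cong (length xs *_) (length-∑ (vectors xs n)) ⟨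
  length xs * length (vectors xs n)        ≡⟨ cong (length xs *_) (length-vectors xs n) ⟩
  length xs ^ suc n                        ∎
  where open ≡-Reasoning

∑-vectors-++ : ∀ (xs : List A) m n (f : Vec A (m + n) → ℕ) →
  ∑[ φ ∈ vectors xs m ] ∑[ ψ ∈ vectors xs n ] f (φ Vec.++ ψ) ≡ ∑ (vectors xs (m + n)) f
∑-vectors-++ xs zero    n f = +-identityʳ _
∑-vectors-++ xs (suc m) n f = trans (∑-vectors-suc m xs _)
  (trans (∑-cong xs λ x → ∑-vectors-++ xs m n (λ φ → f (x ∷ φ))) (sym (∑-vectors-suc (m + n) xs f)))

-- Regroups the ℓ * T rounds of the game as ℓ blocks of T samples.
∑-vectors-concat : ∀ (xs : List A) m n (f : Vec A (m * n) → ℕ) →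
  ∑[ ω ∈ vectors (vectors xs n) m ] f (Vec.concat ω) ≡ ∑ (vectors xs (m * n)) f
∑-vectors-concat xs zero    n f = refl
∑-vectors-concat xs (suc m) n f = trans (∑-vectors-suc m (vectors xs n) _)
  (trans (∑-cong (vectors xs n) λ φ → ∑-vectors-concat xs m n (λ ψ → f (φ Vec.++ ψ)))
         (∑-vectors-++ xs n (m * n) f))

-- Indicators

⟦_⟧ : Dec P → ℕ
⟦ yes _ ⟧ = 1
⟦ no  _ ⟧ = 0

⟦⟧-mono : (p? : Dec P) (q? : Dec Q) → (P → Q) → ⟦ p? ⟧ ≤ ⟦ q? ⟧
⟦⟧-mono (yes p) (yes q) f = ≤-refl
⟦⟧-mono (yes p) (no ¬q) f = contradiction (f p) ¬q
⟦⟧-mono (no ¬p) q?      f = z≤n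

⟦⟧-cong : (p? : Dec P) (q? : Dec Q) → (P → Q) → (Q → P) → ⟦ p? ⟧ ≡ ⟦ q? ⟧
⟦⟧-cong p? q? f g = ≤-antisym (⟦⟧-mono p? q? f) (⟦⟧-mono q? p? g)

⟦⟧-yes : (p? : Dec P) → P → ⟦ p? ⟧ ≡ 1
⟦⟧-yes (yes _) p = refl
⟦⟧-yes (no ¬p) p = contradiction p ¬p

⟦⟧-no : (p? : Dec P) → ¬ P → ⟦ p? ⟧ ≡ 0
⟦⟧-no (yes p) ¬p = contradiction p ¬p
⟦⟧-no (no  _) ¬p = refl

⟦⟧≤1 : (p? : Dec P) → ⟦ p? ⟧ ≤ 1
⟦⟧≤1 (yes _) = ≤-refl
⟦⟧≤1 (no  _) = z≤n

∑-δ-none : ∀ (_≟_ : DecidableEquality A) (xs : List A) (y : A) (f : A → ℕ) →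
           All (y ≢_) xs → ∑[ x ∈ xs ] ⟦ y ≟ x ⟧ * f x ≡ 0
∑-δ-none _≟_ []       y f []         = refl
∑-δ-none _≟_ (x ∷ xs) y f (y≢x ∷ h) rewrite ⟦⟧-no (y ≟ x) y≢x = ∑-δ-none _≟_ xs y f h

∑-δ : ∀ (_≟_ : DecidableEquality A) {xs : List A} {y : A} (f : A → ℕ) →
      Unique xs → y ∈ᴸ xs → ∑[ x ∈ xs ] ⟦ y ≟ x ⟧ * f x ≡ f y
∑-δ _≟_ {x ∷ xs} {y} f (x∉ ∷ u) y∈ with y ≟ x | y∈
... | yes refl | _        rewrite ∑-δ-none _≟_ xs y f x∉ =
  trans (+-identityʳ _) (+-identityʳ _)
... | no y≢x   | here y≡x = contradiction y≡x y≢x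
... | no y≢x   | there y∈′ = ∑-δ _≟_ f u y∈′

∣∣-∑ : ∀ {n} (p : Subset n) → ∣ p ∣ ≡ ∑[ x ∈ allFin n ] ⟦ x ∈? p ⟧
∣∣-∑ []            = refl
∣∣-∑ (inside ∷ p)  = sym (trans (∑-allFin-suc (λ x → ⟦ x ∈? inside ∷ p ⟧)) (cong suc
  (trans (∑-cong (allFin _) (λ x → ⟦⟧-cong (suc x ∈? inside ∷ p) (x ∈? p) drop-there Vec.there))
         (sym (∣∣-∑ p)))))
∣∣-∑ (outside ∷ p) = sym (trans (∑-allFin-suc (λ x → ⟦ x ∈? outside ∷ p ⟧))
  (trans (∑-cong (allFin _) (λ x → ⟦⟧-cong (suc x ∈? outside ∷ p) (x ∈? p) drop-there Vec.there))
         (sym (∣∣-∑ p))))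

-- After splitting by the value of `g`, injectivity lets each element of `p` be counted at most
-- once.
∑-preimage≤∣∣ : ∀ {n} (p : Subset n) {xs : List A} (g : A → Fin n) → Unique xs →
             (∀ {x y} → g x ≡ g y → x ≡ y) → ∑[ x ∈ xs ] ⟦ g x ∈? p ⟧ ≤ ∣ p ∣
∑-preimage≤∣∣ {n = n} p {xs} g u inj = begin
  ∑[ x ∈ xs ] ⟦ g x ∈? p ⟧
    ≡⟨ ∑-cong xs (λ x → sym (∑-δ Fin._≟_ (λ y → ⟦ y ∈? p ⟧) (Unique.allFin⁺ n) (∈-allFin (g x)))) ⟩
  ∑[ x ∈ xs ] ∑[ y ∈ allFin n ] ⟦ g x Fin.≟ y ⟧ * ⟦ y ∈? p ⟧
    ≡⟨ ∑-comm xs (allFin n) _ ⟩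
  ∑[ y ∈ allFin n ] ∑[ x ∈ xs ] ⟦ g x Fin.≟ y ⟧ * ⟦ y ∈? p ⟧
    ≤⟨ ∑-mono (allFin n) (λ y → ≤-trans (≤-reflexive (∑-*ʳ xs ⟦ y ∈? p ⟧ _))
         (≤-trans (*-monoˡ-≤ ⟦ y ∈? p ⟧ (fibre y xs u)) (≤-reflexive (*-identityˡ _)))) ⟩
  ∑[ y ∈ allFin n ] ⟦ y ∈? p ⟧
    ≡⟨ ∣∣-∑ p ⟨
  ∣ p ∣ ∎
  where
  open ≤-Reasoning

  empty : ∀ x xs → All (x ≢_) xs → ∑[ z ∈ xs ] ⟦ g z Fin.≟ g x ⟧ ≡ 0
  empty x []       []         = refl
  empty x (z ∷ xs) (x≢z ∷ h) rewrite ⟦⟧-no (g z Fin.≟ g x) (x≢z ∘ sym ∘ inj) = empty x xs h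

  fibre : ∀ y xs → Unique xs → ∑[ x ∈ xs ] ⟦ g x Fin.≟ y ⟧ ≤ 1
  fibre y []       []       = z≤n
  fibre y (x ∷ xs) (x∉ ∷ u) with g x Fin.≟ y
  ... | yes refl = ≤-reflexive (cong suc (empty x xs x∉))
  ... | no _     = fibre y xs u

-- Breaker's strategy

∣p∪⁅x⁆∣≤ : ∀ {n} (p : Subset n) x → ∣ p ∪ ⁅ x ⁆ ∣ ≤ suc ∣ p ∣
∣p∪⁅x⁆∣≤ (inside  ∷ p) zero    = s≤s (≤-trans (≤-reflexive (cong ∣_∣ (∪-identityʳ p))) (n≤1+n _))
∣p∪⁅x⁆∣≤ (outside ∷ p) zero    = s≤s (≤-reflexive (cong ∣_∣ (∪-identityʳ p)))
∣p∪⁅x⁆∣≤ (inside  ∷ p) (suc x) = s≤s (∣p∪⁅x⁆∣≤ p x)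
∣p∪⁅x⁆∣≤ (outside ∷ p) (suc x) = ∣p∪⁅x⁆∣≤ p x

∣p∩q∪⁅x⁆∣≤ : ∀ {n} (p q : Subset n) x → ∣ p ∩ (q ∪ ⁅ x ⁆) ∣ ≤ suc ∣ p ∩ q ∣
∣p∩q∪⁅x⁆∣≤ p q x = ≤-trans (p⊆q⇒∣p∣≤∣q∣ sub) (∣p∪⁅x⁆∣≤ (p ∩ q) x)
  where
  sub : p ∩ (q ∪ ⁅ x ⁆) ⊆ (p ∩ q) ∪ ⁅ x ⁆
  sub y∈ with x∈p∩q⁻ p (q ∪ ⁅ x ⁆) y∈
  ... | y∈p , y∈q∪x with x∈p∪q⁻ q ⁅ x ⁆ y∈q∪x
  ...   | inj₁ y∈q = x∈p∪q⁺ (inj₁ (x∈p∩q⁺ (y∈p , y∈q)))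
  ...   | inj₂ y∈x = x∈p∪q⁺ (inj₂ y∈x)

x∉p⇒p∩q∪⁅x⁆⊆p∩q : ∀ {n} (p q : Subset n) x → x ∉ p → p ∩ (q ∪ ⁅ x ⁆) ⊆ p ∩ q
x∉p⇒p∩q∪⁅x⁆⊆p∩q p q x x∉p y∈ with x∈p∩q⁻ p (q ∪ ⁅ x ⁆) y∈
... | y∈p , y∈q∪x with x∈p∪q⁻ q ⁅ x ⁆ y∈q∪x
...   | inj₁ y∈q = x∈p∩q⁺ (y∈p , y∈q)
...   | inj₂ y∈x = contradiction (subst (_∈ p) (x∈⁅y⁆⇒x≡y x y∈x) y∈p) x∉p

≤-∑ : ∀ {A : Set} {xs : List A} {x} (f : A → ℕ) → x ∈ᴸ xs → f x ≤ ∑ xs f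
≤-∑ f (here refl) = m≤m+n _ _
≤-∑ {xs = y ∷ _} f (there x∈) = ≤-trans (≤-∑ f x∈) (m≤n+m _ (f y))

-- By `cofinal` it suffices to keep Maker from completing a set of 𝒦. By `large` a set reaches the
-- danger x ^ r before its last edge; by `sparse` the untouched sets account for at most half of
-- that threshold.
module DangerStrategy
  (H : Graph) (n x r : ℕ) .⦃ _ : NonZero x ⦄ (𝒦 : List (EdgeSet n))
  (large : ∀ K → K ∈ᴸ 𝒦 → r < ∣ K ∣)
  (sparse : ∀ f → 2 * (∑[ K ∈ 𝒦 ] ⟦ f ∈? K ⟧) ≤ x ^ r)
  (cofinal : ∀ F → IsCopy H F → ∃ λ K → K ∈ᴸ 𝒦 × K ⊆ F)
  where

  open BudgetGame H n (2 * x)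

  alive? : ∀ (B K : EdgeSet n) → Dec (Empty (K ∩ B))
  alive? B K = ¬? (nonempty? (K ∩ B))

  touched? : ∀ (M K : EdgeSet n) → Dec (Nonempty (K ∩ M))
  touched? M K = nonempty? (K ∩ M)

  power : EdgeSet n → EdgeSet n → ℕ
  power M K = x ^ ∣ K ∩ M ∣

  danger touchedDanger : (M B : EdgeSet n) → Edge n → ℕ
  danger        M B f = ∑[ K ∈ 𝒦 ] ⟦ f ∈? K ⟧ * (⟦ alive? B K ⟧ * power M K)
  touchedDanger M B f =
    ∑[ K ∈ 𝒦 ] ⟦ f ∈? K ⟧ * (⟦ alive? B K ⟧ * (⟦ touched? M K ⟧ * power M K))

  -- Only sets that Maker has touched enter the weight, which therefore starts at 0; the untouched
  -- sets contribute at most half of x ^ r to a danger, by sparseness.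
  weight : (M B : EdgeSet n) → ℕ
  weight M B = ∑[ K ∈ 𝒦 ] ⟦ alive? B K ⟧ * (⟦ touched? M K ⟧ * power M K)

  0<x^r : 0 < x ^ r
  0<x^r = m^n>0 x r

  alive-shrink : ∀ (B : EdgeSet n) f (K : EdgeSet n) → Empty (K ∩ (B ∪ ⁅ f ⁆)) → Empty (K ∩ B)
  alive-shrink B f K al (y , y∈) with x∈p∩q⁻ K B y∈
  ... | y∈K , y∈B = al (y , x∈p∩q⁺ (y∈K , x∈p∪q⁺ (inj₁ y∈B)))

  -- A set through `f` grows by the factor `x` at most, so its new weight is at most `x` times its
  -- share in the danger of `f`, even if it was untouched before.
  weight-Maker : ∀ M B f → weight (M ∪ ⁅ f ⁆) B ≤ weight M B + x * danger M B f
  weight-Maker M B f = ≤-trans (∑-mono 𝒦 step)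
    (≤-reflexive (trans (∑-+ 𝒦 _ _) (cong (weight M B +_) (∑-*ˡ 𝒦 x _))))
    where
    step : ∀ (K : EdgeSet n) → ⟦ alive? B K ⟧ * (⟦ touched? (M ∪ ⁅ f ⁆) K ⟧ * power (M ∪ ⁅ f ⁆) K) ≤
           ⟦ alive? B K ⟧ * (⟦ touched? M K ⟧ * power M K) +
           x * (⟦ f ∈? K ⟧ * (⟦ alive? B K ⟧ * power M K))
    step K with f ∈? K
    ... | yes f∈K = ≤-trans
      (*-monoʳ-≤ ⟦ alive? B K ⟧ (*-mono-≤ (⟦⟧≤1 (touched? (M ∪ ⁅ f ⁆) K))
        (^-monoʳ-≤ x (∣p∩q∪⁅x⁆∣≤ K M f))))
      (≤-trans (≤-reflexive (lemma ⟦ alive? B K ⟧ x (power M K))) (m≤n+m _ _))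
      where
      lemma : ∀ a b c → a * (1 * (b * c)) ≡ b * (1 * (a * c))
      lemma = solve-∀
    ... | no f∉K = ≤-trans
      (*-monoʳ-≤ ⟦ alive? B K ⟧ (*-mono-≤
        (⟦⟧-mono (touched? (M ∪ ⁅ f ⁆) K) (touched? M K) λ (y , y∈) → y , sub y∈)
        (^-monoʳ-≤ x (p⊆q⇒∣p∣≤∣q∣ sub))))
      (m≤m+n _ _)
      where
      sub : K ∩ (M ∪ ⁅ f ⁆) ⊆ K ∩ M
      sub = x∉p⇒p∩q∪⁅x⁆⊆p∩q K M f f∉K

  -- The sets through `f` leave the weight, and what they contributed to it is the touched danger of
  -- `f`.
  weight-Breaker : ∀ M B f → weight M (B ∪ ⁅ f ⁆) + touchedDanger M B f ≤ weight M B
  weight-Breaker M B f = ≤-trans (≤-reflexive (sym (∑-+ 𝒦 _ _))) (∑-mono 𝒦 step)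
    where
    step : ∀ (K : EdgeSet n) → ⟦ alive? (B ∪ ⁅ f ⁆) K ⟧ * (⟦ touched? M K ⟧ * power M K) +
                 ⟦ f ∈? K ⟧ * (⟦ alive? B K ⟧ * (⟦ touched? M K ⟧ * power M K)) ≤
                 ⟦ alive? B K ⟧ * (⟦ touched? M K ⟧ * power M K)
    step K with f ∈? K
    ... | yes f∈K rewrite ⟦⟧-no (alive? (B ∪ ⁅ f ⁆) K)
                            (λ al → al (f , x∈p∩q⁺ (f∈K , x∈p∪q⁺ (inj₂ (x∈⁅x⁆ f)))))
                  = ≤-reflexive (+-identityʳ _)
    ... | no _ = ≤-trans (≤-reflexive (+-identityʳ _))
      (*-monoˡ-≤ _ (⟦⟧-mono (alive? (B ∪ ⁅ f ⁆) K) (alive? B K) (alive-shrink B f K)))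

  -- An untouched set has power x ^ 0 = 1, so the untouched sets through `f` add at most their
  -- number.
  danger-split : ∀ M B f → danger M B f ≤ (∑[ K ∈ 𝒦 ] ⟦ f ∈? K ⟧) + touchedDanger M B f
  danger-split M B f = ≤-trans (∑-mono 𝒦 step) (≤-reflexive (∑-+ 𝒦 _ _))
    where
    step : ∀ (K : EdgeSet n) → ⟦ f ∈? K ⟧ * (⟦ alive? B K ⟧ * power M K) ≤
           ⟦ f ∈? K ⟧ + ⟦ f ∈? K ⟧ * (⟦ alive? B K ⟧ * (⟦ touched? M K ⟧ * power M K))
    step K with touched? M K
    ... | yes _ = ≤-trans
      (≤-reflexive (cong (λ t → ⟦ f ∈? K ⟧ * (⟦ alive? B K ⟧ * t)) (sym (*-identityˡ _)))) (m≤n+m _ _)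
    ... | no em rewrite Empty-unique em | ∣⊥∣≡0 (size n) = ≤-trans
      (*-monoʳ-≤ ⟦ f ∈? K ⟧ (≤-trans (≤-reflexive (*-identityʳ _)) (⟦⟧≤1 (alive? B K))))
      (≤-trans (≤-reflexive (*-identityʳ ⟦ f ∈? K ⟧)) (m≤m+n ⟦ f ∈? K ⟧ _))

  -- A Maker edge adds 2 * x * x ^ r on the right, enough for the rise of twice the weight. A
  -- Breaker edge adds x ^ r on the left, made up for by the fall of twice the weight.
  record Affordable (M B : EdgeSet n) : Set where
    field
      potential : ∣ B ∣ * x ^ r + 2 * weight M B ≤ 2 * x * x ^ r * ∣ M ∣
      incomplete : ∀ K → K ∈ᴸ 𝒦 → Empty (K ∩ B) → ∣ K ∩ M ∣ ≤ r

  open Affordable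

  Settled : (M B : EdgeSet n) → Set
  Settled M B = ∀ f → f ∉ M ∪ B → danger M B f < x ^ r

  MakerMoves : ∀ {M B f} → f ∉ M ∪ B → Affordable M B → Settled M B → Affordable (M ∪ ⁅ f ⁆) B
  MakerMoves {M} {B} {f} f∉ aff settled = record { potential = pot ; incomplete = inc }
    where
    pot : ∣ B ∣ * x ^ r + 2 * weight (M ∪ ⁅ f ⁆) B ≤ 2 * x * x ^ r * ∣ M ∪ ⁅ f ⁆ ∣
    pot = begin
      ∣ B ∣ * x ^ r + 2 * weight (M ∪ ⁅ f ⁆) B
        ≤⟨ +-monoʳ-≤ (∣ B ∣ * x ^ r) (*-monoʳ-≤ 2 (≤-trans (weight-Maker M B f)
             (+-monoʳ-≤ (weight M B) (*-monoʳ-≤ x (<⇒≤ (settled f f∉)))))) ⟩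
      ∣ B ∣ * x ^ r + 2 * (weight M B + x * x ^ r)
        ≡⟨ lemma₁ (∣ B ∣ * x ^ r) (weight M B) (x * x ^ r) ⟩
      (∣ B ∣ * x ^ r + 2 * weight M B) + 2 * (x * x ^ r)
        ≤⟨ +-monoˡ-≤ (2 * (x * x ^ r)) (potential aff) ⟩
      2 * x * x ^ r * ∣ M ∣ + 2 * (x * x ^ r)
        ≡⟨ lemma₂ x (x ^ r) ∣ M ∣ ⟩
      2 * x * x ^ r * suc ∣ M ∣
        ≤⟨ *-monoʳ-≤ (2 * x * x ^ r) (M-grows H n (2 * x) {M} {B} f∉) ⟩
      2 * x * x ^ r * ∣ M ∪ ⁅ f ⁆ ∣ ∎
      where
      open ≤-Reasoning
      lemma₁ : ∀ a b c → a + 2 * (b + c) ≡ (a + 2 * b) + 2 * c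
      lemma₁ = solve-∀
      lemma₂ : ∀ a b c → 2 * a * b * c + 2 * (a * b) ≡ 2 * a * b * (1 + c)
      lemma₂ = solve-∀

    inc : ∀ K → K ∈ᴸ 𝒦 → Empty (K ∩ B) → ∣ K ∩ (M ∪ ⁅ f ⁆) ∣ ≤ r
    inc K K∈ al with f ∈? K
    ... | no f∉K = ≤-trans (p⊆q⇒∣p∣≤∣q∣ (x∉p⇒p∩q∪⁅x⁆⊆p∩q K M f f∉K)) (incomplete aff K K∈ al)
    -- If K already had `r` Maker edges, its single term would make the free edge `f` dangerous,
    -- against `Settled`.
    ... | yes f∈K = ≤-trans (∣p∩q∪⁅x⁆∣≤ K M f) (≰⇒> λ r≤ → <⇒≱ (settled f f∉) (begin
      x ^ r                                          ≤⟨ ^-monoʳ-≤ x r≤ ⟩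
      power M K                                      ≡⟨ *-identityˡ _ ⟨
      1 * power M K                                  ≡⟨ *-identityˡ _ ⟨
      1 * (1 * power M K)                            ≡⟨ cong₂ (λ a b → a * (b * power M K))
                                                         (⟦⟧-yes (f ∈? K) f∈K) (⟦⟧-yes (alive? B K) al) ⟨
      ⟦ f ∈? K ⟧ * (⟦ alive? B K ⟧ * power M K)      ≤⟨ ≤-∑ _ K∈ ⟩
      danger M B f ∎))
      where open ≤-Reasoning

  -- At most half of x ^ r comes from untouched sets, so at least half of it is touched danger
  -- (`half`). Claiming `f` removes this from the weight, which pays for one more Breaker edge.
  BreakerClaims : ∀ {M B f} → x ^ r ≤ danger M B f → Affordable M B → Affordable M (B ∪ ⁅ f ⁆)
  BreakerClaims {M} {B} {f} x^r≤ aff = record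
    { potential = pot
    ; incomplete = λ K K∈ al → incomplete aff K K∈ (alive-shrink B f K al) }
    where
    half : x ^ r ≤ 2 * touchedDanger M B f
    half = +-cancelˡ-≤ (x ^ r) _ _ (begin
      x ^ r + x ^ r                     ≡⟨ cong (x ^ r +_) (+-identityʳ (x ^ r)) ⟨
      2 * x ^ r                         ≤⟨ *-monoʳ-≤ 2 (≤-trans x^r≤ (danger-split M B f)) ⟩
      2 * ((∑[ K ∈ 𝒦 ] ⟦ f ∈? K ⟧) + touchedDanger M B f)
                                        ≡⟨ *-distribˡ-+ 2 (∑[ K ∈ 𝒦 ] ⟦ f ∈? K ⟧) (touchedDanger M B f) ⟩
      2 * (∑[ K ∈ 𝒦 ] ⟦ f ∈? K ⟧) + 2 * touchedDanger M B f
                                        ≤⟨ +-monoˡ-≤ _ (sparse f) ⟩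
      x ^ r + 2 * touchedDanger M B f   ∎)
      where open ≤-Reasoning

    pot : ∣ B ∪ ⁅ f ⁆ ∣ * x ^ r + 2 * weight M (B ∪ ⁅ f ⁆) ≤ 2 * x * x ^ r * ∣ M ∣
    pot = begin
      ∣ B ∪ ⁅ f ⁆ ∣ * x ^ r + 2 * weight M (B ∪ ⁅ f ⁆)
        ≤⟨ +-monoˡ-≤ _ (*-monoˡ-≤ (x ^ r) (∣p∪⁅x⁆∣≤ B f)) ⟩
      (x ^ r + ∣ B ∣ * x ^ r) + 2 * weight M (B ∪ ⁅ f ⁆)
        ≤⟨ +-monoˡ-≤ _ (+-monoˡ-≤ _ half) ⟩
      (2 * touchedDanger M B f + ∣ B ∣ * x ^ r) + 2 * weight M (B ∪ ⁅ f ⁆)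
        ≡⟨ lemma (touchedDanger M B f) (∣ B ∣ * x ^ r) (weight M (B ∪ ⁅ f ⁆)) ⟩
      ∣ B ∣ * x ^ r + 2 * (weight M (B ∪ ⁅ f ⁆) + touchedDanger M B f)
        ≤⟨ +-monoʳ-≤ (∣ B ∣ * x ^ r) (*-monoʳ-≤ 2 (weight-Breaker M B f)) ⟩
      ∣ B ∣ * x ^ r + 2 * weight M B
        ≤⟨ potential aff ⟩
      2 * x * x ^ r * ∣ M ∣ ∎
      where
      open ≤-Reasoning
      lemma : ∀ a b c → (2 * a + b) + 2 * c ≡ b + 2 * (c + a)
      lemma = solve-∀

  -- Dangerous edges are claimed one by one until none is left; `k` bounds the number of edges not
  -- yet Breaker's. Every claim preserves `Affordable`, so the budget is checked only once, after
  -- the turn.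
  settle : ∀ k M B → size n ≤ ∣ B ∣ + k → Affordable M B →
           ∃ λ R → R ⊆ ∁ (M ∪ B) × Affordable M (B ∪ R) × Settled M (B ∪ R)
  settle k M B bound aff with any? (λ f → ¬? (f ∈? M ∪ B) ×-dec (x ^ r ≤? danger M B f))
  ... | no ∄ = ⊥ , (λ y∈ → contradiction y∈ ∉⊥) ,
    subst (λ B′ → Affordable M B′ × Settled M B′) (sym (∪-identityʳ B))
      (aff , λ f f∉ → ≰⇒> λ x^r≤ → ∄ (f , f∉ , x^r≤))
  settle zero M B bound aff | yes (f , f∉ , _) =
    contradiction (p⊆q⇒∣p∣≤∣q∣ {p = B ∪ ⁅ f ⁆} {q = B} (λ _ → full)) (<⇒≱ grows)
    where
    grows : ∣ B ∣ < ∣ B ∪ ⁅ f ⁆ ∣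
    grows = M-grows H n (2 * x) {B} {M} (f∉ ∘ subst (f ∈_) (∪-comm B M))
    full : ∀ {y} → y ∈ B
    full {y} = subst (y ∈_) (sym (∣p∣≡n⇒p≡⊤ (≤-antisym (∣p∣≤n B)
      (≤-trans bound (≤-reflexive (+-identityʳ _)))))) ∈⊤
  settle (suc k) M B bound aff | yes (f , f∉ , x^r≤) =
    let (R , R⊆ , pos) = settle k M (B ∪ ⁅ f ⁆)
          (≤-trans bound (≤-trans (≤-reflexive (+-suc ∣ B ∣ k)) (+-monoˡ-≤ k grows)))
          (BreakerClaims x^r≤ aff)
    in ⁅ f ⁆ ∪ R , legal R R⊆ ,
       subst (λ B′ → Affordable M B′ × Settled M B′) (∪-assoc B ⁅ f ⁆ R) pos
    where
    grows : ∣ B ∣ < ∣ B ∪ ⁅ f ⁆ ∣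
    grows = M-grows H n (2 * x) {B} {M} (f∉ ∘ subst (f ∈_) (∪-comm B M))
    legal : ∀ R → R ⊆ ∁ (M ∪ (B ∪ ⁅ f ⁆)) → ⁅ f ⁆ ∪ R ⊆ ∁ (M ∪ B)
    legal R R⊆ y∈ with x∈p∪q⁻ ⁅ f ⁆ R y∈
    ... | inj₁ y∈f = x∉p⇒x∈∁p (subst (_∉ M ∪ B) (sym (x∈⁅y⁆⇒x≡y f y∈f)) f∉)
    ... | inj₂ y∈R = x∉p⇒x∈∁p λ y∈MB →
      x∈∁p⇒x∉p (R⊆ y∈R) (subst (_ ∈_) (∪-assoc M B ⁅ f ⁆) (x∈p∪q⁺ (inj₁ y∈MB)))

  within-budget : ∀ {M B} → Affordable M B → ∣ B ∣ ≤ 2 * x * ∣ M ∣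
  within-budget {M} {B} aff = *-cancelʳ-≤ ∣ B ∣ _ (x ^ r) ⦃ >-nonZero 0<x^r ⦄
    (≤-trans (m≤m+n _ _) (≤-trans (potential aff) (≤-reflexive (lemma (2 * x) (x ^ r) ∣ M ∣))))
    where
    lemma : ∀ a b c → a * b * c ≡ a * c * b
    lemma = solve-∀

  -- If Breaker missed F, he also missed some K inside F; on a full board all of K, more than `r`
  -- edges, would be Maker's.
  hits : ∀ {M B} → (∀ f → f ∈ M ∪ B) → Affordable M B → HitsEveryCopy B
  hits {M} {B} full aff F copy = decidable-stable (nonempty? (F ∩ B)) λ em →
    let (K , K∈ , K⊆F) = cofinal F copy
        al : Empty (K ∩ B)
        al = λ (y , y∈) → let (y∈K , y∈B) = x∈p∩q⁻ K B y∈ in em (y , x∈p∩q⁺ (K⊆F y∈K , y∈B))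
        K⊆ : K ⊆ K ∩ M
        K⊆ = λ {y} y∈K → x∈p∩q⁺ (y∈K , inM al y y∈K (x∈p∪q⁻ M B (full y)))
    in <⇒≱ (large K K∈) (≤-trans (p⊆q⇒∣p∣≤∣q∣ K⊆) (incomplete aff K K∈ al))
    where
    inM : ∀ {K : EdgeSet n} → Empty (K ∩ B) → ∀ y → y ∈ K → y ∈ M ⊎ y ∈ B → y ∈ M
    inM al y y∈K (inj₁ y∈M) = y∈M
    inM al y y∈K (inj₂ y∈B) = contradiction (y , x∈p∩q⁺ (y∈K , y∈B)) al

  strategy : ∀ k M B → size n ≤ ∣ M ∣ + k → Affordable M B → Settled M B → WinningStrategy M B
  strategy k M B bound aff settled with any? (λ f → ¬? (f ∈? M ∪ B))
  ... | no ∄ = finished full (hits full aff)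
    where
    full : ∀ f → f ∈ M ∪ B
    full f = decidable-stable (f ∈? M ∪ B) λ f∉ → ∄ (f , f∉)
  strategy zero M B bound aff settled | yes (f , f∉) =
    contradiction (≤-trans (∣p∣≤n (M ∪ ⁅ f ⁆)) (≤-trans bound (≤-reflexive (+-identityʳ _))))
                  (<⇒≱ (M-grows H n (2 * x) {M} {B} f∉))
  strategy (suc k) M B bound aff settled | yes ∃f = respond ∃f λ f f∉ →
    let (R , R⊆ , aff′ , settled′) = settle (size n) (M ∪ ⁅ f ⁆) B (m≤n+m _ _)
                                        (MakerMoves f∉ aff settled)
    in R , (R⊆ , within-budget aff′) ,
       strategy k (M ∪ ⁅ f ⁆) (B ∪ R)
         (≤-trans bound (≤-trans (≤-reflexive (+-suc ∣ M ∣ k))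
           (+-monoˡ-≤ k (M-grows H n (2 * x) {M} {B} f∉))))
         aff′ settled′

  breakerWins : BreakerWins
  breakerWins = strategy (size n) ⊥ ⊥ (m≤n+m _ _)
    (record { potential = pot ; incomplete = λ K _ _ → ≤-trans (≤-reflexive (∣K∩⊥∣≡0 K)) z≤n })
    -- On the empty board all powers are 1, so the danger of `f` is at most the number of sets
    -- through it, hence at most half of x ^ r.
    λ f _ → *-cancelˡ-< 2 _ _ (≤-trans (s≤s (≤-trans (*-monoʳ-≤ 2 (dang f)) (sparse f)))
      (m<m+n (x ^ r) (subst (0 <_) (sym (+-identityʳ _)) 0<x^r)))
    where
    ∣K∩⊥∣≡0 : ∀ (K : EdgeSet n) → ∣ K ∩ ⊥ ∣ ≡ 0
    ∣K∩⊥∣≡0 K = trans (cong ∣_∣ (∩-zeroʳ K)) (∣⊥∣≡0 (size n))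

    untouched : ∀ (K : EdgeSet n) → ¬ Nonempty (K ∩ ⊥)
    untouched K (y , y∈) = ∉⊥ (proj₂ (x∈p∩q⁻ K ⊥ y∈))

    weight≡0 : weight ⊥ ⊥ ≡ 0
    weight≡0 = trans (∑-cong 𝒦 λ K →
      trans (cong (λ t → ⟦ alive? ⊥ K ⟧ * (t * power ⊥ K)) (⟦⟧-no (touched? ⊥ K) (untouched K)))
            (*-zeroʳ ⟦ alive? ⊥ K ⟧)) (∑-zero 𝒦)

    pot : ∣ ⊥ {size n} ∣ * x ^ r + 2 * weight ⊥ ⊥ ≤ 2 * x * x ^ r * ∣ ⊥ {size n} ∣
    pot rewrite weight≡0 | ∣⊥∣≡0 (size n) = z≤n

    dang : ∀ f → danger ⊥ ⊥ f ≤ ∑[ K ∈ 𝒦 ] ⟦ f ∈? K ⟧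
    dang f = ∑-mono 𝒦 λ K → ≤-trans
      (*-monoʳ-≤ ⟦ f ∈? K ⟧ (*-mono-≤ (⟦⟧≤1 (alive? ⊥ K)) (≤-reflexive (cong (x ^_) (∣K∩⊥∣≡0 K)))))
      (≤-reflexive (*-identityʳ _))

-- The copies of a subgraph

⁅_⁆ᵈ : ∀ {n} {P : Fin n → Set} → Decidable P → Subset n
⁅ P? ⁆ᵈ = Vec.tabulate (does ∘ P?)

∈⁅⁆ᵈ⁺ : ∀ {n} {P : Fin n → Set} (P? : Decidable P) {x} → P x → x ∈ ⁅ P? ⁆ᵈ
∈⁅⁆ᵈ⁺ P? {x} px = lookup⇒[]= x _ (trans (lookup∘tabulate (does ∘ P?) x) (dec-true (P? x) px))

∈⁅⁆ᵈ⁻ : ∀ {n} {P : Fin n → Set} (P? : Decidable P) {x} → x ∈ ⁅ P? ⁆ᵈ → P x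
∈⁅⁆ᵈ⁻ P? {x} x∈ with P? x in eq
... | yes px = px
... | no ¬px = contradiction
  (trans (sym (trans (lookup∘tabulate (does ∘ P?) x) (cong does eq))) ([]=⇒lookup x∈)) λ ()

∏-∣∣ : ∀ c {n} (p : Subset n) → ∏ (λ i → c ^ ⟦ i ∈? p ⟧) ≡ c ^ ∣ p ∣
∏-∣∣ c []            = refl
∏-∣∣ c (inside  ∷ p) = cong₂ _*_ (*-identityʳ c)
  (trans (∏-cong λ i → cong (c ^_) (⟦⟧-cong (suc i ∈? inside ∷ p) (i ∈? p) drop-there Vec.there)) (∏-∣∣ c p))
∏-∣∣ c (outside ∷ p) = trans (+-identityʳ _)
  (trans (∏-cong λ i → cong (c ^_) (⟦⟧-cong (suc i ∈? outside ∷ p) (i ∈? p) drop-there Vec.there)) (∏-∣∣ c p))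

-- Cross-multiplied, so that the case h x = 0 is covered.
∏-update : ∀ {n} (x : Fin n) (g h : Fin n → ℕ) →
           ∏ (λ i → if does (i Fin.≟ x) then g i else h i) * h x ≡ g x * ∏ h
∏-update zero    g h = lemma (g zero) _ (h zero)
  where
  lemma : ∀ a b c → a * b * c ≡ a * (c * b)
  lemma = solve-∀
∏-update (suc x) g h = trans (*-assoc (h zero) _ _)
  (trans (cong (h zero *_) (∏-update x (g ∘ suc) (h ∘ suc))) (lemma (h zero) (g (suc x)) _))
  where
  lemma : ∀ a b c → a * (b * c) ≡ b * (a * c)
  lemma = solve-∀

∏-single : ∀ {n} (x : Fin n) (g : Fin n → ℕ) →
           ∏ (λ i → if does (i Fin.≟ x) then g i else 1) ≡ g x
∏-single {n} x g = trans (sym (*-identityʳ _)) (trans (∏-update x g (λ _ → 1))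
  (trans (cong (g x *_) (trans (∏-const n 1) (^-zeroˡ n))) (*-identityʳ _)))

∑-filter≤ : ∀ {A : Set} {P : A → Set} (P? : Decidable P) xs (f : A → ℕ) → ∑ (filter P? xs) f ≤ ∑ xs f
∑-filter≤ P? []       f = z≤n
∑-filter≤ P? (x ∷ xs) f with does (P? x)
... | true  = +-monoʳ-≤ (f x) (∑-filter≤ P? xs f)
... | false = ≤-trans (∑-filter≤ P? xs f) (m≤n+m _ (f x))

∈-choices : ∀ {A : Set} {n} (xss : Vec (List A) n) (φ : Vec A n) →
            (∀ i → lookup φ i ∈ᴸ lookup xss i) → φ ∈ᴸ choices xss
∈-choices []         []      h = here refl
∈-choices (xs ∷ xss) (x ∷ φ) h =
  ∈-cartesianProductWith⁺ _∷_ (h zero) (∈-choices xss φ (h ∘ suc))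

joins? : ∀ {n} (f : Edge n) i j → Dec (Joins f i j)
joins? f i j =
  ((src f Fin.≟ i) ×-dec (tgt f Fin.≟ j)) ⊎-dec ((src f Fin.≟ j) ×-dec (tgt f Fin.≟ i))

src≢tgt : ∀ {n} (a : Edge n) → src a ≢ tgt a
src≢tgt a eq = <-irrefl (cong Fin.toℕ eq) (src<tgt a)

∣p-x-y∣≤ : ∀ {n} {p : Subset n} {x y} w → x ∈ p → y ∈ p → x ≢ y → ∣ p ∣ ≡ 2 + w → ∣ p - x - y ∣ ≤ w
∣p-x-y∣≤ {p = p} {x} {y} w x∈ y∈ x≢y eq = s≤s⁻¹ (s≤s⁻¹ (begin
  2 + ∣ p - x - y ∣  ≤⟨ s≤s (x∈p⇒∣p-x∣<∣p∣ (x∈p∧x≢y⇒x∈p-y y∈ (x≢y ∘ sym))) ⟩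
  1 + ∣ p - x ∣      ≤⟨ x∈p⇒∣p-x∣<∣p∣ x∈ ⟩
  ∣ p ∣              ≡⟨ eq ⟩
  2 + w              ∎))
  where open ≤-Reasoning

-- In the application, `r` and `w` are the numerator and the denominator of the ratio that attains
-- m(H). The default vertex `o` keeps the number of placements at n ^ ∣ W ∣, as vertices outside W
-- have no choice.
module Images (H : Graph) (W : Subset (v H)) (F : EdgeSet (v H)) (sub : IsSubgraph H (W , F))
  (w r : ℕ) (∣W∣≡ : ∣ W ∣ ≡ 2 + w) (r<∣F∣ : r < ∣ F ∣) (n : ℕ) (o : Fin n) where

  private instance
    n≢0 : NonZero n
    n≢0 = Fin.nonZeroIndex o

  option : Side → List (Fin n)
  option inside  = allFin n
  option outside = o ∷ []

  -- The maps from W to the vertices of Kₙ, extended by o outside W.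
  placements : List (Vec (Fin n) (v H))
  placements = choices (Vec.map option W)

  Image : Vec (Fin n) (v H) → Edge n → Set
  Image ψ f = ∃ λ a → a ∈ F × Joins f (lookup ψ (src a)) (lookup ψ (tgt a))

  image? : ∀ ψ → Decidable (Image ψ)
  image? ψ f = any? λ a → (a ∈? F) ×-dec joins? f (lookup ψ (src a)) (lookup ψ (tgt a))

  image : Vec (Fin n) (v H) → EdgeSet n
  image ψ = ⁅ image? ψ ⁆ᵈ

  -- Two vertices of W are fixed, which leaves n choices for each of the other `w`. Each indicator
  -- becomes a product over all vertices, with factor 1 away from its own vertex, so that
  -- `∑-choices-∏` applies.
  count-placements : ∀ {x y} p q → x ∈ W → y ∈ W → x ≢ y →
    ∑[ ψ ∈ placements ] ⟦ lookup ψ x Fin.≟ p ⟧ * ⟦ lookup ψ y Fin.≟ q ⟧ ≤ n ^ w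
  count-placements {x} {y} p q x∈W y∈W x≢y = begin
    ∑[ ψ ∈ placements ] ⟦ lookup ψ x Fin.≟ p ⟧ * ⟦ lookup ψ y Fin.≟ q ⟧
      ≡⟨ ∑-cong placements (λ ψ → trans
           (cong₂ _*_ (sym (∏-single x (λ i → ⟦ lookup ψ i Fin.≟ p ⟧)))
                      (sym (∏-single y (λ i → ⟦ lookup ψ i Fin.≟ q ⟧))))
           (sym (∏-* (λ i → at x p i (lookup ψ i)) (λ i → at y q i (lookup ψ i))))) ⟩
    ∑[ ψ ∈ placements ] ∏ (λ i → at x p i (lookup ψ i) * at y q i (lookup ψ i))
      ≡⟨ ∑-choices-∏ (Vec.map option W) (λ i u → at x p i u * at y q i u) ⟩
    ∏ (λ i → ∑[ u ∈ lookup (Vec.map option W) i ] at x p i u * at y q i u)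
      ≡⟨ ∏-cong (λ i → cong (λ us → ∑[ u ∈ us ] at x p i u * at y q i u) (lookup-map i option W)) ⟩
    ∏ (λ i → ∑[ u ∈ option (lookup W i) ] at x p i u * at y q i u)
      ≤⟨ ∏-mono bound ⟩
    ∏ (λ i → n ^ ⟦ i ∈? W - x - y ⟧)
      ≡⟨ ∏-∣∣ n (W - x - y) ⟩
    n ^ ∣ W - x - y ∣
      ≤⟨ ^-monoʳ-≤ n (∣p-x-y∣≤ w x∈W y∈W x≢y ∣W∣≡) ⟩
    n ^ w ∎
    where
    open ≤-Reasoning

    at : Fin (v H) → Fin n → Fin (v H) → Fin n → ℕ
    at x p i u = if does (i Fin.≟ x) then ⟦ u Fin.≟ p ⟧ else 1

    at≤1 : ∀ x p i u → at x p i u ≤ 1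
    at≤1 x p i u with does (i Fin.≟ x)
    ... | true  = ⟦⟧≤1 (u Fin.≟ p)
    ... | false = ≤-refl

    ∑-single : ∀ p → ∑[ u ∈ allFin n ] ⟦ u Fin.≟ p ⟧ ≤ 1
    ∑-single p = ≤-reflexive (trans
      (∑-cong (allFin n) λ u → trans (⟦⟧-cong (u Fin.≟ p) (p Fin.≟ u) sym sym) (sym (*-identityʳ _)))
      (∑-δ Fin._≟_ (λ _ → 1) (Unique.allFin⁺ n) (∈-allFin p)))

    bound-at : ∀ z p → z ∈ W → ∀ (g : Fin n → ℕ) → (∀ u → g u ≤ at z p z u) →
               ∀ t → ∑ (option (lookup W z)) g ≤ n ^ t
    bound-at z p z∈W g g≤ t rewrite []=⇒lookup z∈W =
      ≤-trans (∑-mono (allFin n) λ u → ≤-trans (g≤ u) (≤-reflexive (at-self u)))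
        (≤-trans (∑-single p) (m^n>0 n t))
      where
      at-self : ∀ u → at z p z u ≡ ⟦ u Fin.≟ p ⟧
      at-self u = cong (λ t → if t then ⟦ u Fin.≟ p ⟧ else 1) (dec-true (z Fin.≟ z) refl)

    Bounded : Fin (v H) → Set
    Bounded i = ∑[ u ∈ option (lookup W i) ] at x p i u * at y q i u ≤ n ^ ⟦ i ∈? W - x - y ⟧

    bound-elsewhere : ∀ i → i ≢ x → i ≢ y → Bounded i
    bound-elsewhere i i≢x i≢y with lookup W i in eq
    ... | outside = ≤-trans (≤-reflexive (+-identityʳ _))
      (≤-trans (*-mono-≤ (at≤1 x p i o) (at≤1 y q i o)) (m^n>0 n ⟦ i ∈? W - x - y ⟧))
    ... | inside rewrite ⟦⟧-yes (i ∈? W - x - y)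
                      (x∈p∧x≢y⇒x∈p-y (x∈p∧x≢y⇒x∈p-y (lookup⇒[]= i W eq) i≢x) i≢y) = begin
      ∑[ u ∈ allFin n ] at x p i u * at y q i u
        ≤⟨ ∑-mono (allFin n) (λ u → *-mono-≤ (at≤1 x p i u) (at≤1 y q i u)) ⟩
      ∑[ _ ∈ allFin n ] 1  ≡⟨ ∑-const (allFin n) 1 ⟩
      length (allFin n) * 1  ≡⟨ cong (_* 1) (length-allFin n) ⟩
      n * 1 ∎

    bound-cases : ∀ i → Dec (i ≡ x) → Dec (i ≡ y) → Bounded i
    bound-cases i (yes refl) _ = bound-at x p x∈W _
      (λ u → ≤-trans (*-monoʳ-≤ (at x p x u) (at≤1 y q x u)) (≤-reflexive (*-identityʳ _))) ⟦ i ∈? W - x - y ⟧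
    bound-cases i (no _) (yes refl) = bound-at y q y∈W _
      (λ u → ≤-trans (*-monoˡ-≤ (at y q y u) (at≤1 x p y u)) (≤-reflexive (*-identityˡ _))) ⟦ i ∈? W - x - y ⟧
    bound-cases i (no i≢x) (no i≢y) = bound-elsewhere i i≢x i≢y

    bound : ∀ i → Bounded i
    bound i = bound-cases i (i Fin.≟ x) (i Fin.≟ y)

  -- `f` is the image of some edge of F in one of two directions, and then both endpoints of that
  -- edge have prescribed positions.
  degree≤ : ∀ f → ∑[ ψ ∈ placements ] ⟦ f ∈? image ψ ⟧ ≤ ∣ F ∣ * (2 * n ^ w)
  degree≤ f = begin
    ∑[ ψ ∈ placements ] ⟦ f ∈? image ψ ⟧
      ≤⟨ ∑-mono placements cover ⟩
    ∑[ ψ ∈ placements ] ∑[ a ∈ allFin (size (v H)) ] ⟦ a ∈? F ⟧ * both ψ a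
      ≡⟨ ∑-comm placements (allFin (size (v H))) _ ⟩
    ∑[ a ∈ allFin (size (v H)) ] ∑[ ψ ∈ placements ] ⟦ a ∈? F ⟧ * both ψ a
      ≤⟨ ∑-mono (allFin (size (v H))) per-edge ⟩
    ∑[ a ∈ allFin (size (v H)) ] ⟦ a ∈? F ⟧ * (2 * n ^ w)
      ≡⟨ ∑-*ʳ (allFin (size (v H))) (2 * n ^ w) _ ⟩
    (∑[ a ∈ allFin (size (v H)) ] ⟦ a ∈? F ⟧) * (2 * n ^ w)
      ≡⟨ cong (_* (2 * n ^ w)) (∣∣-∑ F) ⟨
    ∣ F ∣ * (2 * n ^ w) ∎
    where
    open ≤-Reasoning

    one : Vec (Fin n) (v H) → Edge (v H) → Fin n → Fin n → ℕ
    one ψ a p q = ⟦ lookup ψ (src a) Fin.≟ p ⟧ * ⟦ lookup ψ (tgt a) Fin.≟ q ⟧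

    both : Vec (Fin n) (v H) → Edge (v H) → ℕ
    both ψ a = one ψ a (src f) (tgt f) + one ψ a (tgt f) (src f)

    one≡1 : ∀ ψ a {p q} → p ≡ lookup ψ (src a) → q ≡ lookup ψ (tgt a) → one ψ a p q ≡ 1
    one≡1 ψ a refl refl = cong₂ _*_ (⟦⟧-yes (lookup ψ (src a) Fin.≟ _) refl)
                                    (⟦⟧-yes (lookup ψ (tgt a) Fin.≟ _) refl)

    joined : ∀ ψ a → Joins f (lookup ψ (src a)) (lookup ψ (tgt a)) → 1 ≤ both ψ a
    joined ψ a (inj₁ (s , t)) = ≤-trans (≤-reflexive (sym (one≡1 ψ a s t))) (m≤m+n _ _)
    joined ψ a (inj₂ (s , t)) = ≤-trans (≤-reflexive (sym (one≡1 ψ a t s))) (m≤n+m _ (one ψ a (src f) (tgt f)))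

    cover : ∀ ψ → ⟦ f ∈? image ψ ⟧ ≤ ∑[ a ∈ allFin (size (v H)) ] ⟦ a ∈? F ⟧ * both ψ a
    cover ψ with f ∈? image ψ
    ... | no _  = z≤n
    ... | yes f∈ with ∈⁅⁆ᵈ⁻ (image? ψ) f∈
    ...   | a , a∈F , j = ≤-trans
      (*-mono-≤ (≤-reflexive (sym (⟦⟧-yes (a ∈? F) a∈F))) (joined ψ a j))
      (≤-∑ (λ a → ⟦ a ∈? F ⟧ * both ψ a) (∈-allFin a))

    per-edge : ∀ a → ∑[ ψ ∈ placements ] ⟦ a ∈? F ⟧ * both ψ a ≤ ⟦ a ∈? F ⟧ * (2 * n ^ w)
    per-edge a = ≤-trans (≤-reflexive (∑-*ˡ placements ⟦ a ∈? F ⟧ (λ ψ → both ψ a))) inner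
      where
      inner : ⟦ a ∈? F ⟧ * (∑[ ψ ∈ placements ] both ψ a) ≤ ⟦ a ∈? F ⟧ * (2 * n ^ w)
      inner with a ∈? F
      ... | no _ = z≤n
      ... | yes a∈F = *-monoʳ-≤ 1 (begin
        ∑[ ψ ∈ placements ] both ψ a
          ≡⟨ ∑-+ placements (λ ψ → one ψ a (src f) (tgt f)) (λ ψ → one ψ a (tgt f) (src f)) ⟩
        (∑[ ψ ∈ placements ] one ψ a (src f) (tgt f)) + (∑[ ψ ∈ placements ] one ψ a (tgt f) (src f))
          ≤⟨ +-mono-≤ (count (src f) (tgt f)) (count (tgt f) (src f)) ⟩
        n ^ w + n ^ w
          ≡⟨ cong (n ^ w +_) (+-identityʳ (n ^ w)) ⟨
        2 * n ^ w ∎)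
        where
        count : ∀ p q → ∑[ ψ ∈ placements ] one ψ a p q ≤ n ^ w
        count p q = let (s∈ , t∈) = proj₂ sub a a∈F in count-placements p q s∈ t∈ (src≢tgt a)

  -- Placements need not be injective; the filter discards those whose image has lost too many
  -- edges. Repeated sets are kept, and the degree bound counts them with multiplicity.
  images : List (EdgeSet n)
  images = filter (λ K → r <? ∣ K ∣) (map image placements)

  images-degree≤ : ∀ f → ∑[ K ∈ images ] ⟦ f ∈? K ⟧ ≤ ∣ F ∣ * (2 * n ^ w)
  images-degree≤ f = ≤-trans (∑-filter≤ _ (map image placements) _)
    (≤-trans (≤-reflexive (∑-map image placements _)) (degree≤ f))

  images-cofinal : ∀ G → IsCopy H G → ∃ λ K → K ∈ᴸ images × K ⊆ G
  images-cofinal G (φ , inj , img) =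
    image ψ , ∈-filter⁺ (λ K → r <? ∣ K ∣) (∈-map⁺ image ψ∈) (≤-trans r<∣F∣ ∣F∣≤) , K⊆G
    where
    ψ : Vec (Fin n) (v H)
    -- The given copy, restricted to W. Since φ is injective, distinct edges of F keep distinct
    -- images.
    ψ = Vec.tabulate λ i → if lookup W i then φ i else o

    ψ≡φ : ∀ {i} → i ∈ W → lookup ψ i ≡ φ i
    ψ≡φ {i} i∈ = trans (lookup∘tabulate _ i) (cong (λ s → if s then φ i else o) ([]=⇒lookup i∈))

    ψ∈ : ψ ∈ᴸ placements
    ψ∈ = ∈-choices (Vec.map option W) ψ λ i → subst₂ _∈ᴸ_
      (sym (lookup∘tabulate _ i)) (sym (lookup-map i option W)) (opt i (lookup W i))
      where
      opt : ∀ i s → (if s then φ i else o) ∈ᴸ option s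
      opt i inside  = ∈-allFin (φ i)
      opt i outside = here refl

    K⊆G : image ψ ⊆ G
    K⊆G {f} f∈ =
      let (a , a∈F , j) = ∈⁅⁆ᵈ⁻ (image? ψ) f∈
          (s∈ , t∈) = proj₂ sub a a∈F
      in Equivalence.from (img f) (a , proj₁ sub a∈F , subst₂ (Joins f) (ψ≡φ s∈) (ψ≡φ t∈) j)

    between : ∀ a → ∃ λ g → Joins g (φ (src a)) (φ (tgt a))
    between a = edgeBetween (src≢tgt a ∘ inj)

    g : Edge (v H) → Edge n
    g a = proj₁ (between a)

    g-injective : ∀ {a b} → g a ≡ g b → a ≡ b
    g-injective {a} {b} eq = joins-unique inj (proj₂ (between a))
      (subst (λ f → Joins f (φ (src b)) (φ (tgt b))) (sym eq) (proj₂ (between b)))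

    g∈K : ∀ a → a ∈ F → g a ∈ image ψ
    g∈K a a∈F = let (s∈ , t∈) = proj₂ sub a a∈F in
      ∈⁅⁆ᵈ⁺ (image? ψ) (a , a∈F , subst₂ (Joins (g a)) (sym (ψ≡φ s∈)) (sym (ψ≡φ t∈)) (proj₂ (between a)))

    ∣F∣≤ : ∣ F ∣ ≤ ∣ image ψ ∣
    ∣F∣≤ = begin
      ∣ F ∣                                     ≡⟨ ∣∣-∑ F ⟩
      ∑[ a ∈ allFin (size (v H)) ] ⟦ a ∈? F ⟧
        ≤⟨ ∑-mono (allFin (size (v H))) (λ a → ⟦⟧-mono (a ∈? F) (g a ∈? image ψ) (g∈K a)) ⟩
      ∑[ a ∈ allFin (size (v H)) ] ⟦ g a ∈? image ψ ⟧
        ≤⟨ ∑-preimage≤∣∣ (image ψ) g (Unique.allFin⁺ (size (v H))) g-injective ⟩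
      ∣ image ψ ∣ ∎
      where open ≤-Reasoning

  breakerWins-subgraph : ∀ x .⦃ _ : NonZero x ⦄ → 2 * (∣ F ∣ * (2 * n ^ w)) ≤ x ^ r →
                         BudgetGame.BreakerWins H n (2 * x)
  breakerWins-subgraph x bound = DangerStrategy.breakerWins H n x r images
    (λ K K∈ → proj₂ (∈-filter⁻ (λ K → r <? ∣ K ∣) {xs = map image placements} K∈))
    (λ f → ≤-trans (*-monoʳ-≤ 2 (images-degree≤ f)) bound)
    images-cofinal

-- The density m(H)

-- `_/ℚ_` reduces fractions; up to ≃ the numerator and denominator stay as given, which is what
-- cross-multiplication needs.
/≃ : ∀ i k → toℚᵘ (i /ℚ suc k) ≃ᵘ mkℚᵘ i k
/≃ i k = ℚ.toℚᵘ-fromℚᵘ (mkℚᵘ i k)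

/≤⇒ : ∀ {f k q} → (ℤ.+ f) /ℚ suc k ≤ℚ q → ↧ₙ q * f ≤ ℤ.∣ ↥ q ∣ * suc k
/≤⇒ {f} {k} {q} h with q | ℚᵘ.≤-respˡ-≃ (/≃ (ℤ.+ f) k) (ℚ.toℚᵘ-mono-≤ h)
... | mkℚ (ℤ.+ a) d _ | *≤* h′ = ≤-trans (≤-reflexive (*-comm (suc d) f))
  (ℤ.drop‿+≤+ (subst₂ ℤ._≤_ (sym (ℤ.pos-* f (suc d))) (sym (ℤ.pos-* a (suc k))) h′))
... | mkℚ ℤ.-[1+ a ] d _ | *≤* h′ with subst (ℤ._≤ _) (sym (ℤ.pos-* f (suc d))) h′
...   | ()

≡/⇒ : ∀ {f k q} → q ≡ (ℤ.+ f) /ℚ suc k → ↧ₙ q * f ≡ ℤ.∣ ↥ q ∣ * suc k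
≡/⇒ {f} {k} {q} eq with q | ℚᵘ.≃-trans (ℚᵘ.≃-sym (/≃ (ℤ.+ f) k)) (ℚ.toℚᵘ-cong (sym eq))
... | mkℚ (ℤ.+ a) d _ | *≡* h = trans (*-comm (suc d) f)
  (ℤ.+-injective (trans (ℤ.pos-* f (suc d)) (trans h (sym (ℤ.pos-* a (suc k))))))
... | mkℚ ℤ.-[1+ a ] d _ | *≡* h with trans (ℤ.pos-* f (suc d)) h
...   | ()

0≰-1/ : ∀ {k} → ¬ (0ℚ ≤ℚ ℤ.-[1+ 0 ] /ℚ suc k)
0≰-1/ {k} h with ℚᵘ.≤-respʳ-≃ (/≃ ℤ.-[1+ 0 ] k) (ℚ.toℚᵘ-mono-≤ h)
... | *≤* ()

∈-subsets : ∀ {n} (p : Subset n) → p ∈ᴸ subsets n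
∈-subsets []            = here refl
∈-subsets (inside  ∷ p) = ∈-++⁺ˡ (∈-map⁺ (inside ∷_) (∈-subsets p))
∈-subsets (outside ∷ p) = ∈-++⁺ʳ _ (∈-map⁺ (outside ∷_) (∈-subsets p))

∈-mapMaybe⁺ : ∀ {A C : Set} (g : A → Maybe C) {xs x y} → x ∈ᴸ xs → g x ≡ just y → y ∈ᴸ mapMaybe g xs
∈-mapMaybe⁺ g {x ∷ xs} (here refl) eq with g x
∈-mapMaybe⁺ g {x ∷ xs} (here refl) refl | just _ = here refl
∈-mapMaybe⁺ g {x ∷ xs} (there x∈) eq with g x
... | just _  = there (∈-mapMaybe⁺ g x∈ eq)
... | nothing = ∈-mapMaybe⁺ g x∈ eq

∈-mapMaybe⁻ : ∀ {A C : Set} (g : A → Maybe C) xs {y} → y ∈ᴸ mapMaybe g xs → ∃ λ x → x ∈ᴸ xs × g x ≡ just y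
∈-mapMaybe⁻ g (x ∷ xs) y∈ with g x in eq | y∈
... | just _  | here refl = x , here refl , eq
... | just _  | there y∈′ = let (x′ , x′∈ , eq′) = ∈-mapMaybe⁻ g xs y∈′ in x′ , there x′∈ , eq′
... | nothing | y∈′       = let (x′ , x′∈ , eq′) = ∈-mapMaybe⁻ g xs y∈′ in x′ , there x′∈ , eq′

m-num m-den : Graph → ℕ
m-num H = ℤ.∣ ↥ m H ∣
m-den H = ↧ₙ m H

module _ (H : Graph) where

  private
    ratioOf : Subset (v H) × EdgeSet (v H) → Maybe ℚ
    ratioOf (W , F) = ratio ∣ W ∣ ∣ F ∣

    order = DecTotalOrder.totalOrder ℚ.≤-decTotalOrder

  m-upper : ∀ {W F} → IsSubgraph H (W , F) → ∀ k f → ∣ W ∣ ≡ 3 + k → ∣ F ∣ ≡ suc f →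
            m-den H * f ≤ m-num H * suc k
  m-upper {W} {F} sub k f ∣W∣≡ ∣F∣≡ = /≤⇒ {f} {k} {m H} (All.lookup
    (xs≤max order 0ℚ (mapMaybe ratioOf (subgraphs H)))
    (∈-mapMaybe⁺ ratioOf
      (∈-filter⁺ (isSubgraph? H) (∈-cartesianProduct⁺ (∈-subsets W) (∈-subsets F)) sub)
      (cong₂ ratio ∣W∣≡ ∣F∣≡)))

  -- `m-num` is an absolute value, so its positivity excludes only m H ≡ 0: the base value 0ℚ and
  -- subgraphs with one edge. Subgraphs without edges have a negative ratio, below the base value.
  m-attained : 0 < m-num H → ∃ λ W → ∃ λ F → ∃₂ λ k f → IsSubgraph H (W , F) × ∣ W ∣ ≡ 3 + k ×
               ∣ F ∣ ≡ 2 + f × m-den H * suc f ≡ m-num H * suc k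
  m-attained 0<num with argmax-sel order id 0ℚ (mapMaybe ratioOf (subgraphs H))
  ... | inj₁ m≡0 = contradiction (cong (λ q → ℤ.∣ ↥ q ∣) m≡0) (>⇒≢ 0<num)
  ... | inj₂ m∈ with ∈-mapMaybe⁻ ratioOf (subgraphs H) m∈
  ...   | (W , F) , WF∈ , eq = classify refl refl eq
    where
    classify : ∀ {c d} → ∣ W ∣ ≡ c → ∣ F ∣ ≡ d → ratio c d ≡ just (m H) → ∃ λ W → ∃ λ F → ∃₂ λ k f →
               IsSubgraph H (W , F) × ∣ W ∣ ≡ 3 + k × ∣ F ∣ ≡ 2 + f × m-den H * suc f ≡ m-num H * suc k
    classify {suc (suc (suc k))} {zero} _ _ eq = contradiction
      (ℚ.≤-trans (⊥≤max order 0ℚ (mapMaybe ratioOf (subgraphs H))) (ℚ.≤-reflexive (sym (just-injective eq))))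
      (0≰-1/ {k})
    classify {suc (suc (suc k))} {suc zero} _ _ eq = contradiction
      (*-cancelʳ-≡ (m-num H) 0 (suc k)
        (trans (sym (≡/⇒ {0} {k} {m H} (sym (just-injective eq)))) (*-zeroʳ (m-den H))))
      (>⇒≢ 0<num)
    classify {suc (suc (suc k))} {suc (suc f)} ∣W∣≡ ∣F∣≡ eq =
      W , F , k , f , proj₂ (∈-filter⁻ (isSubgraph? H)
        {xs = cartesianProduct (subsets (v H)) (subsets (size (v H)))} WF∈) , ∣W∣≡ , ∣F∣≡ ,
      ≡/⇒ {suc f} {k} {m H} (sym (just-injective eq))

-- If both endpoints of `b` lay on `a`, the two edges would coincide, since each lists its smaller
-- endpoint first.
∃third-vertex : ∀ {n} {a b : Edge n} → a ≢ b → ∃ λ z → (z ≡ src b ⊎ z ≡ tgt b) × z ≢ src a × z ≢ tgt a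
∃third-vertex {n} {a} {b} a≢b
  with src b Fin.≟ src a | src b Fin.≟ tgt a | tgt b Fin.≟ src a | tgt b Fin.≟ tgt a
... | no p  | no q  | _     | _     = src b , inj₁ refl , p , q
... | _     | _     | no p  | no q  = tgt b , inj₂ refl , p , q
... | yes p | _     | yes r | _     = contradiction (trans p (sym r)) (src≢tgt b)
... | yes p | _     | no _  | yes s = contradiction (edge-≡ (sym p) (sym s)) a≢b
... | no _  | yes q | _     | yes s = contradiction (trans q (sym s)) (src≢tgt b)
... | no _  | yes q | yes r | no _  =
  contradiction (src<tgt a) (Fin.<-asym (subst₂ Fin._<_ q r (src<tgt b)))

-- Ensures that every subgraph with two edges counts in the maximum m(H).
2≤∣F∣⇒3≤∣W∣ : ∀ {n} (W : Subset n) (F : EdgeSet n) → (∀ a → a ∈ F → src a ∈ W × tgt a ∈ W) →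
              2 ≤ ∣ F ∣ → 3 ≤ ∣ W ∣
2≤∣F∣⇒3≤∣W∣ W F within 2≤ =
  let (a , b , a∈ , b∈ , a≢b) = two-elements F 2≤
      (z , z≡ , z≢s , z≢t) = ∃third-vertex a≢b
      z∈ = incident b∈ z≡
      (s∈ , t∈) = within a a∈
  in begin
    3                                  ≤⟨ s≤s (s≤s (≤-<-trans z≤n
      (x∈p⇒∣p-x∣<∣p∣ (x∈p∧x≢y⇒x∈p-y (x∈p∧x≢y⇒x∈p-y z∈ z≢s) z≢t)))) ⟩
    2 + ∣ W - src a - tgt a ∣          ≤⟨ s≤s (x∈p⇒∣p-x∣<∣p∣ (x∈p∧x≢y⇒x∈p-y t∈ (src≢tgt a ∘ sym))) ⟩
    1 + ∣ W - src a ∣                  ≤⟨ x∈p⇒∣p-x∣<∣p∣ s∈ ⟩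
    ∣ W ∣                              ∎
  where
  open ≤-Reasoning
  incident : ∀ {b z} → b ∈ F → z ≡ src b ⊎ z ≡ tgt b → z ∈ W
  incident b∈ (inj₁ refl) = proj₁ (within _ b∈)
  incident b∈ (inj₂ refl) = proj₂ (within _ b∈)

-- This is m(H) ≥ 1/2; two edges span at most 4 vertices.
m-den≤2*m-num : ∀ H → 2 ≤ e H → m-den H ≤ m-num H * 2
m-den≤2*m-num H 2≤e = let (a , b , a∈ , b∈ , a≢b) = two-elements (E H) 2≤e in bound a b a∈ b∈ a≢b
  where
  ∃suc : ∀ {i} j → j ≤ i → ∃ λ k → i ≡ j + k
  ∃suc j j≤i = _ , sym (m+[n∸m]≡n j≤i)

  bound : ∀ a b → a ∈ E H → b ∈ E H → a ≢ b → m-den H ≤ m-num H * 2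
  bound a b a∈ b∈ a≢b =
    let (k , ∣W∣≡) = ∃suc 3 (2≤∣F∣⇒3≤∣W∣ W F (proj₂ sub) 2≤∣F∣)
        (f , ∣F∣≡) = ∃suc 2 2≤∣F∣
    in begin
      m-den H            ≤⟨ m≤m*n (m-den H) (suc f) ⟩
      m-den H * suc f    ≤⟨ m-upper H sub k (suc f) ∣W∣≡ ∣F∣≡ ⟩
      m-num H * suc k    ≤⟨ *-monoʳ-≤ (m-num H) (s≤s⁻¹ (s≤s⁻¹ (subst (_≤ 4) ∣W∣≡ ∣W∣≤4))) ⟩
      m-num H * 2        ∎
    where
    open ≤-Reasoning
    W₂ = ⁅ src a ⁆ ∪ ⁅ tgt a ⁆
    W₃ = W₂ ∪ ⁅ src b ⁆
    W  = W₃ ∪ ⁅ tgt b ⁆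
    F = ⁅ a ⁆ ∪ ⁅ b ⁆

    ∣W∣≤4 : ∣ W ∣ ≤ 4
    ∣W∣≤4 = ≤-trans (∣p∪⁅x⁆∣≤ W₃ (tgt b)) (s≤s (≤-trans (∣p∪⁅x⁆∣≤ W₂ (src b)) (s≤s
      (≤-trans (∣p∪⁅x⁆∣≤ ⁅ src a ⁆ (tgt a)) (s≤s (≤-reflexive (∣⁅x⁆∣≡1 (src a))))))))

    2≤∣F∣ : 2 ≤ ∣ F ∣
    2≤∣F∣ = ≤-trans (s≤s (≤-reflexive (sym (∣⁅x⁆∣≡1 a)))) (p⊂q⇒∣p∣<∣q∣
      (p⊆p∪q ⁅ b ⁆ , b , q⊆p∪q ⁅ a ⁆ ⁅ b ⁆ (x∈⁅x⁆ b) , λ b∈a → a≢b (sym (x∈⁅y⁆⇒x≡y a b∈a))))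

    sub : IsSubgraph H (W , F)
    sub = F⊆E , within
      where
      F⊆E : F ⊆ E H
      F⊆E c∈ with x∈p∪q⁻ ⁅ a ⁆ ⁅ b ⁆ c∈
      ... | inj₁ c∈a = subst (_∈ E H) (sym (x∈⁅y⁆⇒x≡y a c∈a)) a∈
      ... | inj₂ c∈b = subst (_∈ E H) (sym (x∈⁅y⁆⇒x≡y b c∈b)) b∈
      within : ∀ c → c ∈ F → src c ∈ W × tgt c ∈ W
      within c c∈ with x∈p∪q⁻ ⁅ a ⁆ ⁅ b ⁆ c∈
      ... | inj₁ c∈a rewrite x∈⁅y⁆⇒x≡y a c∈a =
        p⊆p∪q ⁅ tgt b ⁆ (p⊆p∪q ⁅ src b ⁆ (p⊆p∪q ⁅ tgt a ⁆ (x∈⁅x⁆ (src a)))) ,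
        p⊆p∪q ⁅ tgt b ⁆ (p⊆p∪q ⁅ src b ⁆ (q⊆p∪q ⁅ src a ⁆ ⁅ tgt a ⁆ (x∈⁅x⁆ (tgt a))))
      ... | inj₂ c∈b rewrite x∈⁅y⁆⇒x≡y b c∈b =
        p⊆p∪q ⁅ tgt b ⁆ (q⊆p∪q W₂ ⁅ src b ⁆ (x∈⁅x⁆ (src b))) ,
        q⊆p∪q W₃ ⁅ tgt b ⁆ (x∈⁅x⁆ (tgt b))

0<m-num : ∀ H → 2 ≤ e H → 0 < m-num H
0<m-num H 2≤e = n≢0⇒n>0 λ num≡0 → <⇒≱ (s≤s z≤n)
  (≤-trans (m-den≤2*m-num H 2≤e) (≤-reflexive (cong (_* 2) num≡0)))

-- Integer roots

^-distribʳ-* : ∀ m n o → (m * n) ^ o ≡ m ^ o * n ^ o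
^-distribʳ-* m n zero    = refl
^-distribʳ-* m n (suc o) rewrite ^-distribʳ-* m n o = lemma m n (m ^ o) (n ^ o)
  where
  lemma : ∀ a b c d → a * b * (c * d) ≡ (a * c) * (b * d)
  lemma = solve-∀

^-cancelʳ-≤ : ∀ {x y} a .⦃ _ : NonZero a ⦄ → x ^ a ≤ y ^ a → x ≤ y
^-cancelʳ-≤ a x^a≤y^a = ≮⇒≥ λ y<x → <⇒≱ (^-monoˡ-< a y<x) x^a≤y^a

-- The integer part of the root goes up by at most 1 when N does.
root : ∀ a .⦃ _ : NonZero a ⦄ N → ∃ λ z → z ^ a ≤ N × N < suc z ^ a
root (suc a) zero    = 0 , z≤n , ≤-reflexive (sym (^-zeroˡ (suc a)))
root a (suc N) with root a N
... | z , z^a≤N , N<z with suc z ^ a ≤? suc N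
...   | yes le = suc z , le , ≤-<-trans N<z (^-monoˡ-< a (n<1+n (suc z)))
...   | no ≰   = z , ≤-trans z^a≤N (n≤1+n N) , ≰⇒> ≰

^-swap : ∀ m n o → (m ^ n) ^ o ≡ (m ^ o) ^ n
^-swap m n o = trans (^-*-assoc m n o) (trans (cong (m ^_) (*-comm n o)) (sym (^-*-assoc m o n)))

-- The hypothesis is z ≤ N^{b/a} in disguise, and br/a ≤ w; comparing a-th powers keeps all
-- exponents integral.
^-root-≤ : ∀ {a b r w z N} .⦃ _ : NonZero a ⦄ .⦃ _ : NonZero N ⦄ →
           z ^ a ≤ N ^ b → b * r ≤ a * w → z ^ r ≤ N ^ w
^-root-≤ {a} {b} {r} {w} {z} {N} z^a≤ br≤aw = ^-cancelʳ-≤ a (begin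
  (z ^ r) ^ a  ≡⟨ ^-swap z r a ⟩
  (z ^ a) ^ r  ≤⟨ ^-monoˡ-≤ r z^a≤ ⟩
  (N ^ b) ^ r  ≡⟨ ^-*-assoc N b r ⟩
  N ^ (b * r)  ≤⟨ ^-monoʳ-≤ N br≤aw ⟩
  N ^ (a * w)  ≡⟨ cong (N ^_) (*-comm a w) ⟩
  N ^ (w * a)  ≡⟨ ^-*-assoc N w a ⟨
  (N ^ w) ^ a  ∎)
  where open ≤-Reasoning

^-root-≥ : ∀ {a b r w z N} .⦃ _ : NonZero a ⦄ .⦃ _ : NonZero N ⦄ →
           N ^ b ≤ z ^ a → a * w ≤ b * r → N ^ w ≤ z ^ r
^-root-≥ {a} {b} {r} {w} {z} {N} z^a≥ aw≤br = ^-cancelʳ-≤ a (begin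
  (N ^ w) ^ a  ≡⟨ ^-*-assoc N w a ⟩
  N ^ (w * a)  ≡⟨ cong (N ^_) (*-comm w a) ⟩
  N ^ (a * w)  ≤⟨ ^-monoʳ-≤ N aw≤br ⟩
  N ^ (b * r)  ≡⟨ ^-*-assoc N b r ⟨
  (N ^ b) ^ r  ≤⟨ ^-monoˡ-≤ r z^a≥ ⟩
  (z ^ a) ^ r  ≡⟨ ^-swap z a r ⟩
  (z ^ r) ^ a  ∎)
  where open ≤-Reasoning

1≤root : ∀ {a z N} → 0 < N → N < suc z ^ a → 1 ≤ z
1≤root {a} {zero}  0<N N< = contradiction (subst (_ <_) (^-zeroˡ a) N<) (≤⇒≯ 0<N)
1≤root {a} {suc z} 0<N N< = s≤s z≤n

-- The upper bound on the threshold bias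

breakerWins-root : ∀ H {W F k f a b} → IsSubgraph H (W , F) → ∣ W ∣ ≡ 3 + k → ∣ F ∣ ≡ 2 + f →
                   0 < a → b * suc f ≡ a * suc k → ∀ n → 0 < n →
                   ∃ λ q → BudgetGame.BreakerWins H n q × q ^ a ≤ (16 * (2 + f)) ^ a * n ^ b
breakerWins-root H {W} {F} {k} {f} {a@(suc _)} {b} sub ∣W∣≡ ∣F∣≡ _ eq n@(suc _) 0<n =
  2 * x , wins , (begin
    -- Since 1 ≤ y, `suc y` is at most y + y, whence the constant 16.
    (2 * x) ^ a                    ≤⟨ ^-monoˡ-≤ a (*-monoʳ-≤ 2 (*-monoʳ-≤ c (+-monoˡ-≤ y 1≤y))) ⟩
    (2 * (c * (y + y))) ^ a        ≡⟨ cong (_^ a) (lemma₁ f y) ⟩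
    (16 * (2 + f) * y) ^ a         ≡⟨ ^-distribʳ-* (16 * (2 + f)) y a ⟩
    (16 * (2 + f)) ^ a * y ^ a     ≤⟨ *-monoʳ-≤ ((16 * (2 + f)) ^ a) y^a≤ ⟩
    (16 * (2 + f)) ^ a * n ^ b     ∎)
  where
  open ≤-Reasoning
  y = proj₁ (root a (n ^ b))
  y^a≤ : y ^ a ≤ n ^ b
  y^a≤ = proj₁ (proj₂ (root a (n ^ b)))
  n^b< : n ^ b < suc y ^ a
  n^b< = proj₂ (proj₂ (root a (n ^ b)))
  -- Sparseness requires 4 * ∣ F ∣ * n ^ suc k ≤ x ^ suc f. The exponent is at least 1, so the
  -- factor 4 * ∣ F ∣ may move into the base; `suc y` exceeds the real root n^{b/a}.
  c = 4 * (2 + f)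
  x = c * suc y
  1≤y : 1 ≤ y
  1≤y = 1≤root {a} (m^n>0 n b) n^b<
  lemma₁ : ∀ f y → 2 * ((4 * (2 + f)) * (y + y)) ≡ 16 * (2 + f) * y
  lemma₁ = solve-∀
  lemma₂ : ∀ f t → 2 * ((2 + f) * (2 * t)) ≡ 4 * (2 + f) * t
  lemma₂ = solve-∀
  wins : BudgetGame.BreakerWins H n (2 * x)
  wins = Images.breakerWins-subgraph H W F sub (suc k) (suc f) ∣W∣≡ (≤-reflexive (sym ∣F∣≡)) n zero x (begin
    2 * (∣ F ∣ * (2 * n ^ suc k))     ≡⟨ cong (λ t → 2 * (t * (2 * n ^ suc k))) ∣F∣≡ ⟩
    2 * ((2 + f) * (2 * n ^ suc k))   ≡⟨ lemma₂ f (n ^ suc k) ⟩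
    c * n ^ suc k                     ≤⟨ *-mono-≤ (m≤m*n c (c ^ f) ⦃ m^n≢0 c f ⦄)
                                           (^-root-≥ {a} {b} {suc f} {suc k} (<⇒≤ n^b<) (≤-reflexive (sym eq))) ⟩
    c ^ suc f * suc y ^ suc f         ≡⟨ ^-distribʳ-* c (suc y) (suc f) ⟨
    x ^ suc f                         ∎)

thresholdBias-upper : ∀ H (2≤e : 2 ≤ e H) → ∃ λ C → 0 < C × (∀ n → 0 < n →
  thresholdBias H 2≤e n ^ m-num H ≤ C ^ m-num H * n ^ m-den H)
thresholdBias-upper H 2≤e =
  let (W , F , k , f , sub , ∣W∣≡ , ∣F∣≡ , eq) = m-attained H (0<m-num H 2≤e)
  in 16 * (2 + f) , s≤s z≤n , λ n 0<n →
    let (q , wins , q≤) = breakerWins-root H {a = m-num H} {m-den H} sub ∣W∣≡ ∣F∣≡ (0<m-num H 2≤e) eq n 0<n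
    in ≤-trans (^-monoˡ-≤ (m-num H) (proj₂ (thresholdBias-spec H 2≤e n) q wins)) q≤

-- Random play by Maker

module Samples {Y : Set} (_≟_ : DecidableEquality Y) where

  count : ∀ {T} → Vec Y T → Y → ℕ
  count []      y = 0
  count (z ∷ w) y = ⟦ z ≟ y ⟧ + count w y

module RandomPlay (H : Graph) (n q : ℕ) where
  open BudgetGame H n q

  private
    E′ = EdgeSet n

  disjoint-round : ∀ {M B R : E′} {f} → Empty (M ∩ B) → f ∉ M ∪ B → R ⊆ ∁ ((M ∪ ⁅ f ⁆) ∪ B) →
                   Empty ((M ∪ ⁅ f ⁆) ∩ (B ∪ R))
  disjoint-round {M} {B} {R} {f} dis f∉ R⊆ (y , y∈) with x∈p∩q⁻ (M ∪ ⁅ f ⁆) (B ∪ R) y∈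
  ... | y∈M′ , y∈B′ with x∈p∪q⁻ B R y∈B′
  ...   | inj₂ y∈R = x∈∁p⇒x∉p (R⊆ y∈R) (x∈p∪q⁺ (inj₁ y∈M′))
  ...   | inj₁ y∈B with x∈p∪q⁻ M ⁅ f ⁆ y∈M′
  ...     | inj₁ y∈M = dis (y , x∈p∩q⁺ (y∈M , y∈B))
  ...     | inj₂ y∈f = f∉ (x∈p∪q⁺ (inj₂ (subst (_∈ B) (x∈⁅y⁆⇒x≡y f y∈f) y∈B)))

  -- B is Breaker's final set, while M may be Maker's set at any earlier time, as she never loses an
  -- edge.
  Outcome : E′ → E′ → Set
  Outcome M B = HitsEveryCopy B × Empty (M ∩ B)

  Outcome-⊆ : ∀ {M M′ B : E′} → M ⊆ M′ → Outcome M′ B → Outcome M B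
  Outcome-⊆ {M} {M′} {B} M⊆M′ (h , dis) = h , λ (y , y∈) →
    let (y∈M , y∈B) = x∈p∩q⁻ M B y∈ in dis (y , x∈p∩q⁺ (M⊆M′ y∈M , y∈B))

  -- After the scripted rounds Maker claims arbitrary free edges, only to bring the game to its end.
  outcome : ∀ {M B} → WinningStrategy M B → Empty (M ∩ B) → ∃ (Outcome M)
  outcome {B = B} (finished _ h) dis = B , h , dis
  outcome {M} {B} (respond (f , f∉) s) dis with s f f∉
  ... | R , (R⊆ , _) , σ =
    let (B′ , out) = outcome σ (disjoint-round {M} {B} {R} {f} dis f∉ R⊆)
    in B′ , Outcome-⊆ (p⊆p∪q ⁅ f ⁆) out

  record Round (M B : E′) (f : Edge n) : Set where
    field
      {M′ B′}  : E′
      strategy : WinningStrategy M′ B′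
      disjoint : Empty (M′ ∩ B′)
      budget   : ∣ B′ ∣ ≤ q * ∣ M′ ∣
      slow     : ∣ M′ ∣ ≤ suc ∣ M ∣
      grows    : M ⊆ M′
      claimed  : f ∈ M′ ⊎ f ∈ B

  -- Maker aims at f, and claims some other edge if f is taken.
  round : ∀ {M B} → WinningStrategy M B → Empty (M ∩ B) → ∣ B ∣ ≤ q * ∣ M ∣ → ∀ f → Round M B f
  round {M} {B} σ@(finished full _) dis bud f = record
    { strategy = σ ; disjoint = dis ; budget = bud ; slow = n≤1+n _ ; grows = λ x∈ → x∈
    ; claimed = x∈p∪q⁻ M B (full f) }
  round {M} {B} (respond (f₀ , f₀∉) s) dis bud f with f ∈? M ∪ B
  ... | yes f∈ = let (R , (R⊆ , bud′) , σ) = s f₀ f₀∉ in record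
    { strategy = σ ; disjoint = disjoint-round {M} {B} {R} dis f₀∉ R⊆ ; budget = bud′
    ; slow = ∣p∪⁅x⁆∣≤ M f₀ ; grows = p⊆p∪q ⁅ f₀ ⁆
    ; claimed = map₁ (p⊆p∪q ⁅ f₀ ⁆) (x∈p∪q⁻ M B f∈) }
  ... | no f∉ = let (R , (R⊆ , bud′) , σ) = s f f∉ in record
    { strategy = σ ; disjoint = disjoint-round {M} {B} {R} dis f∉ R⊆ ; budget = bud′
    ; slow = ∣p∪⁅x⁆∣≤ M f ; grows = p⊆p∪q ⁅ f ⁆
    ; claimed = inj₁ (q⊆p∪q M ⁅ f ⁆ (x∈⁅x⁆ f)) }

  module _ {Y : Set} (ys : List Y) (ys-unique : Unique ys) where

    private
      N = length ys

    hits : ∀ {L} → Vec (Y → Edge n) L → Vec Y L → E′ → ℕ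
    hits []       []      B = 0
    hits (g ∷ gs) (y ∷ ω) B = ⟦ g y ∈? B ⟧ + hits gs ω B

    -- Maker aims at the edges gᵢ(ωᵢ) in turn.  Such an edge is in Breaker's final set only if it
    -- was in his set B when she aimed at it, which holds for at most |B| of the N values of ωᵢ.
    play : ∀ {L} (gs : Vec (Y → Edge n) L) →
           (∀ i {x y} → lookup gs i x ≡ lookup gs i y → x ≡ y) → ∀ t {M B} →
           WinningStrategy M B → Empty (M ∩ B) → ∣ B ∣ ≤ q * ∣ M ∣ → ∣ M ∣ + L ≤ t →
           ∃ λ (out : Vec Y L → E′) → (∀ ω → Outcome M (out ω)) ×
             N * (∑[ ω ∈ vectors ys L ] hits gs ω (out ω)) ≤ L * (q * t) * N ^ L
    play [] inj t σ dis bud _ = let (B′ , h) = outcome σ dis in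
      (λ _ → B′) , (λ _ → h) , ≤-reflexive (*-zeroʳ N)
    play {suc L} (g ∷ gs) inj t {M} {B} σ dis bud ∣M∣+L≤t = out , out-outcome , (begin
      N * (∑[ ω ∈ vectors ys (suc L) ] hits (g ∷ gs) ω (out ω))
        ≡⟨ cong (N *_) (∑-vectors-suc L ys _) ⟩
      N * (∑[ y ∈ ys ] ∑[ ω ∈ vectors ys L ] ⟦ g y ∈? rest y ω ⟧ + hits gs ω (rest y ω))
        ≤⟨ *-monoʳ-≤ N (∑-mono ys λ y → ∑-mono (vectors ys L) λ ω → +-monoˡ-≤ _ (late y ω)) ⟩
      N * (∑[ y ∈ ys ] ∑[ ω ∈ vectors ys L ] ⟦ g y ∈? B ⟧ + hits gs ω (rest y ω))
        ≡⟨ cong (N *_) (trans (∑-cong ys λ y → ∑-+ (vectors ys L) _ _) (∑-+ ys _ _)) ⟩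
      N * ((∑[ y ∈ ys ] ∑[ ω ∈ vectors ys L ] ⟦ g y ∈? B ⟧) +
           (∑[ y ∈ ys ] ∑[ ω ∈ vectors ys L ] hits gs ω (rest y ω)))
        ≡⟨ *-distribˡ-+ N _ _ ⟩
      N * (∑[ y ∈ ys ] ∑[ ω ∈ vectors ys L ] ⟦ g y ∈? B ⟧) +
      N * (∑[ y ∈ ys ] ∑[ ω ∈ vectors ys L ] hits gs ω (rest y ω))
        ≤⟨ +-mono-≤ (*-monoʳ-≤ N first) (≤-trans (≤-reflexive (sym (∑-*ˡ ys N _))) (∑-mono ys later)) ⟩
      N * (N ^ L * (q * t)) + (∑[ _ ∈ ys ] L * (q * t) * N ^ L)
        ≡⟨ cong (N * (N ^ L * (q * t)) +_) (∑-const ys _) ⟩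
      N * (N ^ L * (q * t)) + N * (L * (q * t) * N ^ L)
        ≡⟨ lemma N (N ^ L) (q * t) L ⟩
      suc L * (q * t) * N ^ suc L ∎)
      where
      open ≤-Reasoning
      lemma : ∀ a b c d → a * (b * c) + a * (d * c * b) ≡ (1 + d) * c * (a * b)
      lemma = solve-∀

      r : ∀ y → Round M B (g y)
      r y = round σ dis bud (g y)
      open module R y = Round (r y)

      continue : ∀ y → ∃ λ (out : Vec Y L → E′) → (∀ ω → Outcome (M′ y) (out ω)) ×
                 N * (∑[ ω ∈ vectors ys L ] hits gs ω (out ω)) ≤ L * (q * t) * N ^ L
      continue y = play gs (λ i → inj (suc i)) t (strategy y) (disjoint y) (budget y)
        (≤-trans (+-monoˡ-≤ L (slow y)) (≤-trans (≤-reflexive (sym (+-suc ∣ M ∣ L))) ∣M∣+L≤t))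

      rest : Y → Vec Y L → E′
      rest y = proj₁ (continue y)

      out : Vec Y (suc L) → E′
      out (y ∷ ω) = rest y ω

      out-outcome : ∀ ω → Outcome M (out ω)
      out-outcome (y ∷ ω) = Outcome-⊆ (grows y) (proj₁ (proj₂ (continue y)) ω)

      late : ∀ y ω → ⟦ g y ∈? rest y ω ⟧ ≤ ⟦ g y ∈? B ⟧
      late y ω = ⟦⟧-mono (g y ∈? rest y ω) (g y ∈? B) λ gy∈ → was gy∈ (claimed y)
        where
        was : g y ∈ rest y ω → g y ∈ M′ y ⊎ g y ∈ B → g y ∈ B
        was gy∈ (inj₁ gy∈M′) = contradiction (g y , x∈p∩q⁺ (gy∈M′ , gy∈)) (proj₂ (proj₁ (proj₂ (continue y)) ω))
        was gy∈ (inj₂ gy∈B)  = gy∈B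

      later : ∀ y → N * (∑[ ω ∈ vectors ys L ] hits gs ω (rest y ω)) ≤ L * (q * t) * N ^ L
      later y = proj₂ (proj₂ (continue y))

      first : ∑[ y ∈ ys ] ∑[ ω ∈ vectors ys L ] ⟦ g y ∈? B ⟧ ≤ N ^ L * (q * t)
      first = begin
        ∑[ y ∈ ys ] ∑[ ω ∈ vectors ys L ] ⟦ g y ∈? B ⟧
          ≡⟨ ∑-cong ys (λ y → trans (∑-const (vectors ys L) _) (cong (_* ⟦ g y ∈? B ⟧) (length-vectors ys L))) ⟩
        ∑[ y ∈ ys ] N ^ L * ⟦ g y ∈? B ⟧
          ≡⟨ ∑-*ˡ ys (N ^ L) _ ⟩
        N ^ L * (∑[ y ∈ ys ] ⟦ g y ∈? B ⟧)
          -- B does not depend on `y`. Maker has at most `t` edges throughout the script, so q * t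
          -- bounds ∣ B ∣ in every round.
          ≤⟨ *-monoʳ-≤ (N ^ L) (≤-trans (∑-preimage≤∣∣ B g ys-unique (inj zero))
               (≤-trans bud (*-monoʳ-≤ q (≤-trans (m≤m+n ∣ M ∣ (suc L)) ∣M∣+L≤t)))) ⟩
        N ^ L * (q * t) ∎

    module _ (_≟_ : DecidableEquality Y) (ys-complete : ∀ y → y ∈ᴸ ys) where

      open Samples _≟_

      -- Laid out in the order of `Vec.concat`: T consecutive rounds serve the same edge of H.
      blocks : ∀ {ℓ} T → (Fin ℓ → Y → Edge n) → Vec (Y → Edge n) (ℓ * T)
      blocks {zero}  T g = []
      blocks {suc ℓ} T g = Vec.replicate T (g zero) Vec.++ blocks T (g ∘ suc)

      blocks-injective : ∀ {ℓ} T (g : Fin ℓ → Y → Edge n) → (∀ i {x y} → g i x ≡ g i y → x ≡ y) →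
                         ∀ i {x y} → lookup (blocks T g) i x ≡ lookup (blocks T g) i y → x ≡ y
      blocks-injective {suc ℓ} T g inj i = on-++ T i
        where
        on-++ : ∀ T′ (i : Fin (T′ + ℓ * T)) {x y} →
                lookup (Vec.replicate T′ (g zero) Vec.++ blocks T (g ∘ suc)) i x ≡
                lookup (Vec.replicate T′ (g zero) Vec.++ blocks T (g ∘ suc)) i y → x ≡ y
        on-++ zero     i       = blocks-injective T (g ∘ suc) (inj ∘ suc) i
        on-++ (suc T′) zero    = inj zero
        on-++ (suc T′) (suc i) = on-++ T′ i

      hits-++ : ∀ {L L′} (gs : Vec (Y → Edge n) L) {gs′ : Vec (Y → Edge n) L′} ω {ω′} {B} →
                hits (gs Vec.++ gs′) (ω Vec.++ ω′) B ≡ hits gs ω B + hits gs′ ω′ B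
      hits-++ []       []      = refl
      hits-++ (g ∷ gs) (y ∷ ω) {B = B} =
        trans (cong (⟦ g y ∈? B ⟧ +_) (hits-++ gs ω)) (sym (+-assoc ⟦ g y ∈? B ⟧ _ _))

      -- Groups the rounds of a block by the value drawn.
      hits-replicate : ∀ {T} (g : Y → Edge n) (w : Vec Y T) B →
                       hits (Vec.replicate T g) w B ≡ ∑[ y ∈ ys ] count w y * ⟦ g y ∈? B ⟧
      hits-replicate g []      B = sym (∑-zero ys)
      hits-replicate g (z ∷ w) B = sym (trans
        (trans (∑-cong ys λ y → *-distribʳ-+ ⟦ g y ∈? B ⟧ ⟦ z ≟ y ⟧ (count w y)) (∑-+ ys _ _))
        (cong₂ _+_ (∑-δ _≟_ (λ y → ⟦ g y ∈? B ⟧) ys-unique (ys-complete z)) (sym (hits-replicate g w B))))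

      blockHits : ∀ {ℓ T} → (Fin ℓ → Y → Edge n) → Vec (Vec Y T) ℓ → E′ → ℕ
      blockHits g ω B = ∑[ i ∈ allFin _ ] ∑[ y ∈ ys ] count (lookup ω i) y * ⟦ g i y ∈? B ⟧

      hits-blocks : ∀ {ℓ T} (g : Fin ℓ → Y → Edge n) (ω : Vec (Vec Y T) ℓ) B →
                    hits (blocks T g) (Vec.concat ω) B ≡ blockHits g ω B
      hits-blocks g []      B = refl
      hits-blocks {suc ℓ} {T} g (w ∷ ω) B = trans (hits-++ (Vec.replicate T (g zero)) w)
        (trans (cong₂ _+_ (hits-replicate (g zero) w B) (hits-blocks (g ∘ suc) ω B))
          (sym (∑-allFin-suc (λ i → ∑[ y ∈ ys ] count (lookup (w ∷ ω) i) y * ⟦ g i y ∈? B ⟧))))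

      -- The whole script from the empty board: on average at most q(ℓT)²/N samples are bad.
      play-blocks : BreakerWins → ∀ {ℓ} T (g : Fin ℓ → Y → Edge n) → (∀ i {x y} → g i x ≡ g i y → x ≡ y) →
        ∃ λ (out : Vec (Vec Y T) ℓ → E′) → (∀ ω → HitsEveryCopy (out ω)) ×
          N * (∑[ ω ∈ vectors (vectors ys T) ℓ ] blockHits g ω (out ω)) ≤
          ℓ * T * (q * (ℓ * T)) * N ^ (ℓ * T)
      play-blocks σ {ℓ} T g inj =
        let (out , h , bound) = play (blocks T g) (blocks-injective T g inj) (ℓ * T) σ empty
              (≤-trans (≤-reflexive (∣⊥∣≡0 (size n))) z≤n)
              (≤-reflexive (cong (_+ ℓ * T) (∣⊥∣≡0 (size n))))
        in out ∘ Vec.concat , (λ ω → proj₁ (h (Vec.concat ω))) ,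
           ≤-trans (≤-reflexive (cong (N *_) (trans
             (∑-cong (vectors (vectors ys T) ℓ) λ ω → sym (hits-blocks g ω _))
             (∑-vectors-concat ys ℓ T (λ ω → hits (blocks T g) ω (out ω)))))) bound
        where
        empty : Empty (⊥ ∩ ⊥ {size n})
        empty (y , y∈) = ∉⊥ (proj₁ (x∈p∩q⁻ ⊥ ⊥ y∈))

-- First and second moments

2*m*n≤m²+n² : ∀ m n → 2 * (m * n) ≤ m * m + n * n
2*m*n≤m²+n² m n with ≤-total m n
... | inj₁ m≤n = subst (λ n → 2 * (m * n) ≤ m * m + n * n) (m+[n∸m]≡n m≤n)
  (≤-trans (m≤m+n _ ((n ∸ m) * (n ∸ m))) (≤-reflexive (lemma m (n ∸ m))))
  where
  lemma : ∀ a d → 2 * (a * (a + d)) + d * d ≡ a * a + (a + d) * (a + d)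
  lemma = solve-∀
... | inj₂ n≤m = subst (λ m → 2 * (m * n) ≤ m * m + n * n) (m+[n∸m]≡n n≤m)
  (≤-trans (m≤m+n _ ((m ∸ n) * (m ∸ n))) (≤-reflexive (lemma n (m ∸ n))))
  where
  lemma : ∀ a d → 2 * ((a + d) * a) + d * d ≡ (a + d) * (a + d) + a * a
  lemma = solve-∀

-- The optimal choice is x = a, y = p. If p = 0, then x = q + 1, y = 1 already rules out a > 0.
discriminant : ∀ {a p q} → (∀ x y → 2 * (x * y) * a ≤ x * x * p + y * y * q) → a * a ≤ p * q
discriminant {zero}          h = z≤n
discriminant {suc a} {zero} {q} h = contradiction (h (suc q) 1) (<⇒≱ (begin-strict
  suc q * suc q * 0 + 1 * 1 * q     ≡⟨ lemma₁ q ⟩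
  q                                 <⟨ m≤m+n (suc q) _ ⟩
  suc q + (suc q + a * (2 * suc q)) ≡⟨ lemma₂ q a ⟩
  2 * (suc q * 1) * suc a           ∎))
  where
  open ≤-Reasoning
  lemma₁ : ∀ q → (1 + q) * (1 + q) * 0 + 1 * 1 * q ≡ q
  lemma₁ = solve-∀
  lemma₂ : ∀ q a → (1 + q) + ((1 + q) + a * (2 * (1 + q))) ≡ 2 * ((1 + q) * 1) * (1 + a)
  lemma₂ = solve-∀
discriminant {a} {p@(suc _)} {q} h = *-cancelʳ-≤ (a * a) (p * q) p (+-cancelˡ-≤ (a * a * p) _ _ (begin
  a * a * p + a * a * p   ≡⟨ lemma₁ a p ⟩
  2 * (a * p) * a         ≤⟨ h a p ⟩
  a * a * p + p * p * q   ≡⟨ cong (a * a * p +_) (lemma₂ p q) ⟩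
  a * a * p + p * q * p   ∎))
  where
  open ≤-Reasoning
  lemma₁ : ∀ a p → a * a * p + a * a * p ≡ 2 * (a * p) * a
  lemma₁ = solve-∀
  lemma₂ : ∀ p q → p * p * q ≡ p * q * p
  lemma₂ = solve-∀

module Moments {Y : Set} (_≟_ : DecidableEquality Y) (ys : List Y)
  (ys-unique : Unique ys) (ys-complete : ∀ y → y ∈ᴸ ys) where

  open Samples _≟_

  private
    N = length ys

  ∑-δ′ : ∀ y (f : Y → ℕ) → ∑[ z ∈ ys ] ⟦ y ≟ z ⟧ * f z ≡ f y
  ∑-δ′ y f = ∑-δ _≟_ f ys-unique (ys-complete y)

  ∑-δʳ : ∀ y (f : Y → ℕ) → ∑[ z ∈ ys ] ⟦ z ≟ y ⟧ * f z ≡ f y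
  ∑-δʳ y f = trans (∑-cong ys λ z → cong (_* f z) (⟦⟧-cong (z ≟ y) (y ≟ z) sym sym)) (∑-δ′ y f)

  ∑⟦⟧≡1 : ∀ y → ∑[ z ∈ ys ] ⟦ z ≟ y ⟧ ≡ 1
  ∑⟦⟧≡1 y = trans (∑-cong ys λ z → sym (*-identityʳ ⟦ z ≟ y ⟧)) (∑-δʳ y (λ _ → 1))

  -- Each of the T samples equals `y` in a 1/N share of the outcomes.
  first-moment : ∀ T y → N * (∑[ w ∈ vectors ys T ] count w y) ≡ T * N ^ T
  first-moment zero    y = *-zeroʳ N
  first-moment (suc T) y = begin
    N * (∑[ w ∈ vectors ys (suc T) ] count w y)
      ≡⟨ cong (N *_) (∑-vectors-suc T ys _) ⟩
    N * (∑[ z ∈ ys ] ∑[ w ∈ vectors ys T ] ⟦ z ≟ y ⟧ + count w y)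
      ≡⟨ cong (N *_) (∑-cong ys λ z → trans (∑-+ (vectors ys T) _ _)
           (cong (_+ S) (trans (∑-const (vectors ys T) _) (cong (_* ⟦ z ≟ y ⟧) (length-vectors ys T))))) ⟩
    N * (∑[ z ∈ ys ] N ^ T * ⟦ z ≟ y ⟧ + S)
      ≡⟨ cong (N *_) (trans (∑-+ ys _ _) (cong₂ _+_
           (trans (∑-*ˡ ys (N ^ T) _) (cong (N ^ T *_) (∑⟦⟧≡1 y))) (∑-const ys S))) ⟩
    N * (N ^ T * 1 + N * S)
      ≡⟨ cong (λ t → N * (N ^ T * 1 + t)) (first-moment T y) ⟩
    N * (N ^ T * 1 + T * N ^ T)
      ≡⟨ lemma N (N ^ T) T ⟩
    suc T * N ^ suc T ∎
    where
    open ≡-Reasoning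
    S = ∑[ w ∈ vectors ys T ] count w y
    lemma : ∀ a b c → a * (b * 1 + c * b) ≡ (1 + c) * (a * b)
    lemma = solve-∀

  -- Two different samples contribute T(T - 1)/N² to the mean, and a sample paired with itself
  -- contributes T/N if y ≡ y′. Rounding T(T - 1) up to T * T is the slack given away in the
  -- induction.
  second-moment : ∀ T y y′ → N * N * (∑[ w ∈ vectors ys T ] count w y * count w y′) ≤
                  N ^ T * (T * T + ⟦ y ≟ y′ ⟧ * (T * N))
  second-moment zero    y y′ = ≤-trans (≤-reflexive (*-zeroʳ (N * N))) z≤n
  second-moment (suc T) y y′ = begin
    N * N * (∑[ w ∈ vectors ys (suc T) ] count w y * count w y′)
      ≡⟨ cong (N * N *_) (∑-vectors-suc T ys _) ⟩
    N * N * (∑[ z ∈ ys ] ∑[ w ∈ vectors ys T ] (⟦ z ≟ y ⟧ + count w y) * (⟦ z ≟ y′ ⟧ + count w y′))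
      ≡⟨ cong (N * N *_) (∑-cong ys inner) ⟩
    N * N * (∑[ z ∈ ys ] (N ^ T * (⟦ z ≟ y ⟧ * ⟦ z ≟ y′ ⟧) + ⟦ z ≟ y ⟧ * S y′) + (⟦ z ≟ y′ ⟧ * S y + SS))
      ≡⟨ cong (N * N *_) outer ⟩
    N * N * ((N ^ T * D + S y′) + (S y + N * SS))
      ≡⟨ lemma₁ N (N ^ T) D (S y) (S y′) SS ⟩
    N * N * N ^ T * D + N * (N * S y′) + N * (N * S y) + N * (N * N * SS)
      ≤⟨ +-mono-≤ (≤-reflexive (cong₂ (λ a b → N * N * N ^ T * D + N * a + N * b)
           (first-moment T y′) (first-moment T y))) (*-monoʳ-≤ N (second-moment T y y′)) ⟩
    N * N * N ^ T * D + N * (T * N ^ T) + N * (T * N ^ T) + N * (N ^ T * (T * T + D * (T * N)))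
      ≤⟨ m≤m+n _ (N * N ^ T) ⟩
    N * N * N ^ T * D + N * (T * N ^ T) + N * (T * N ^ T) + N * (N ^ T * (T * T + D * (T * N))) + N * N ^ T
      ≡⟨ lemma₂ N (N ^ T) D T ⟩
    N ^ suc T * (suc T * suc T + D * (suc T * N)) ∎
    where
    open ≤-Reasoning
    S : Y → ℕ
    S y = ∑[ w ∈ vectors ys T ] count w y
    SS = ∑[ w ∈ vectors ys T ] count w y * count w y′
    D = ⟦ y ≟ y′ ⟧

    lemma₁ : ∀ n p d s s′ t → n * n * ((p * d + s′) + (s + n * t)) ≡
             n * n * p * d + n * (n * s′) + n * (n * s) + n * (n * n * t)
    lemma₁ = solve-∀
    lemma₂ : ∀ n p d t → n * n * p * d + n * (t * p) + n * (t * p) + n * (p * (t * t + d * (t * n))) + n * p ≡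
             n * p * ((1 + t) * (1 + t) + d * ((1 + t) * n))
    lemma₂ = solve-∀
    lemma₃ : ∀ a b c d → (a + b) * (c + d) ≡ (a * c + a * d) + (c * b + b * d)
    lemma₃ = solve-∀

    inner : ∀ z → ∑[ w ∈ vectors ys T ] (⟦ z ≟ y ⟧ + count w y) * (⟦ z ≟ y′ ⟧ + count w y′) ≡
            (N ^ T * (⟦ z ≟ y ⟧ * ⟦ z ≟ y′ ⟧) + ⟦ z ≟ y ⟧ * S y′) + (⟦ z ≟ y′ ⟧ * S y + SS)
    inner z = trans (∑-cong (vectors ys T) λ w → lemma₃ ⟦ z ≟ y ⟧ (count w y) ⟦ z ≟ y′ ⟧ (count w y′))
      (trans (∑-+ (vectors ys T) _ _) (cong₂ _+_
        (trans (∑-+ (vectors ys T) _ _) (cong₂ _+_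
          (trans (∑-const (vectors ys T) _) (cong (_* (⟦ z ≟ y ⟧ * ⟦ z ≟ y′ ⟧)) (length-vectors ys T)))
          (∑-*ˡ (vectors ys T) ⟦ z ≟ y ⟧ _)))
        (trans (∑-+ (vectors ys T) _ _) (cong (_+ SS) (∑-*ˡ (vectors ys T) ⟦ z ≟ y′ ⟧ _)))))

    outer : ∑[ z ∈ ys ] (N ^ T * (⟦ z ≟ y ⟧ * ⟦ z ≟ y′ ⟧) + ⟦ z ≟ y ⟧ * S y′) + (⟦ z ≟ y′ ⟧ * S y + SS) ≡
            (N ^ T * D + S y′) + (S y + N * SS)
    outer = trans (∑-+ ys _ _) (cong₂ _+_
      (trans (∑-+ ys _ _) (cong₂ _+_
        (trans (∑-*ˡ ys (N ^ T) _) (cong (N ^ T *_) (∑-δʳ y (λ z → ⟦ z ≟ y′ ⟧))))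
        (∑-δʳ y (λ _ → S y′))))
      (trans (∑-+ ys _ _) (cong₂ _+_ (∑-δʳ y′ (λ _ → S y)) (∑-const ys SS))))

  -- c i y counts the samples for the i-th edge of H that equal y, and f i y the bad ones among
  -- them; φ ranges over the potential copies of H, whose i-th edge is pos i φ.
  module _ {ℓ} {Φ : Set} (φs : List Φ) (pos : Fin ℓ → Φ → Y) where

    others : (Fin ℓ → Y → ℕ) → Fin ℓ → Φ → ℕ
    others c i φ = ∏ λ j → if does (j Fin.≟ i) then 1 else c j (pos j φ)

    -- The common sample at `i` is counted once; at every other `j` the two copies choose their
    -- samples separately.
    pair : (Fin ℓ → Y → ℕ) → Fin ℓ → Φ → Φ → Fin ℓ → ℕ
    pair c i φ φ′ j = if does (j Fin.≟ i) then c j (pos j φ) else c j (pos j φ) * c j (pos j φ′)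

    -- The number of pairs of copies with a common sample, counted by its position; φ ≡ φ′ is
    -- included.
    overlaps : (Fin ℓ → Y → ℕ) → ℕ
    overlaps c = ∑[ i ∈ allFin ℓ ] ∑[ φ ∈ φs ] ∑[ φ′ ∈ φs ] ⟦ pos i φ ≟ pos i φ′ ⟧ * ∏ (pair c i φ φ′)

    pair-others : ∀ c i φ φ′ → ∏ (pair c i φ φ′) ≡ c i (pos i φ) * (others c i φ * others c i φ′)
    pair-others c i φ φ′ = begin
      ∏ (pair c i φ φ′)
        ≡⟨ ∏-cong (λ j → split (does (j Fin.≟ i)) _ _ _) ⟩
      ∏ (λ j → self j * (factor φ j * factor φ′ j))
        ≡⟨ ∏-* self _ ⟩
      ∏ self * ∏ (λ j → factor φ j * factor φ′ j)
        ≡⟨ cong₂ _*_ (∏-single i (λ j → c j (pos j φ))) (∏-* (factor φ) (factor φ′)) ⟩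
      c i (pos i φ) * (others c i φ * others c i φ′) ∎
      where
      open ≡-Reasoning
      self : Fin ℓ → ℕ
      self j = if does (j Fin.≟ i) then c j (pos j φ) else 1
      factor : Φ → Fin ℓ → ℕ
      factor φ j = if does (j Fin.≟ i) then 1 else c j (pos j φ)
      split : ∀ b (x y z : ℕ) → (if b then x else y * z) ≡
              (if b then x else 1) * ((if b then 1 else y) * (if b then 1 else z))
      split true  x y z = sym (*-identityʳ x)
      split false x y z = sym (*-identityˡ (y * z))

    -- Each copy is charged to a position at which all its samples are bad, and copies are grouped
    -- by the edge u used there. If t counts the completions through u, then 2xyft ≤ x²f + y²ft²;
    -- only in the last term is f replaced by c. The sum of the ct² is `overlaps c`.
    cauchy-schwarz : ∀ (c f : Fin ℓ → Y → ℕ) → (∀ i y → f i y ≤ c i y) →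
      (∀ φ → ∃ λ i → f i (pos i φ) ≡ c i (pos i φ)) → ∀ x y →
      2 * (x * y) * (∑[ φ ∈ φs ] ∏ λ i → c i (pos i φ)) ≤
      x * x * (∑[ i ∈ allFin ℓ ] ∑[ u ∈ ys ] f i u) + y * y * overlaps c
    cauchy-schwarz c f f≤c useless x y = begin
      2 * (x * y) * (∑[ φ ∈ φs ] ∏ λ i → c i (pos i φ))
        ≤⟨ *-monoʳ-≤ (2 * (x * y)) (∑-mono φs some-useless) ⟩
      2 * (x * y) * (∑[ φ ∈ φs ] ∑[ i ∈ allFin ℓ ] f i (pos i φ) * others c i φ)
        ≡⟨ cong (2 * (x * y) *_) (trans (∑-comm φs (allFin ℓ) _) (∑-cong (allFin ℓ) by-position)) ⟩
      2 * (x * y) * (∑[ i ∈ allFin ℓ ] ∑[ u ∈ ys ] f i u * through i u)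
        ≡⟨ trans (sym (∑-*ˡ (allFin ℓ) (2 * (x * y)) _))
             (∑-cong (allFin ℓ) λ i → sym (∑-*ˡ ys (2 * (x * y)) _)) ⟩
      ∑[ i ∈ allFin ℓ ] ∑[ u ∈ ys ] 2 * (x * y) * (f i u * through i u)
        ≤⟨ ∑-mono (allFin ℓ) (λ i → ∑-mono ys (am-gm i)) ⟩
      ∑[ i ∈ allFin ℓ ] ∑[ u ∈ ys ] x * x * f i u + y * y * (c i u * (through i u * through i u))
        ≡⟨ ∑-cong (allFin ℓ) (λ i → trans (∑-+ ys _ _)
             (cong₂ _+_ (∑-*ˡ ys (x * x) _) (trans (∑-*ˡ ys (y * y) _) (cong (y * y *_) (square i))))) ⟩
      ∑[ i ∈ allFin ℓ ] x * x * (∑[ u ∈ ys ] f i u) + y * y * pairs i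
        ≡⟨ trans (∑-+ (allFin ℓ) _ _) (cong₂ _+_ (∑-*ˡ (allFin ℓ) (x * x) _) (∑-*ˡ (allFin ℓ) (y * y) _)) ⟩
      x * x * (∑[ i ∈ allFin ℓ ] ∑[ u ∈ ys ] f i u) + y * y * overlaps c ∎
      where
      open ≤-Reasoning

      through : Fin ℓ → Y → ℕ
      through i u = ∑[ φ ∈ φs ] ⟦ pos i φ ≟ u ⟧ * others c i φ

      pairs : Fin ℓ → ℕ
      pairs i = ∑[ φ ∈ φs ] ∑[ φ′ ∈ φs ] ⟦ pos i φ ≟ pos i φ′ ⟧ * ∏ (pair c i φ φ′)

      some-useless : ∀ φ → ∏ (λ i → c i (pos i φ)) ≤ ∑[ i ∈ allFin ℓ ] f i (pos i φ) * others c i φ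
      some-useless φ = let (i , f≡c) = useless φ in begin
        ∏ (λ i → c i (pos i φ))              ≡⟨ *-identityˡ _ ⟨
        1 * ∏ (λ i → c i (pos i φ))          ≡⟨ ∏-update i (λ _ → 1) (λ j → c j (pos j φ)) ⟨
        others c i φ * c i (pos i φ)         ≡⟨ *-comm (others c i φ) _ ⟩
        c i (pos i φ) * others c i φ         ≡⟨ cong (_* others c i φ) f≡c ⟨
        f i (pos i φ) * others c i φ         ≤⟨ ≤-∑ (λ i → f i (pos i φ) * others c i φ) (∈-allFin i) ⟩
        ∑[ i ∈ allFin ℓ ] f i (pos i φ) * others c i φ ∎

      by-position : ∀ i → ∑[ φ ∈ φs ] f i (pos i φ) * others c i φ ≡ ∑[ u ∈ ys ] f i u * through i u
      by-position i = begin-equality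
        ∑[ φ ∈ φs ] f i (pos i φ) * others c i φ
          ≡⟨ ∑-cong φs (λ φ → trans (cong (_* others c i φ) (sym (∑-δ′ (pos i φ) (f i))))
               (sym (∑-*ʳ ys (others c i φ) _))) ⟩
        ∑[ φ ∈ φs ] ∑[ u ∈ ys ] ⟦ pos i φ ≟ u ⟧ * f i u * others c i φ
          ≡⟨ ∑-comm φs ys _ ⟩
        ∑[ u ∈ ys ] ∑[ φ ∈ φs ] ⟦ pos i φ ≟ u ⟧ * f i u * others c i φ
          ≡⟨ ∑-cong ys (λ u → trans (∑-cong φs λ φ → lemma ⟦ pos i φ ≟ u ⟧ (f i u) (others c i φ))
               (∑-*ˡ φs (f i u) _)) ⟩
        ∑[ u ∈ ys ] f i u * through i u ∎
        where
        lemma : ∀ a b c → a * b * c ≡ b * (a * c)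
        lemma = solve-∀

      am-gm : ∀ i u → 2 * (x * y) * (f i u * through i u) ≤
              x * x * f i u + y * y * (c i u * (through i u * through i u))
      am-gm i u = begin
        2 * (x * y) * (f i u * t)                       ≡⟨ lemma₁ x y (f i u) t ⟩
        f i u * (2 * (x * (y * t)))                     ≤⟨ *-monoʳ-≤ (f i u) (2*m*n≤m²+n² x (y * t)) ⟩
        f i u * (x * x + y * t * (y * t))               ≡⟨ lemma₂ x y (f i u) t ⟩
        x * x * f i u + f i u * (y * t * (y * t))
          ≤⟨ +-monoʳ-≤ (x * x * f i u) (*-monoˡ-≤ (y * t * (y * t)) (f≤c i u)) ⟩
        x * x * f i u + c i u * (y * t * (y * t))       ≡⟨ cong (x * x * f i u +_) (lemma₃ y (c i u) t) ⟩
        x * x * f i u + y * y * (c i u * (t * t))       ∎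
        where
        t = through i u
        lemma₁ : ∀ x y f t → 2 * (x * y) * (f * t) ≡ f * (2 * (x * (y * t)))
        lemma₁ = solve-∀
        lemma₂ : ∀ x y f t → f * (x * x + y * t * (y * t)) ≡ x * x * f + f * (y * t * (y * t))
        lemma₂ = solve-∀
        lemma₃ : ∀ y c t → c * (y * t * (y * t)) ≡ y * y * (c * (t * t))
        lemma₃ = solve-∀

      square : ∀ i → ∑[ u ∈ ys ] c i u * (through i u * through i u) ≡ pairs i
      square i = begin-equality
        ∑[ u ∈ ys ] c i u * (through i u * through i u)
          ≡⟨ ∑-cong ys (λ u → trans (cong (c i u *_) (∑-* φs φs _ _))
               (trans (sym (∑-*ˡ φs (c i u) _)) (∑-cong φs λ φ → sym (∑-*ˡ φs (c i u) _)))) ⟩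
        ∑[ u ∈ ys ] ∑[ φ ∈ φs ] ∑[ φ′ ∈ φs ] term u φ φ′
          ≡⟨ ∑-comm ys φs _ ⟩
        ∑[ φ ∈ φs ] ∑[ u ∈ ys ] ∑[ φ′ ∈ φs ] term u φ φ′
          ≡⟨ ∑-cong φs (λ φ → trans (∑-comm ys φs _) (∑-cong φs (collapse φ))) ⟩
        pairs i ∎
        where
        term : Y → Φ → Φ → ℕ
        term u φ φ′ = c i u * (⟦ pos i φ ≟ u ⟧ * others c i φ * (⟦ pos i φ′ ≟ u ⟧ * others c i φ′))
        lemma : ∀ c d o d′ o′ → c * (d * o * (d′ * o′)) ≡ d * (d′ * (c * (o * o′)))
        lemma = solve-∀
        collapse : ∀ φ φ′ → ∑[ u ∈ ys ] term u φ φ′ ≡ ⟦ pos i φ ≟ pos i φ′ ⟧ * ∏ (pair c i φ φ′)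
        collapse φ φ′ = begin-equality
          ∑[ u ∈ ys ] term u φ φ′
            ≡⟨ ∑-cong ys (λ u → lemma (c i u) ⟦ pos i φ ≟ u ⟧ (others c i φ) ⟦ pos i φ′ ≟ u ⟧ (others c i φ′)) ⟩
          ∑[ u ∈ ys ] ⟦ pos i φ ≟ u ⟧ * (⟦ pos i φ′ ≟ u ⟧ * (c i u * (others c i φ * others c i φ′)))
            ≡⟨ ∑-δ′ (pos i φ) _ ⟩
          ⟦ pos i φ′ ≟ pos i φ ⟧ * (c i (pos i φ) * (others c i φ * others c i φ′))
            ≡⟨ cong₂ _*_ (⟦⟧-cong (pos i φ′ ≟ pos i φ) (pos i φ ≟ pos i φ′) sym sym) (sym (pair-others c i φ φ′)) ⟩
          ⟦ pos i φ ≟ pos i φ′ ⟧ * ∏ (pair c i φ φ′) ∎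

-- Expected numbers of copies and of overlapping pairs

∏-^ : ∀ c {n} (f : Fin n → ℕ) → ∏ (λ i → c ^ f i) ≡ c ^ ∑ (allFin n) f
∏-^ c {zero}  f = refl
∏-^ c {suc n} f = trans (cong (c ^ f zero *_) (∏-^ c (f ∘ suc)))
  (trans (sym (^-distribˡ-+-* c (f zero) _)) (cong (c ^_) (sym (∑-allFin-suc f))))

-- z plays the role of k^{1/m(H)}.  An element φ of Φ picks a vertex in each of the v blocks, and
-- an edge between two blocks is an element of Y.

module Sampling {v ℓ} (s t : Fin ℓ → Fin v) (k T z : ℕ)
  .⦃ _ : NonZero k ⦄ .⦃ _ : NonZero z ⦄ (k²≤Tz : k * k ≤ T * z) where

  Y : Set
  Y = Fin k × Fin k

  _≟_ : DecidableEquality Y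
  _≟_ = ≡-dec Fin._≟_ Fin._≟_

  ys : List Y
  ys = cartesianProduct (allFin k) (allFin k)

  ys-unique : Unique ys
  ys-unique = Unique.cartesianProduct⁺ (Unique.allFin⁺ k) (Unique.allFin⁺ k)

  ys-complete : ∀ y → y ∈ᴸ ys
  ys-complete (i , j) = ∈-cartesianProduct⁺ (∈-allFin i) (∈-allFin j)

  open Samples _≟_ public
  open Moments _≟_ ys ys-unique ys-complete public

  N : ℕ
  N = length ys

  N≡k² : N ≡ k * k
  N≡k² = begin
    N                                               ≡⟨ length-∑ ys ⟩
    ∑[ _ ∈ ys ] 1                                   ≡⟨ ∑-cartesianProductWith _,_ (allFin k) (allFin k) _ ⟩
    ∑[ _ ∈ allFin k ] ∑[ _ ∈ allFin k ] 1           ≡⟨ ∑-const (allFin k) _ ⟩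
    length (allFin k) * (∑[ _ ∈ allFin k ] 1)       ≡⟨ cong₂ _*_ (length-allFin k)
                                                         (trans (sym (length-∑ (allFin k))) (length-allFin k)) ⟩
    k * k                                           ∎
    where open ≡-Reasoning

  N≤Tz : N ≤ T * z
  N≤Tz = subst (_≤ T * z) (sym N≡k²) k²≤Tz

  Φ : Set
  Φ = Vec (Fin k) v

  φs : List Φ
  φs = vectors (allFin k) v

  pos : Fin ℓ → Φ → Y
  pos i φ = lookup φ (s i) , lookup φ (t i)

  samples : List (Vec (Vec Y T) ℓ)
  samples = vectors (vectors ys T) ℓ

  counts : Vec (Vec Y T) ℓ → Fin ℓ → Y → ℕ
  counts ω i = count (lookup ω i)

  expected-copies : N ^ ℓ * (∑[ ω ∈ samples ] ∑[ φ ∈ φs ] ∏ λ i → counts ω i (pos i φ)) ≡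
                    k ^ v * (T * N ^ T) ^ ℓ
  expected-copies = begin
    N ^ ℓ * (∑[ ω ∈ samples ] ∑[ φ ∈ φs ] ∏ λ i → counts ω i (pos i φ))
      ≡⟨ cong (N ^ ℓ *_) (∑-comm samples φs _) ⟩
    N ^ ℓ * (∑[ φ ∈ φs ] ∑[ ω ∈ samples ] ∏ λ i → counts ω i (pos i φ))
      ≡⟨ ∑-*ˡ φs (N ^ ℓ) _ ⟨
    ∑[ φ ∈ φs ] N ^ ℓ * (∑[ ω ∈ samples ] ∏ λ i → counts ω i (pos i φ))
      ≡⟨ ∑-cong φs per-copy ⟩
    ∑[ φ ∈ φs ] (T * N ^ T) ^ ℓ
      ≡⟨ ∑-const φs _ ⟩
    length φs * (T * N ^ T) ^ ℓ
      ≡⟨ cong (_* (T * N ^ T) ^ ℓ) (trans (length-vectors (allFin k) v) (cong (_^ v) (length-allFin k))) ⟩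
    k ^ v * (T * N ^ T) ^ ℓ ∎
    where
    open ≡-Reasoning
    per-copy : ∀ φ → N ^ ℓ * (∑[ ω ∈ samples ] ∏ λ i → counts ω i (pos i φ)) ≡ (T * N ^ T) ^ ℓ
    per-copy φ = begin
      N ^ ℓ * (∑[ ω ∈ samples ] ∏ λ i → counts ω i (pos i φ))
        ≡⟨ cong₂ _*_ (sym (∏-const ℓ N)) (∑-vectors-∏ ℓ (vectors ys T) λ i w → count w (pos i φ)) ⟩
      ∏ {ℓ} (λ _ → N) * ∏ (λ i → ∑[ w ∈ vectors ys T ] count w (pos i φ))
        ≡⟨ ∏-* {ℓ} (λ _ → N) _ ⟨
      ∏ (λ i → N * (∑[ w ∈ vectors ys T ] count w (pos i φ)))
        ≡⟨ ∏-cong (λ i → first-moment T (pos i φ)) ⟩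
      ∏ {ℓ} (λ _ → T * N ^ T)
        ≡⟨ ∏-const ℓ _ ⟩
      (T * N ^ T) ^ ℓ ∎

  -- For fixed φ the sum factorises over the vertices: k - 1 values that disagree and one of weight
  -- k make less than k + k. This treats all agreement sets at once.
  ∑-agreement : ∑[ φ ∈ φs ] ∑[ φ′ ∈ φs ] ∏ (λ x → k ^ ⟦ lookup φ x Fin.≟ lookup φ′ x ⟧) ≤ k ^ v * (k + k) ^ v
  ∑-agreement = begin
    ∑[ φ ∈ φs ] ∑[ φ′ ∈ φs ] ∏ (λ x → k ^ ⟦ lookup φ x Fin.≟ lookup φ′ x ⟧)
      ≡⟨ ∑-cong φs (λ φ → ∑-vectors-∏ v (allFin k) λ x u → k ^ ⟦ lookup φ x Fin.≟ u ⟧) ⟩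
    ∑[ φ ∈ φs ] ∏ (λ x → ∑[ u ∈ allFin k ] k ^ ⟦ lookup φ x Fin.≟ u ⟧)
      ≤⟨ ∑-mono φs (λ φ → ∏-mono λ x → at-vertex (lookup φ x)) ⟩
    ∑[ φ ∈ φs ] ∏ {v} (λ _ → k + k)
      ≡⟨ trans (∑-const φs _) (cong₂ _*_
           (trans (length-vectors (allFin k) v) (cong (_^ v) (length-allFin k))) (∏-const v _)) ⟩
    k ^ v * (k + k) ^ v ∎
    where
    open ≤-Reasoning
    at-vertex : ∀ p → ∑[ u ∈ allFin k ] k ^ ⟦ p Fin.≟ u ⟧ ≤ k + k
    at-vertex p = begin
      ∑[ u ∈ allFin k ] k ^ ⟦ p Fin.≟ u ⟧         ≤⟨ ∑-mono (allFin k) (λ u → split (p Fin.≟ u)) ⟩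
      ∑[ u ∈ allFin k ] 1 + ⟦ p Fin.≟ u ⟧ * k     ≡⟨ ∑-+ (allFin k) _ _ ⟩
      (∑[ u ∈ allFin k ] 1) + (∑[ u ∈ allFin k ] ⟦ p Fin.≟ u ⟧ * k)
        ≡⟨ cong₂ _+_ (trans (sym (length-∑ (allFin k))) (length-allFin k))
             (∑-δ Fin._≟_ (λ _ → k) (Unique.allFin⁺ k) (∈-allFin p)) ⟩
      k + k ∎
      where
      split : ∀ {P : Set} (d : Dec P) → k ^ ⟦ d ⟧ ≤ 1 + ⟦ d ⟧ * k
      split (yes _) = ≤-trans (≤-reflexive (trans (*-identityʳ k) (sym (*-identityˡ k)))) (n≤1+n _)
      split (no _)  = ≤-refl

  -- Divided by k²z, this is z^{e - 1} ≤ k^{v - 2} for the subgraph induced on U, and it is how m(H)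
  -- enters.
  module _ (sparse : ∀ (U : Subset v) i → s i ∈ U → t i ∈ U →
              k * k * z ^ (∑[ j ∈ allFin ℓ ] ⟦ (s j ∈? U) ×-dec (t j ∈? U) ⟧) ≤ z * k ^ ∣ U ∣) where

    private
      V = 2 * (N ^ T * (T * T))

    -- V is twice the squared mean, scaled by N² and the number of outcomes. An agreement costs a
    -- factor N/T ≤ z, and so does position `i`, where the mean T/N itself stands in place of its
    -- square.
    pair-moment : ∀ i φ φ′ → pos i φ ≡ pos i φ′ → ∀ j →
      N * N * (∑[ w ∈ vectors ys T ] pair φs pos (λ _ → count w) i φ φ′ j) ≤
      V * z ^ ⟦ pos j φ ≟ pos j φ′ ⟧
    pair-moment i φ φ′ eq j with j Fin.≟ i
    ... | yes refl rewrite ⟦⟧-yes (pos i φ ≟ pos i φ′) eq = begin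
      N * N * (∑[ w ∈ vectors ys T ] count w (pos i φ))    ≡⟨ *-assoc N N _ ⟩
      N * (N * (∑[ w ∈ vectors ys T ] count w (pos i φ)))  ≡⟨ cong (N *_) (first-moment T (pos i φ)) ⟩
      N * (T * N ^ T)                                      ≤⟨ *-monoˡ-≤ (T * N ^ T) N≤Tz ⟩
      T * z * (T * N ^ T)                                  ≤⟨ m≤m+n _ (T * z * (T * N ^ T)) ⟩
      T * z * (T * N ^ T) + T * z * (T * N ^ T)            ≡⟨ lemma T z (N ^ T) ⟩
      V * (z * 1)                                          ∎
      where
      open ≤-Reasoning
      lemma : ∀ t z p → t * z * (t * p) + t * z * (t * p) ≡ 2 * (p * (t * t)) * (z * 1)
      lemma = solve-∀
    ... | no _ = ≤-trans (second-moment T (pos j φ) (pos j φ′)) (split (pos j φ ≟ pos j φ′))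
      where
      open ≤-Reasoning
      lemma₁ : ∀ t z p → p * (t * t * z + 1 * (t * (t * z))) ≡ 2 * (p * (t * t)) * (z * 1)
      lemma₁ = solve-∀
      lemma₂ : ∀ t p → p * (t * t + 0) + p * (t * t) ≡ 2 * (p * (t * t)) * 1
      lemma₂ = solve-∀
      split : ∀ {P : Set} (d : Dec P) → N ^ T * (T * T + ⟦ d ⟧ * (T * N)) ≤ V * z ^ ⟦ d ⟧
      split (yes _) = begin
        N ^ T * (T * T + 1 * (T * N))            ≤⟨ *-monoʳ-≤ (N ^ T) (+-mono-≤ (m≤m*n (T * T) z)
                                                      (*-monoʳ-≤ 1 (*-monoʳ-≤ T N≤Tz))) ⟩
        N ^ T * (T * T * z + 1 * (T * (T * z)))  ≡⟨ lemma₁ T z (N ^ T) ⟩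
        V * (z * 1)                              ∎
      split (no _) = begin
        N ^ T * (T * T + 0)                      ≤⟨ m≤m+n _ (N ^ T * (T * T)) ⟩
        N ^ T * (T * T + 0) + N ^ T * (T * T)    ≡⟨ lemma₂ T (N ^ T) ⟩
        V * 1                                    ∎

    agree? : ∀ (φ φ′ : Φ) x → Dec (lookup φ x ≡ lookup φ′ x)
    agree? φ φ′ x = lookup φ x Fin.≟ lookup φ′ x

    -- Positions where φ and φ′ agree are edges inside the set U of vertices where they agree.
    -- `sparse` trades their factors z for k ^ ∣ U ∣, which `∑-agreement` can sum.
    overlap-bound : ∀ i φ φ′ →
      k * k * ((N * N) ^ ℓ * (∑[ ω ∈ samples ] ⟦ pos i φ ≟ pos i φ′ ⟧ * ∏ (pair φs pos (counts ω) i φ φ′))) ≤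
      z * (V ^ ℓ * ∏ (λ x → k ^ ⟦ agree? φ φ′ x ⟧))
    overlap-bound i φ φ′ with pos i φ ≟ pos i φ′
    ... | no _ = ≤-trans (≤-reflexive (trans
        (cong (λ t → k * k * ((N * N) ^ ℓ * t)) (∑-zero samples))
        (trans (cong (k * k *_) (*-zeroʳ ((N * N) ^ ℓ))) (*-zeroʳ (k * k))))) z≤n
    ... | yes eq = begin
      k * k * ((N * N) ^ ℓ * (∑[ ω ∈ samples ] 1 * ∏ (pair φs pos (counts ω) i φ φ′)))
        ≡⟨ cong (λ t → k * k * ((N * N) ^ ℓ * t)) (trans (∑-cong samples λ ω → *-identityˡ _)
             (∑-vectors-∏ ℓ (vectors ys T) λ j w → pair φs pos (λ _ → count w) i φ φ′ j)) ⟩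
      k * k * ((N * N) ^ ℓ * ∏ (λ j → ∑[ w ∈ vectors ys T ] pair φs pos (λ _ → count w) i φ φ′ j))
        ≡⟨ cong (k * k *_) (trans (cong (_* ∏ moment) (sym (∏-const ℓ (N * N))))
             (sym (∏-* {ℓ} (λ _ → N * N) moment))) ⟩
      k * k * ∏ (λ j → N * N * moment j)
        ≤⟨ *-monoʳ-≤ (k * k) (∏-mono (pair-moment i φ φ′ eq)) ⟩
      k * k * ∏ (λ j → V * z ^ ⟦ pos j φ ≟ pos j φ′ ⟧)
        ≡⟨ cong (k * k *_) (trans (∏-* {ℓ} (λ _ → V) _)
             (cong₂ _*_ (∏-const ℓ V) (∏-^ z (λ j → ⟦ pos j φ ≟ pos j φ′ ⟧)))) ⟩
      k * k * (V ^ ℓ * z ^ (∑[ j ∈ allFin ℓ ] ⟦ pos j φ ≟ pos j φ′ ⟧))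
        ≤⟨ *-monoʳ-≤ (k * k) (*-monoʳ-≤ (V ^ ℓ) (^-monoʳ-≤ z (∑-mono (allFin ℓ) λ j →
             ⟦⟧-mono (pos j φ ≟ pos j φ′) ((s j ∈? U) ×-dec (t j ∈? U)) in-U))) ⟩
      k * k * (V ^ ℓ * z ^ (∑[ j ∈ allFin ℓ ] ⟦ (s j ∈? U) ×-dec (t j ∈? U) ⟧))
        ≡⟨ lemma (k * k) (V ^ ℓ) _ ⟩
      V ^ ℓ * (k * k * z ^ (∑[ j ∈ allFin ℓ ] ⟦ (s j ∈? U) ×-dec (t j ∈? U) ⟧))
        ≤⟨ *-monoʳ-≤ (V ^ ℓ) (sparse U i (proj₁ (in-U eq)) (proj₂ (in-U eq))) ⟩
      V ^ ℓ * (z * k ^ ∣ U ∣)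
        ≡⟨ lemma (V ^ ℓ) z _ ⟩
      z * (V ^ ℓ * k ^ ∣ U ∣)
        ≡⟨ cong (λ t → z * (V ^ ℓ * t)) (trans (sym (∏-∣∣ k U)) (∏-cong λ x → cong (k ^_)
             (⟦⟧-cong (x ∈? U) (agree? φ φ′ x) (∈⁅⁆ᵈ⁻ (agree? φ φ′)) (∈⁅⁆ᵈ⁺ (agree? φ φ′))))) ⟩
      z * (V ^ ℓ * ∏ (λ x → k ^ ⟦ agree? φ φ′ x ⟧)) ∎
      where
      open ≤-Reasoning
      lemma : ∀ a b c → a * (b * c) ≡ b * (a * c)
      lemma = solve-∀
      moment : Fin ℓ → ℕ
      moment j = ∑[ w ∈ vectors ys T ] pair φs pos (λ _ → count w) i φ φ′ j
      U : Subset v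
      U = ⁅ agree? φ φ′ ⁆ᵈ
      in-U : ∀ {j} → pos j φ ≡ pos j φ′ → s j ∈ U × t j ∈ U
      in-U eq = ∈⁅⁆ᵈ⁺ (agree? φ φ′) (cong proj₁ eq) , ∈⁅⁆ᵈ⁺ (agree? φ φ′) (cong proj₂ eq)

    expected-overlaps : k * k * ((N * N) ^ ℓ * (∑[ ω ∈ samples ] overlaps φs pos (counts ω))) ≤
                        ℓ * (z * (V ^ ℓ * (k ^ v * (k + k) ^ v)))
    expected-overlaps = begin
      k * k * ((N * N) ^ ℓ * (∑[ ω ∈ samples ] overlaps φs pos (counts ω)))
        ≡⟨ sym (*-assoc (k * k) _ _) ⟩
      c * (∑[ ω ∈ samples ] ∑[ i ∈ allFin ℓ ] ∑[ φ ∈ φs ] ∑[ φ′ ∈ φs ] term ω i φ φ′)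
        ≡⟨ cong (c *_) (trans (∑-comm samples (allFin ℓ) _) (∑-cong (allFin ℓ) λ i →
             trans (∑-comm samples φs _) (∑-cong φs λ φ → ∑-comm samples φs _))) ⟩
      c * (∑[ i ∈ allFin ℓ ] ∑[ φ ∈ φs ] ∑[ φ′ ∈ φs ] ∑[ ω ∈ samples ] term ω i φ φ′)
        ≡⟨ sym (trans (∑-cong (allFin ℓ) λ i → trans (∑-cong φs λ φ → ∑-*ˡ φs c _) (∑-*ˡ φs c _))
             (∑-*ˡ (allFin ℓ) c _)) ⟩
      ∑[ i ∈ allFin ℓ ] ∑[ φ ∈ φs ] ∑[ φ′ ∈ φs ] c * (∑[ ω ∈ samples ] term ω i φ φ′)
        ≤⟨ ∑-mono (allFin ℓ) (λ i → ∑-mono φs λ φ → ∑-mono φs λ φ′ →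
             ≤-trans (≤-reflexive (*-assoc (k * k) _ _)) (overlap-bound i φ φ′)) ⟩
      ∑[ _ ∈ allFin ℓ ] ∑[ φ ∈ φs ] ∑[ φ′ ∈ φs ] z * (V ^ ℓ * ∏ (λ x → k ^ ⟦ agree? φ φ′ x ⟧))
        ≡⟨ ∑-const (allFin ℓ) _ ⟩
      length (allFin ℓ) * (∑[ φ ∈ φs ] ∑[ φ′ ∈ φs ] z * (V ^ ℓ * ∏ (λ x → k ^ ⟦ agree? φ φ′ x ⟧)))
        ≡⟨ cong₂ _*_ (length-allFin ℓ) (trans
             (∑-cong φs λ φ → trans (∑-*ˡ φs z _) (cong (z *_) (∑-*ˡ φs (V ^ ℓ) _)))
             (trans (∑-*ˡ φs z _) (cong (z *_) (∑-*ˡ φs (V ^ ℓ) _)))) ⟩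
      ℓ * (z * (V ^ ℓ * (∑[ φ ∈ φs ] ∑[ φ′ ∈ φs ] ∏ (λ x → k ^ ⟦ agree? φ φ′ x ⟧))))
        ≤⟨ *-monoʳ-≤ ℓ (*-monoʳ-≤ z (*-monoʳ-≤ (V ^ ℓ) ∑-agreement)) ⟩
      ℓ * (z * (V ^ ℓ * (k ^ v * (k + k) ^ v))) ∎
      where
      open ≤-Reasoning
      c = k * k * (N * N) ^ ℓ
      term : Vec (Vec Y T) ℓ → Fin ℓ → Φ → Φ → ℕ
      term ω i φ φ′ = ⟦ pos i φ ≟ pos i φ′ ⟧ * ∏ (pair φs pos (counts ω) i φ φ′)

-- The lower bound

∑-lookup : ∀ {A : Set} (xs : List A) (f : A → ℕ) → ∑ (allFin (length xs)) (f ∘ List.lookup xs) ≡ ∑ xs f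
∑-lookup xs f = trans (sym (∑-tabulate (f ∘ List.lookup xs)))
  (cong sum (trans (sym (map-tabulate (List.lookup xs) f)) (cong (List.map f) (tabulate-lookup xs))))

∑-filter : ∀ {A : Set} {P : A → Set} (P? : Decidable P) xs (f : A → ℕ) →
           ∑ (filter P? xs) f ≡ ∑[ x ∈ xs ] ⟦ P? x ⟧ * f x
∑-filter P? []       f = refl
∑-filter P? (x ∷ xs) f with P? x
... | yes _ = cong₂ _+_ (sym (*-identityˡ (f x))) (∑-filter P? xs f)
... | no _  = ∑-filter P? xs f

joins-determines : ∀ {n} {f g : Edge n} {i j} → Joins f i j → Joins g i j → f ≡ g
joins-determines (inj₁ (p , q)) (inj₁ (r , s)) = edge-≡ (trans p (sym r)) (trans q (sym s))
joins-determines (inj₂ (p , q)) (inj₂ (r , s)) = edge-≡ (trans p (sym r)) (trans q (sym s))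
joins-determines {f = f} {g} (inj₁ (refl , refl)) (inj₂ (r , s)) =
  contradiction (subst₂ Fin._<_ r s (src<tgt g)) (Fin.<-asym (src<tgt f))
joins-determines {f = f} {g} (inj₂ (refl , refl)) (inj₁ (r , s)) =
  contradiction (subst₂ Fin._<_ r s (src<tgt g)) (Fin.<-asym (src<tgt f))

joins-endpoints : ∀ {n} {f : Edge n} {i j i′ j′} → Joins f i j → Joins f i′ j′ →
                  (i ≡ i′ × j ≡ j′) ⊎ (i ≡ j′ × j ≡ i′)
joins-endpoints (inj₁ (refl , refl)) (inj₁ h)       = inj₁ h
joins-endpoints (inj₁ (refl , refl)) (inj₂ h)       = inj₂ h
joins-endpoints (inj₂ (refl , refl)) (inj₁ (p , q)) = inj₂ (q , p)
joins-endpoints (inj₂ (refl , refl)) (inj₂ (p , q)) = inj₁ (q , p)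

-- A, P and Q are the sums of the numbers of copies, bad samples and pairs of copies sharing a
-- sample over all Ω ^ ℓ outcomes.
moments⇒bias : ∀ {N T z k v ℓ q Ω A P Q} .⦃ _ : NonZero k ⦄ .⦃ _ : NonZero T ⦄ .⦃ _ : NonZero Ω ⦄ →
  N ≡ k * k → T * z ≤ 2 * N → A * A ≤ P * Q →
  N ^ ℓ * A ≡ k ^ v * (T * Ω) ^ ℓ →
  N * P ≤ ℓ * T * (q * (ℓ * T)) * Ω ^ ℓ →
  k * k * ((N * N) ^ ℓ * Q) ≤ ℓ * (z * ((2 * (Ω * (T * T))) ^ ℓ * (k ^ v * (k + k) ^ v))) →
  z ≤ 4 * (ℓ * ℓ * ℓ * 2 ^ ℓ * 2 ^ v) * q
moments⇒bias {N} {T} {z} {k} {v} {ℓ} {q} {Ω} {A} {P} {Q} refl Tz≤2N A²≤PQ eA eP eQ =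
  *-cancelˡ-≤ (N * N) ⦃ m*n≢0 N N ⦃ m*n≢0 k k ⦄ ⦃ m*n≢0 k k ⦄ ⦄ (begin
    -- The additional factor z completes (T * z)², and T * z ≤ 2 * N then produces the 4.
    N * N * z                    ≤⟨ *-monoˡ-≤ z N²≤ ⟩
    C * q * z * (T * T) * z      ≡⟨ lemma₁ C q z T ⟩
    C * q * ((T * z) * (T * z))  ≤⟨ *-monoʳ-≤ (C * q) (*-mono-≤ Tz≤2N Tz≤2N) ⟩
    C * q * ((2 * N) * (2 * N))  ≡⟨ lemma₂ C q N ⟩
    N * N * (4 * C * q)          ∎)
  where
  open ≤-Reasoning
  C = ℓ * ℓ * ℓ * 2 ^ ℓ * 2 ^ v
  K = k ^ v
  τ = T ^ ℓ
  o = Ω ^ ℓ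
  X = K * (τ * o)

  lemma₁ : ∀ C q z T → C * q * z * (T * T) * z ≡ C * q * ((T * z) * (T * z))
  lemma₁ = solve-∀
  lemma₂ : ∀ C q N → C * q * ((2 * N) * (2 * N)) ≡ N * N * (4 * C * q)
  lemma₂ = solve-∀
  lemma₃ : ∀ n A N → (n * A) * (n * A) * (N * N) ≡ N * (N * (n * n * (A * A)))
  lemma₃ = solve-∀
  lemma₄ : ∀ n P Q N → N * (N * (n * n * (P * Q))) ≡ (N * P) * (N * (n * n * Q))
  lemma₄ = solve-∀
  lemma₅ : ∀ ℓ T q o z e τ K h →
    (ℓ * T * (q * (ℓ * T)) * o) * (ℓ * (z * ((e * (o * (τ * τ))) * (K * (h * K))))) ≡
    (K * (τ * o)) * (K * (τ * o)) * ((ℓ * ℓ * ℓ * e * h) * q * z * (T * T))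
  lemma₅ = solve-∀

  eA′ : N ^ ℓ * A ≡ X
  eA′ = trans eA (cong (K *_) (^-distribʳ-* T Ω ℓ))

  eQ′ : N * (N ^ ℓ * N ^ ℓ * Q) ≤ ℓ * (z * ((2 ^ ℓ * (o * (τ * τ))) * (K * (2 ^ v * K))))
  eQ′ = begin
    N * (N ^ ℓ * N ^ ℓ * Q)
      ≡⟨ cong (λ t → N * (t * Q)) (^-distribʳ-* N N ℓ) ⟨
    N * ((N * N) ^ ℓ * Q)
      ≤⟨ eQ ⟩
    ℓ * (z * ((2 * (Ω * (T * T))) ^ ℓ * (k ^ v * (k + k) ^ v)))
      ≡⟨ cong₂ (λ a b → ℓ * (z * (a * (K * b))))
           (trans (^-distribʳ-* 2 _ ℓ) (cong (2 ^ ℓ *_)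
             (trans (^-distribʳ-* Ω (T * T) ℓ) (cong (o *_) (^-distribʳ-* T T ℓ)))))
           (trans (cong (_^ v) (cong (k +_) (sym (+-identityʳ k)))) (^-distribʳ-* 2 k v)) ⟩
    ℓ * (z * ((2 ^ ℓ * (o * (τ * τ))) * (K * (2 ^ v * K)))) ∎

  instance
    X≢0 : NonZero X
    X≢0 = m*n≢0 K (τ * o) ⦃ m^n≢0 k v ⦄ ⦃ m*n≢0 τ o ⦃ m^n≢0 T ℓ ⦄ ⦃ m^n≢0 Ω ℓ ⦄ ⦄

  -- All three moments are inserted into A * A ≤ P * Q; the squared number of copies X * X occurs on
  -- both sides and cancels.
  N²≤ : N * N ≤ C * q * z * (T * T)
  N²≤ = *-cancelˡ-≤ (X * X) ⦃ m*n≢0 X X ⦄ (begin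
    X * X * (N * N)                          ≡⟨ cong (λ t → t * t * (N * N)) eA′ ⟨
    (N ^ ℓ * A) * (N ^ ℓ * A) * (N * N)      ≡⟨ lemma₃ (N ^ ℓ) A N ⟩
    N * (N * (N ^ ℓ * N ^ ℓ * (A * A)))      ≤⟨ *-monoʳ-≤ N (*-monoʳ-≤ N (*-monoʳ-≤ (N ^ ℓ * N ^ ℓ) A²≤PQ)) ⟩
    N * (N * (N ^ ℓ * N ^ ℓ * (P * Q)))      ≡⟨ lemma₄ (N ^ ℓ) P Q N ⟩
    (N * P) * (N * (N ^ ℓ * N ^ ℓ * Q))      ≤⟨ *-mono-≤ eP eQ′ ⟩
    (ℓ * T * (q * (ℓ * T)) * o) * (ℓ * (z * ((2 ^ ℓ * (o * (τ * τ))) * (K * (2 ^ v * K)))))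
                                             ≡⟨ lemma₅ ℓ T q o z (2 ^ ℓ) τ K (2 ^ v) ⟩
    X * X * (C * q * z * (T * T))            ∎)

module _ (H : Graph) where

  edgeList : List (Edge (v H))
  edgeList = filter (_∈? E H) (allFin (size (v H)))

  private
    ℓ = length edgeList

    edge : Fin ℓ → Edge (v H)
    edge = List.lookup edgeList

    s t : Fin ℓ → Fin (v H)
    s = src ∘ edge
    t = tgt ∘ edge

  biasConstant : ℕ
  biasConstant = 4 * (ℓ * ℓ * ℓ * 2 ^ ℓ * 2 ^ v H)

  module _ (n q k T z : ℕ) ⦃ _ : NonZero k ⦄ ⦃ _ : NonZero T ⦄ ⦃ _ : NonZero z ⦄
    (vk≤n : v H * k ≤ n) (N≤Tz : k * k ≤ T * z) (Tz≤2N : T * z ≤ 2 * (k * k)) where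

    open BudgetGame H n q
    open Sampling s t k T z N≤Tz
    open RandomPlay H n q

    place : Fin (v H) → Fin k → Fin n
    place x u = Fin.inject≤ (Fin.combine x u) vk≤n

    place-injective : ∀ {x u x′ u′} → place x u ≡ place x′ u′ → x ≡ x′ × u ≡ u′
    place-injective {x} {u} {x′} {u′} eq =
      Fin.combine-injective x u x′ u′ (Fin.inject≤-injective vk≤n vk≤n _ _ eq)

    between : ∀ j (y : Y) → ∃ λ g → Joins g (place (s j) (proj₁ y)) (place (t j) (proj₂ y))
    between j y = edgeBetween (src≢tgt (edge j) ∘ proj₁ ∘ place-injective)

    target : Fin ℓ → Y → Edge n
    target j y = proj₁ (between j y)

    target-injective : ∀ j {y y′} → target j y ≡ target j y′ → y ≡ y′
    target-injective j {y} {y′} eq with joins-endpoints (proj₂ (between j y))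
      (subst (λ g → Joins g (place (s j) (proj₁ y′)) (place (t j) (proj₂ y′))) (sym eq) (proj₂ (between j y′)))
    ... | inj₁ (p , q) = cong₂ _,_ (proj₂ (place-injective p)) (proj₂ (place-injective q))
    ... | inj₂ (p , _) = contradiction (proj₁ (place-injective p)) (src≢tgt (edge j))

    -- One vertex from each block gives a copy of H, and any edge in which Breaker hits it is the
    -- target of some position.
    spoiled : ∀ {B} → HitsEveryCopy B → ∀ φ → ∃ λ j → target j (pos j φ) ∈ B
    spoiled {B} hits φ =
      let (f , f∈) = hits F copy
          (f∈F , f∈B) = x∈p∩q⁻ F B f∈
          (a , a∈E , joins) = ∈⁅⁆ᵈ⁻ inImage? f∈F
          (j , edge-j≡a) = position (∈-filter⁺ (_∈? E H) (∈-allFin a) a∈E)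
      in j , subst (_∈ B) (joins-determines
        (subst (λ a → Joins f (ψ (src a)) (ψ (tgt a))) (sym edge-j≡a) joins)
        (proj₂ (between j (pos j φ)))) f∈B
      where
      ψ : Fin (v H) → Fin n
      ψ x = place x (lookup φ x)
      InImage : Edge n → Set
      InImage f = ∃ λ a → a ∈ E H × Joins f (ψ (src a)) (ψ (tgt a))
      inImage? : Decidable InImage
      inImage? f = any? λ a → (a ∈? E H) ×-dec joins? f (ψ (src a)) (ψ (tgt a))
      F : EdgeSet n
      F = ⁅ inImage? ⁆ᵈ
      copy : IsCopy H F
      copy = ψ , (proj₁ ∘ place-injective) , λ f → mk⇔ (∈⁅⁆ᵈ⁻ inImage?) (∈⁅⁆ᵈ⁺ inImage?)

    bias-lower : BreakerWins →
      (∀ (U : Subset (v H)) i → s i ∈ U → t i ∈ U →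
        k * k * z ^ (∑[ j ∈ allFin ℓ ] ⟦ (s j ∈? U) ×-dec (t j ∈? U) ⟧) ≤ z * k ^ ∣ U ∣) →
      z ≤ biasConstant * q
    bias-lower wins sparse =
      let (out , hits , few) = play-blocks ys ys-unique _≟_ ys-complete wins T target target-injective
      in moments⇒bias {k = k} {v = v H} {ℓ = ℓ}
           N≡k² (subst (λ N → T * z ≤ 2 * N) (sym N≡k²) Tz≤2N)
           (discriminant (quadratic out hits)) expected-copies
           (≤-trans few (≤-reflexive (cong (ℓ * T * (q * (ℓ * T)) *_)
             (trans (cong (N ^_) (*-comm ℓ T)) (sym (^-*-assoc N T ℓ))))))
           (expected-overlaps sparse)
      where
      instance
        Ω≢0 : NonZero (N ^ T)
        Ω≢0 = m^n≢0 N T ⦃ subst NonZero (sym N≡k²) (m*n≢0 k k) ⦄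

      quadratic : (out : Vec (Vec Y T) ℓ → EdgeSet n) → (∀ ω → HitsEveryCopy (out ω)) → ∀ x y →
        2 * (x * y) * (∑[ ω ∈ samples ] ∑[ φ ∈ φs ] ∏ λ i → counts ω i (pos i φ)) ≤
        x * x * (∑[ ω ∈ samples ] blockHits ys ys-unique _≟_ ys-complete target ω (out ω)) +
        y * y * (∑[ ω ∈ samples ] overlaps φs pos (counts ω))
      quadratic out hits x y = begin
        2 * (x * y) * (∑[ ω ∈ samples ] ∑[ φ ∈ φs ] ∏ λ i → counts ω i (pos i φ))
          ≡⟨ ∑-*ˡ samples (2 * (x * y)) _ ⟨
        ∑[ ω ∈ samples ] 2 * (x * y) * (∑[ φ ∈ φs ] ∏ λ i → counts ω i (pos i φ))
          ≤⟨ ∑-mono samples (λ ω → cauchy-schwarz φs pos (counts ω) (bad ω) (bad≤ ω) (all-bad ω) x y) ⟩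
        ∑[ ω ∈ samples ] x * x * (∑[ i ∈ allFin ℓ ] ∑[ u ∈ ys ] bad ω i u) + y * y * overlaps φs pos (counts ω)
          ≡⟨ trans (∑-+ samples _ _) (cong₂ _+_ (∑-*ˡ samples (x * x) _) (∑-*ˡ samples (y * y) _)) ⟩
        x * x * (∑[ ω ∈ samples ] blockHits ys ys-unique _≟_ ys-complete target ω (out ω)) +
        y * y * (∑[ ω ∈ samples ] overlaps φs pos (counts ω)) ∎
        where
        open ≤-Reasoning
        bad : Vec (Vec Y T) ℓ → Fin ℓ → Y → ℕ
        bad ω i u = count (lookup ω i) u * ⟦ target i u ∈? out ω ⟧
        bad≤ : ∀ ω i u → bad ω i u ≤ counts ω i u
        bad≤ ω i u = ≤-trans (*-monoʳ-≤ (counts ω i u) (⟦⟧≤1 (target i u ∈? out ω)))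
                             (≤-reflexive (*-identityʳ _))
        all-bad : ∀ ω φ → ∃ λ i → bad ω i (pos i φ) ≡ counts ω i (pos i φ)
        all-bad ω φ = let (i , i∈) = spoiled (hits ω) φ in
          i , trans (cong (counts ω i (pos i φ) *_) (⟦⟧-yes (target i (pos i φ) ∈? out ω) i∈)) (*-identityʳ _)

  -- The edge `i` gives U two vertices, which settles the case of at most one edge. With two or more
  -- edges the induced subgraph counts in m(H).
  induced-sparse : ∀ {a b z k} .⦃ _ : NonZero a ⦄ .⦃ _ : NonZero z ⦄ .⦃ _ : NonZero k ⦄ →
    (∀ {W F} → IsSubgraph H (W , F) → ∀ κ f → ∣ W ∣ ≡ 3 + κ → ∣ F ∣ ≡ suc f → b * f ≤ a * suc κ) →
    z ^ a ≤ k ^ b → ∀ (U : Subset (v H)) i → s i ∈ U → t i ∈ U →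
    k * k * z ^ (∑[ j ∈ allFin ℓ ] ⟦ (s j ∈? U) ×-dec (t j ∈? U) ⟧) ≤ z * k ^ ∣ U ∣
  induced-sparse {a} {b} {z} {k} density z^a≤k^b U i s∈ t∈ =
    ≤-trans (*-monoʳ-≤ (k * k) (^-monoʳ-≤ z edges≤)) (cases ∣ F ∣ refl)
    where
    open ≤-Reasoning

    inF? : Decidable λ c → c ∈ E H × (src c ∈ U × tgt c ∈ U)
    inF? c = (c ∈? E H) ×-dec ((src c ∈? U) ×-dec (tgt c ∈? U))

    F : EdgeSet (v H)
    F = ⁅ inF? ⁆ᵈ

    edges≤ : ∑[ j ∈ allFin ℓ ] ⟦ (s j ∈? U) ×-dec (t j ∈? U) ⟧ ≤ ∣ F ∣
    edges≤ = begin
      ∑[ j ∈ allFin ℓ ] ⟦ (s j ∈? U) ×-dec (t j ∈? U) ⟧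
        ≡⟨ ∑-lookup edgeList (λ c → ⟦ (src c ∈? U) ×-dec (tgt c ∈? U) ⟧) ⟩
      ∑[ c ∈ edgeList ] ⟦ (src c ∈? U) ×-dec (tgt c ∈? U) ⟧
        ≡⟨ ∑-filter (_∈? E H) (allFin (size (v H))) _ ⟩
      ∑[ c ∈ allFin (size (v H)) ] ⟦ c ∈? E H ⟧ * ⟦ (src c ∈? U) ×-dec (tgt c ∈? U) ⟧
        ≤⟨ ∑-mono (allFin (size (v H))) both ⟩
      ∑[ c ∈ allFin (size (v H)) ] ⟦ c ∈? F ⟧
        ≡⟨ ∣∣-∑ F ⟨
      ∣ F ∣ ∎
      where
      both : ∀ c → ⟦ c ∈? E H ⟧ * ⟦ (src c ∈? U) ×-dec (tgt c ∈? U) ⟧ ≤ ⟦ c ∈? F ⟧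
      both c with c ∈? E H
      ... | no _   = z≤n
      ... | yes c∈ = ≤-trans (≤-reflexive (*-identityˡ _))
        (⟦⟧-mono ((src c ∈? U) ×-dec (tgt c ∈? U)) (c ∈? F) λ h → ∈⁅⁆ᵈ⁺ inF? (c∈ , h))

    sub : IsSubgraph H (U , F)
    sub = (proj₁ ∘ ∈⁅⁆ᵈ⁻ inF?) , λ c c∈ → proj₂ (∈⁅⁆ᵈ⁻ inF? c∈)

    2≤∣U∣ : 2 ≤ ∣ U ∣
    2≤∣U∣ = ≤-trans (s≤s (≤-<-trans z≤n (x∈p⇒∣p-x∣<∣p∣ (x∈p∧x≢y⇒x∈p-y t∈ (src≢tgt (edge i) ∘ sym)))))
                    (x∈p⇒∣p-x∣<∣p∣ s∈)

    few : ∀ {c} → c ≤ 1 → k * k * z ^ c ≤ z * k ^ ∣ U ∣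
    few {c} c≤1 = begin
      k * k * z ^ c      ≤⟨ *-monoʳ-≤ (k * k) (≤-trans (^-monoʳ-≤ z c≤1) (≤-reflexive (*-identityʳ z))) ⟩
      k * k * z          ≡⟨ *-comm (k * k) z ⟩
      z * (k * k)        ≡⟨ cong (λ t → z * (k * t)) (*-identityʳ k) ⟨
      z * k ^ 2          ≤⟨ *-monoʳ-≤ z (^-monoʳ-≤ k 2≤∣U∣) ⟩
      z * k ^ ∣ U ∣      ∎

    cases : ∀ c → ∣ F ∣ ≡ c → k * k * z ^ c ≤ z * k ^ ∣ U ∣
    cases zero          _    = few z≤n
    cases (suc zero)    _    = few ≤-refl
    cases (suc (suc f)) ∣F∣≡ = begin
      k * k * (z * z ^ suc f)    ≤⟨ *-monoʳ-≤ (k * k) (*-monoʳ-≤ z (^-root-≤ {a} {b} z^a≤k^b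
                                      (density sub κ (suc f) ∣U∣≡ ∣F∣≡))) ⟩
      k * k * (z * k ^ suc κ)    ≡⟨ lemma k z (k ^ suc κ) ⟩
      z * k ^ (3 + κ)            ≡⟨ cong (λ t → z * k ^ t) ∣U∣≡ ⟨
      z * k ^ ∣ U ∣              ∎
      where
      lemma : ∀ k z t → k * k * (z * t) ≡ z * (k * (k * t))
      lemma = solve-∀
      κ = ∣ U ∣ ∸ 3
      ∣U∣≡ : ∣ U ∣ ≡ 3 + κ
      ∣U∣≡ = sym (m+[n∸m]≡n (2≤∣F∣⇒3≤∣W∣ U F (proj₂ sub) (≤-trans (s≤s (s≤s z≤n)) (≤-reflexive (sym ∣F∣≡)))))

m<[1+m/n]*n : ∀ m n .⦃ _ : NonZero n ⦄ → m < suc (m / n) * n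
m<[1+m/n]*n m n = subst (_< suc (m / n) * n) (sym (m≡m%n+[m/n]*n m n)) (+-monoˡ-< (m / n * n) (m%n<n m n))

-- Here z is the integer part of k^{b/a}, and T is that of k²/z plus 1, so that k² ≤ Tz ≤ 2k². The
-- last estimate needs z ≤ k², which is where b ≤ a * 2, that is m(H) ≥ 1/2, enters.
breakerWins⇒root≤ : ∀ H {a b} .⦃ _ : NonZero a ⦄ →
  (∀ {W F} → IsSubgraph H (W , F) → ∀ κ f → ∣ W ∣ ≡ 3 + κ → ∣ F ∣ ≡ suc f → b * f ≤ a * suc κ) →
  b ≤ a * 2 → ∀ {n q k} → BudgetGame.BreakerWins H n q → 0 < k → v H * k ≤ n →
  k ^ b ≤ (2 * (biasConstant H * q)) ^ a
breakerWins⇒root≤ H {a} {b} density b≤2a {n} {q} {k@(suc _)} wins 0<k vk≤n with root a (k ^ b)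
... | z , z^a≤ , k^b< with 1≤root {a} (m^n>0 k b) k^b<
...   | s≤s {n = z′} _ = begin
  k ^ b                                  ≤⟨ <⇒≤ k^b< ⟩
  suc z ^ a                              ≤⟨ ^-monoˡ-≤ a (+-mono-≤ {1} {z} {z} {z + 0} (s≤s z≤n) (m≤m+n z 0)) ⟩
  (2 * z) ^ a                            ≤⟨ ^-monoˡ-≤ a (*-monoʳ-≤ 2 (bias-lower H n q k (suc (k * k / z)) z
                                              vk≤n (<⇒≤ (m<[1+m/n]*n (k * k) z)) Tz≤2N wins
                                              (induced-sparse H {a} {b} density z^a≤))) ⟩
  (2 * (biasConstant H * q)) ^ a         ∎
  where
  open ≤-Reasoning
  z≤k² : z ≤ k * k
  z≤k² = begin
    z       ≡⟨ *-identityʳ z ⟨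
    z ^ 1   ≤⟨ ^-root-≤ {a} {b} {1} {2} z^a≤ (≤-trans (≤-reflexive (*-identityʳ b)) b≤2a) ⟩
    k ^ 2   ≡⟨ cong (k *_) (*-identityʳ k) ⟩
    k * k   ∎
  Tz≤2N : suc (k * k / z) * z ≤ 2 * (k * k)
  Tz≤2N = ≤-trans (+-mono-≤ z≤k² (m/n*n≤m (k * k) z)) (≤-reflexive (cong (k * k +_) (sym (+-identityʳ (k * k)))))

breakerWins⇒bias≥ : ∀ H {a b} .⦃ _ : NonZero (v H) ⦄ → 0 < a →
  (∀ {W F} → IsSubgraph H (W , F) → ∀ κ f → ∣ W ∣ ≡ 3 + κ → ∣ F ∣ ≡ suc f → b * f ≤ a * suc κ) →
  b ≤ a * 2 → ∀ {n q} → BudgetGame.BreakerWins H n q → v H ≤ n →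
  n ^ b ≤ (suc ((2 * v H) ^ b * (2 * biasConstant H)) * q) ^ a
breakerWins⇒bias≥ H {a@(suc a′)} {b} _ density b≤2a {n} {q} wins v≤n = begin
  n ^ b                                          ≤⟨ ^-monoˡ-≤ b n≤2vk ⟩
  (2 * v H * k) ^ b                              ≡⟨ ^-distribʳ-* (2 * v H) k b ⟩
  -- The loss c from rounding n down to a multiple of v H is absorbed into the a-th power by c ≤ c ^
  -- a.
  c * k ^ b                                      ≤⟨ *-mono-≤ (m≤m*n c (c ^ a′) ⦃ m^n≢0 c a′ ⦃ c≢0 ⦄ ⦄)
                                                      (breakerWins⇒root≤ H {a} {b} density b≤2a wins 0<k vk≤n) ⟩
  c ^ a * (2 * (biasConstant H * q)) ^ a         ≡⟨ ^-distribʳ-* c (2 * (biasConstant H * q)) a ⟨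
  -- The successor makes the constant visibly positive, as Θ demands.
  (c * (2 * (biasConstant H * q))) ^ a           ≤⟨ ^-monoˡ-≤ a (≤-trans (≤-reflexive (lemma c (biasConstant H) q))
                                                      (*-monoˡ-≤ q (n≤1+n (c * (2 * biasConstant H))))) ⟩
  (suc (c * (2 * biasConstant H)) * q) ^ a       ∎
  where
  open ≤-Reasoning
  lemma : ∀ c d q → c * (2 * (d * q)) ≡ c * (2 * d) * q
  lemma = solve-∀
  k = n / v H
  c = (2 * v H) ^ b
  c≢0 : NonZero c
  c≢0 = m^n≢0 (2 * v H) b ⦃ m*n≢0 2 (v H) ⦄
  0<k : 0 < k
  0<k = n≢0⇒n>0 λ k≡0 → <⇒≱ (subst (λ k → n < suc k * v H) k≡0 (m<[1+m/n]*n n (v H)))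
    (≤-trans (≤-reflexive (+-identityʳ (v H))) v≤n)
  vk≤n : v H * k ≤ n
  vk≤n = ≤-trans (≤-reflexive (*-comm (v H) k)) (m/n*n≤m n (v H))
  n≤2vk : n ≤ 2 * v H * k
  n≤2vk = begin
    n                ≤⟨ <⇒≤ (m<[1+m/n]*n n (v H)) ⟩
    (1 + k) * v H    ≤⟨ *-monoˡ-≤ (v H) (+-monoˡ-≤ k 0<k) ⟩
    (k + k) * v H    ≡⟨ lemma₂ k (v H) ⟩
    2 * v H * k      ∎
    where
    lemma₂ : ∀ k v → (k + k) * v ≡ 2 * v * k
    lemma₂ = solve-∀

proposition1p7 :
  (H : Graph) (2≤e : 2 ≤ e H) →
  thresholdBias H 2≤e =Θ[n^1/ m H ]
proposition1p7 H 2≤e =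
  let (C , 0<C , upper) = thresholdBias-upper H 2≤e
  -- From n = v H on, each of the v H blocks can be given a vertex.
  in suc ((2 * v H) ^ m-den H * (2 * biasConstant H)) , C , v H , s≤s z≤n , 0<C , λ n v≤n →
     breakerWins⇒bias≥ H (0<m-num H 2≤e) (m-upper H) (m-den≤2*m-num H 2≤e)
       (proj₁ (thresholdBias-spec H 2≤e n)) v≤n ,
     upper n (≤-trans (>-nonZero⁻¹ (v H)) v≤n)
  where
  instance
    v≢0 : NonZero (v H)
    v≢0 = let (a , _) = two-elements (E H) 2≤e in Fin.nonZeroIndex (src a)
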